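{- Let $K$ be a finite pure $k$-dimensional simplicial complex ($k\ge1$) on the vertex set $[n]=\{1,\dots,n\}$. Then $$\lambda(K)=d^{\mathrm v}(K)^{\mathsf T}$$ if and only if $K$ is isomorphic to a shifted simplicial complex. Moreover, if equality holds, then every labelling of the vertices for which $\deg_K(1)\ge\deg_K(2)\ge\cdots\ge\deg_K(n)$ is shifted, i.e. $K$ is a shifted complex in that labelling.
   Context: A simplicial complex $K$ on a finite vertex set is a collection of subsets closed under taking subsets; a face with $m+1$ vertices has dimension $m$, and $K_j$ is the set of $j$-dimensional faces. $K$ is $k$-dimensional if $k$ is the largest dimension of a face, and pure if every face lies in a $k$-face. Choose an orientation (an ordering of the vertices, up to even permutations) of each face. The boundary matrix $B_k=([\sigma:F])_{\sigma\in K_{k-1},F\in K_k}$ has $[\sigma:F]=0$ if $\sigma\not\subset F$, and if $F=[v_0,\dots,v_k]$ and $\sigma=F\setminus\{v_i\}$ then $[\sigma:F]=(-1)^i\operatorname{sgn}(\pi)$, where $\pi$ is the permutation carrying $(v_0,\dots,\widehat{v_i},\dots,v_k)$ to the chosen ordering of $\sigma$. The up-Laplacian is $L^{\mathrm{up}}_{k-1}(K)=B_kB_k^{\mathsf T}$; its spectrum does not depend on the orientations. $\lambda(K)=(\lambda_1(K),\lambda_2(K),\dots)$ is the sequence of its nonzero eigenvalues, counted with multiplicity, in nonincreasing order (trailing zeroes are suppressed when sequences are compared). $\deg_K(v)=|\{\sigma\in K_k: v\in\sigma\}|$. $d^{\mathrm v}(K)$ is the sequence of vertex degrees in nonincreasing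 order, and its conjugate partition $d^{\mathrm v}(K)^{\mathsf T}$ has $r$th entry $d^{\mathrm v,\mathsf T}_r(K)=|\{i\in[n]:\deg_K(i)\ge r\}|$, $r\ge1$. For $t$-element subsets $F=\{f_1<\cdots<f_t\}$ and $G=\{g_1<\cdots<g_t\}$ of $[n]$, write $F\le_P G$ if $f_r\le g_r$ for all $r$. A simplicial complex $K$ on $[n]$ is shifted if whenever $G\in K$, $F\subseteq[n]$, $|F|=|G|$ and $F\le_P G$, then $F\in K$. Isomorphic means equal after a bijective relabelling of the vertices. -}

module Defs where

open import Data.Nat.Base using (ℕ; zero; suc)
import Data.Nat.Base as ℕ
import Data.Nat.Properties as ℕ
open import Data.Integer.Base using (ℤ; +_; 0ℤ; 1ℤ; -1ℤ; _-_; _*_; _^_; _≥_)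
import Data.Integer.Properties as ℤ
import Data.Bool.Properties as Bool
open import Data.Fin.Base using (Fin; zero; suc; toℕ; punchIn)
import Data.Fin.Base as Fin
import Data.Fin.Properties as Fin
open import Data.Fin.Permutation using (Permutation′; _⟨$⟩ʳ_)
open import Data.Fin.Subset using (Subset; inside; outside; _∈_; _⊆_; ∣_∣)
import Data.Fin.Subset as Subset
open import Data.Fin.Subset.Properties using (_∈?_)
open import Data.Vec.Base using ([]; _∷_)
import Data.Vec.Base as Vec
import Data.Vec.Properties as Vec
open import Data.List.Base using (List; []; _∷_; _++_; map; foldr; filter; length; lookup; removeAt; allFin; cartesianProduct)
import Data.List.Membership.Propositional as List
open import Data.List.Relation.Unary.All using (All)
open import Data.List.Relation.Unary.Linked using (Linked)
open import Data.List.Relation.Unary.Unique.Propositional using (Unique)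
open import Data.List.Relation.Binary.Pointwise.Base using (Pointwise)
open import Data.Product.Base using (∃-syntax; _×_; _,_)
open import Function.Bundles using (_⇔_)
open import Relation.Binary.Definitions using (DecidableEquality)
open import Relation.Binary.PropositionalEquality using (_≡_; _≢_; sym; trans)
open import Relation.Nullary using (yes; no; _×-dec_)
open import Relation.Unary using (Decidable)
open import Algebra.Properties.Semiring.Sum ℤ.+-*-semiring using (sum)

-- The vertex i + 1 of [n] is the element i of Fin n.
record SimplicialComplex (n : ℕ) : Set₁ where
  field
    Face   : Subset n → Set
    face?  : Decidable Face
    closed : ∀ {F G} → F ⊆ G → Face G → Face F

open SimplicialComplex public

-- Dimensions are one less than cardinalities.
record PureOfDimension {n : ℕ} (k : ℕ) (K : SimplicialComplex n) : Set where
  field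
    attained : ∃[ F ] Face K F × ∣ F ∣ ≡ suc k
    maximal  : ∀ F → Face K F → ∣ F ∣ ℕ.≤ suc k
    pure     : ∀ F → Face K F → ∃[ G ] Face K G × ∣ G ∣ ≡ suc k × F ⊆ G

_≟ˢ_ : ∀ {n} → DecidableEquality (Subset n)
_≟ˢ_ = Vec.≡-dec Bool._≟_

subsets : ∀ n → List (Subset n)
subsets zero    = [] ∷ []
subsets (suc n) = map (inside ∷_) (subsets n) ++ map (outside ∷_) (subsets n)

-- Indexed by cardinality: the set K_j of j-dimensional faces is
-- facesOfSize K (suc j).
facesOfSize : ∀ {n} → SimplicialComplex n → ℕ → List (Subset n)
facesOfSize {n} K m = filter (λ F → (∣ F ∣ ℕ.≟ m) ×-dec face? K F) (subsets n)

record Ordering {n : ℕ} (F : Subset n) : Set where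
  field
    vertices : List (Fin n)
    unique   : Unique vertices
    complete : ∀ v → (v List.∈ vertices) ⇔ (v ∈ F)

open Ordering public

-- An ordering representing the orientation is chosen for every subset of [n];
-- those chosen for non-faces are never used.
Orientation : ℕ → Set
Orientation n = ∀ (F : Subset n) → Ordering F

position : ∀ {n} → Fin n → List (Fin n) → ℕ
position v []       = 0
position v (x ∷ xs) with v Fin.≟ x
... | yes _ = 0
... | no  _ = suc (position v xs)

-- For two orderings xs, ys of the same set: the number of inversions of the
-- permutation of positions carrying xs to ys.
inversions : ∀ {n} → List (Fin n) → List (Fin n) → ℕ
inversions xs ys =
  length (filter (λ (u , v) → (position u xs ℕ.<? position v xs)
                        ×-dec (position v ys ℕ.<? position u ys))
                 (cartesianProduct xs xs))

sgn : ∀ {n} → List (Fin n) → List (Fin n) → ℤ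
sgn xs ys = -1ℤ ^ inversions xs ys

-- [σ : F], for ∣ F ∣ ≡ suc ∣ σ ∣, where σ ⊆ F means that σ is F with one vertex removed.
incidence : ∀ {n} → Orientation n → Subset n → Subset n → ℤ
incidence o σ F with Fin.any? (λ i → σ ≟ˢ (F Subset.- lookup (vertices (o F)) i))
... | yes (i , _) = (-1ℤ ^ toℕ i) * sgn (removeAt (vertices (o F)) i) (vertices (o σ))
... | no  _       = 0ℤ

Matrix : ℕ → ℕ → Set
Matrix r c = Fin r → Fin c → ℤ

_·_ᵀ : ∀ {r c s} → Matrix r c → Matrix s c → Matrix r s
(A · B ᵀ) i j = sum (λ l → A i l * B j l)

det : ∀ {N} → Matrix N N → ℤ
det {zero}  M = 1ℤ
det {suc N} M =
  sum (λ j → (-1ℤ ^ toℕ j) * M zero j * det (λ a b → M (suc a) (punchIn j b)))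

scalar : ∀ {N} → ℤ → Matrix N N
scalar x i j with i Fin.≟ j
... | yes _ = x
... | no  _ = 0ℤ

charPoly : ∀ {N} → Matrix N N → ℤ → ℤ
charPoly M x = det (λ i j → scalar x i j - M i j)

product : List ℤ → ℤ
product = foldr _*_ 1ℤ

-- "The nonzero eigenvalues of M, with multiplicity and in nonincreasing order,
-- are μs": the characteristic polynomial is X^z ∏ (X - μ).  This is an identity
-- of integer polynomials, written as equality of their values at all integers.
-- All eigenvalues are accounted for, so if some eigenvalue (in ℂ) is not an
-- integer, then no list μs satisfies this.
record NonzeroEigenvalues {N : ℕ} (M : Matrix N N) (μs : List ℤ) : Set where
  field
    nonincreasing : Linked _≥_ μs
    nonzero       : All (_≢ 0ℤ) μs
    z             : ℕ
    total         : z ℕ.+ length μs ≡ N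
    splits        : ∀ x → charPoly M x ≡ x ^ z * product (map (x -_) μs)

-- Entries of a finite sequence extended by zeroes, counted from 0.
entry : List ℤ → ℕ → ℤ
entry []       r       = 0ℤ
entry (x ∷ xs) zero    = x
entry (x ∷ xs) (suc r) = entry xs r

-- B_k, with rows indexed by K_{k-1} and columns by K_k.
boundary : ∀ {n} (K : SimplicialComplex n) → Orientation n → ∀ k →
           Matrix (length (facesOfSize K k)) (length (facesOfSize K (suc k)))
boundary K o k i j =
  incidence o (lookup (facesOfSize K k) i) (lookup (facesOfSize K (suc k)) j)

-- L^up_{k-1}(K); the argument is k.
upLaplacian : ∀ {n} (K : SimplicialComplex n) → Orientation n → ∀ k →
              Matrix (length (facesOfSize K k)) (length (facesOfSize K k))
upLaplacian K o k = boundary K o k · boundary K o k ᵀ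

deg : ∀ {n} → ℕ → SimplicialComplex n → Fin n → ℕ
deg k K v = length (filter (v ∈?_) (facesOfSize K (suc k)))

conjugateDegree : ∀ {n} → ℕ → SimplicialComplex n → ℕ → ℕ
conjugateDegree {n} k K r = length (filter (λ v → r ℕ.≤? deg k K v) (allFin n))

-- λ(K) = d^v(K)^T for a k-dimensional K, as sequences up to trailing zeroes.
SpectrumIsConjugateDegrees : ∀ {n} → ℕ → SimplicialComplex n → Orientation n → Set
SpectrumIsConjugateDegrees k K o =
  ∃[ μs ] NonzeroEigenvalues (upLaplacian K o k) μs ×
          (∀ r → entry μs r ≡ + conjugateDegree k K (suc r))

increasing : ∀ {n} → Subset n → List (Fin n)
increasing {n} F = filter (_∈? F) (allFin n)

_≤ᴾ_ : ∀ {n} → Subset n → Subset n → Set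
F ≤ᴾ G = Pointwise Fin._≤_ (increasing F) (increasing G)

Shifted : ∀ {n} → SimplicialComplex n → Set
Shifted K = ∀ F G → Face K G → ∣ F ∣ ≡ ∣ G ∣ → F ≤ᴾ G → Face K F

preimage : ∀ {n} → Permutation′ n → Subset n → Subset n
preimage π F = Vec.tabulate (λ v → Vec.lookup F (π ⟨$⟩ʳ v))

-- The complex obtained from K by giving each vertex v the new label π v.
relabel : ∀ {n} → Permutation′ n → SimplicialComplex n → SimplicialComplex n
relabel π K = record
  { Face   = λ F → Face K (preimage π F)
  ; face?  = λ F → face? K (preimage π F)
  ; closed = λ {F} {G} F⊆G → closed K (mono F G F⊆G)
  }
  where
  mono : ∀ F G → F ⊆ G → preimage π F ⊆ preimage π G
  mono F G F⊆G {v} v∈ = Vec.lookup⇒[]= v _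
    (trans (Vec.lookup∘tabulate _ v)
      (Vec.[]=⇒lookup (F⊆G (Vec.lookup⇒[]= (π ⟨$⟩ʳ v) F
        (trans (sym (Vec.lookup∘tabulate _ v)) (Vec.[]=⇒lookup v∈))))))

_≅_ : ∀ {n} → SimplicialComplex n → SimplicialComplex n → Set
K ≅ K′ = ∃[ π ] ∀ F → Face (relabel π K) F ⇔ Face K′ F

NonincreasingDegrees : ∀ {n} → ℕ → SimplicialComplex n → Set
NonincreasingDegrees k K = ∀ i j → i Fin.≤ j → deg k K i ℕ.≥ deg k K j

module Submission where

open import Defs
open import Data.Nat.Base using (ℕ; zero; suc; _≤_)
import Data.Nat.Base as ℕ
import Data.Nat.Properties as ℕ
open import Data.Integer.Base using (ℤ; +_; 0ℤ; 1ℤ; -1ℤ; -_; _+_; _-_; _*_; _^_)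
import Data.Integer.Base as ℤ
import Data.Integer.Properties as ℤ
open import Data.Integer.Tactic.RingSolver using (solve-∀)
open import Data.Bool.Base using (true; false; if_then_else_; _∧_)
open import Data.Fin.Base using (Fin; zero; suc; toℕ; punchIn)
import Data.Fin.Base as Fin
import Data.Fin.Properties as Fin
open import Data.Fin.Permutation using (Permutation′; _⟨$⟩ʳ_; _⟨$⟩ˡ_; inverseˡ; inverseʳ; transpose; lift₀; _∘ₚ_)
import Data.Fin.Permutation as Permutation
open import Data.Fin.Subset using (Subset; inside; outside; _∈_; _∉_; _⊆_; ∣_∣)
import Data.Fin.Subset as Subset
import Data.Fin.Subset.Properties as Subset
open import Data.Vec.Base using (Vec; []; _∷_; _[_]≔_; zipWith; here; there)
import Data.Vec.Base as Vec
import Data.Vec.Properties as Vec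
open import Data.List.Base using (List; []; _∷_; _++_; map; filter; length; lookup; tabulate; allFin; removeAt; cartesianProduct; applyUpTo; upTo)
import Data.List.Properties as List
import Data.List.Membership.Propositional as List
import Data.List.Membership.Propositional.Properties as List
open import Data.List.Membership.Propositional.Properties.WithK using (unique∧set⇒bag)
open import Data.List.Relation.Unary.Any as Any using (here; there)
open import Data.List.Relation.Unary.Any.Properties using (lookup-index)
open import Data.List.Relation.Unary.All using ([]; _∷_)
import Data.List.Relation.Unary.All as All
import Data.List.Relation.Unary.All.Properties as All
open import Data.List.Relation.Unary.AllPairs using ([]; _∷_)
import Data.List.Relation.Unary.Linked.Properties as Linked
open import Data.List.Relation.Unary.Unique.Propositional using (Unique)
import Data.List.Relation.Unary.Unique.Propositional.Properties as Unique
open import Data.List.Relation.Binary.BagAndSetEquality using (∼bag⇒↭)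
open import Data.List.Relation.Binary.Permutation.Propositional as Perm using (_↭_)
import Data.List.Relation.Binary.Permutation.Propositional.Properties as Perm
open import Data.List.Relation.Binary.Pointwise.Base using (Pointwise; []; _∷_)
import Data.List.Relation.Binary.Pointwise as Pointwise
open import Data.Product.Base using (∃-syntax; _×_; _,_; proj₁; proj₂)
open import Data.Sum.Base using (_⊎_; inj₁; inj₂)
open import Data.Unit.Base using (⊤; tt)
open import Data.Empty using (⊥-elim)
open import Function.Base using (_∘_; id)
open import Function.Bundles using (_⇔_; mk⇔; module Equivalence)
open import Relation.Binary.Definitions using (tri<; tri≈; tri>)
open import Relation.Binary.PropositionalEquality using (_≡_; _≢_; refl; sym; trans; cong; cong₂; subst; subst₂; module ≡-Reasoning)
open import Relation.Nullary using (¬_; Dec; yes; no; does)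
open import Relation.Nullary.Decidable using (dec-true; dec-false; ¬?; _×-dec_)
open import Relation.Unary using (Decidable)
open import Algebra.Properties.CommutativeSemigroup ℤ.+-commutativeSemigroup renaming (interchange to +-interchange; x∙yz≈y∙xz to +-rotate) using ()
open import Algebra.Properties.CommutativeSemigroup ℤ.*-commutativeSemigroup renaming (interchange to *-interchange; x∙yz≈y∙xz to *-rotate) using ()
open import Algebra.Properties.Semiring.Sum ℤ.+-*-semiring using (sum; sum-cong-≗; sum-permute)

-- Shifted complexes have the spectrum given by the conjugate degrees because
-- of a recursion over the first vertex.  Up to signs and zero rows, the
-- up-Laplacian of a family S of facets is L_S = ∂ P_S ∂ᵀ, with ∂ the boundary
-- matrix of the full simplex.  Let S₁ and S₀ be the link and the deletion of
-- the first vertex.  If S is shifted, then ∂ P_{S₀} is supported on rows in S₁,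
-- and with a = ∂ P_{S₁}, y = x - 1,
--   (x - L_S) (y , 0 ; -aᵀ , 1) = (x (y - L_{S₁}) , a ; 0 , x - P_{S₁} - L_{S₀}),
-- where ∂ ∂ = 0 gives the zero block.  So det (x - L_S) is a product of
-- det (y - L_{S₁}), det (y - L_{S₀}) and powers of x and y.  The polynomials
-- ∏ᵢ (x - i) ^ (dᵢ - dᵢ₊₁), which are the ∏ᵣ (x - d^Tᵣ), obey the same
-- recursion.
--
-- Conversely, det (x² - L²) = det (x - L) det (x + L) gives tr L² as the sum of
-- the squares of the eigenvalues, so equality of the two sequences yields
-- tr L² = ∑ᵢⱼ min (dᵢ, dⱼ).  On the other hand tr L² ≤ ∑ᵢⱼ tᵢⱼ, where
-- tᵢⱼ ≤ min (dᵢ, dⱼ) is the number of facets F ∋ i for which exchanging i and j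
-- in F gives a facet.  Hence tᵢⱼ = min (dᵢ, dⱼ): if dᵢ ≥ dⱼ, then in every facet
-- containing j the vertex j can be exchanged for i.

-- The recursion dictates the setting. Shiftedness becomes `SwapClosed`, which passes to both
-- families. Each level lowers `x` by one and cancels powers of `x - 1`, so the identity is proved
-- for integers above n only, and then extended because a polynomial is determined by unboundedly
-- many values.
--
-- The trace, too, must be extracted from values. The characteristic polynomial is homogenized to
-- `det (a - b A)`, which at `a = 1` is `1 - b tr A` modulo `b²`.
--
-- The bound on `tr L²` comes from writing it as a sum, over pairs of facets F, G, of squared inner
-- products of boundary columns. For F = G the square is the number of pairs of members of F; for F
-- ≠ G it is 1 or 0 according to whether some exchange takes F to G. The minima arise because the
-- square of the rth conjugate degree counts the pairs of vertices of degree at least r.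

open ≡-Reasoning

-- Sums and products over lists

neg*neg : ∀ a b → (- a) * (- b) ≡ a * b
neg*neg = solve-∀

∑ : {A : Set} → List A → (A → ℤ) → ℤ
∑ []       f = 0ℤ
∑ (x ∷ xs) f = f x + ∑ xs f

∏ : {A : Set} → List A → (A → ℤ) → ℤ
∏ []       f = 1ℤ
∏ (x ∷ xs) f = f x * ∏ xs f

⟦_⟧ : {P : Set} → Dec P → ℤ
⟦ d ⟧ = if does d then 1ℤ else 0ℤ

⟦⟧-yes : {P : Set} (d : Dec P) → P → ⟦ d ⟧ ≡ 1ℤ
⟦⟧-yes d p rewrite dec-true d p = refl

⟦⟧-no : {P : Set} (d : Dec P) → ¬ P → ⟦ d ⟧ ≡ 0ℤ
⟦⟧-no d ¬p rewrite dec-false d ¬p = refl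

⟦⟧-iff : {P Q : Set} (d : Dec P) (e : Dec Q) → (P → Q) → (Q → P) → ⟦ d ⟧ ≡ ⟦ e ⟧
⟦⟧-iff (yes p) e f g = sym (⟦⟧-yes e (f p))
⟦⟧-iff (no ¬p) e f g = sym (⟦⟧-no e (¬p ∘ g))

module _ {A : Set} where

  ∑-cong∈ : (xs : List A) {f g : A → ℤ} → (∀ {x} → x List.∈ xs → f x ≡ g x) → ∑ xs f ≡ ∑ xs g
  ∑-cong∈ []       h = refl
  ∑-cong∈ (x ∷ xs) h = cong₂ _+_ (h (here refl)) (∑-cong∈ xs (h ∘ there))

  ∑-cong : (xs : List A) {f g : A → ℤ} → (∀ x → f x ≡ g x) → ∑ xs f ≡ ∑ xs g
  ∑-cong xs h = ∑-cong∈ xs (λ {x} _ → h x)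

  ∑-zero : (xs : List A) {f : A → ℤ} → (∀ {x} → x List.∈ xs → f x ≡ 0ℤ) → ∑ xs f ≡ 0ℤ
  ∑-zero []       h = refl
  ∑-zero (x ∷ xs) h = cong₂ _+_ (h (here refl)) (∑-zero xs (h ∘ there))

  ∑-+ : (xs : List A) (f g : A → ℤ) → ∑ xs (λ x → f x + g x) ≡ ∑ xs f + ∑ xs g
  ∑-+ []       f g = refl
  ∑-+ (x ∷ xs) f g = trans (cong (λ z → f x + g x + z) (∑-+ xs f g)) (+-interchange (f x) (g x) (∑ xs f) (∑ xs g))

  ∑-*ˡ : (xs : List A) (c : ℤ) (f : A → ℤ) → ∑ xs (λ x → c * f x) ≡ c * ∑ xs f
  ∑-*ˡ []       c f = sym (ℤ.*-zeroʳ c)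
  ∑-*ˡ (x ∷ xs) c f = trans (cong (λ z → c * f x + z) (∑-*ˡ xs c f)) (sym (ℤ.*-distribˡ-+ c (f x) _))

  ∑-*ʳ : (xs : List A) (c : ℤ) (f : A → ℤ) → ∑ xs (λ x → f x * c) ≡ ∑ xs f * c
  ∑-*ʳ xs c f = begin
    ∑ xs (λ x → f x * c) ≡⟨ ∑-cong xs (λ x → ℤ.*-comm (f x) c) ⟩
    ∑ xs (λ x → c * f x) ≡⟨ ∑-*ˡ xs c f ⟩
    c * ∑ xs f ≡⟨ ℤ.*-comm c _ ⟩
    ∑ xs f * c ∎

  ∑-++ : (xs ys : List A) (f : A → ℤ) → ∑ (xs ++ ys) f ≡ ∑ xs f + ∑ ys f
  ∑-++ []       ys f = sym (ℤ.+-identityˡ _)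
  ∑-++ (x ∷ xs) ys f = trans (cong (λ z → f x + z) (∑-++ xs ys f)) (sym (ℤ.+-assoc (f x) _ _))

  ∑-↭ : {xs ys : List A} → xs ↭ ys → (f : A → ℤ) → ∑ xs f ≡ ∑ ys f
  ∑-↭ Perm.refl         f = refl
  ∑-↭ (Perm.prep x p)   f = cong (λ z → f x + z) (∑-↭ p f)
  ∑-↭ (Perm.swap {xs} {ys} x y p) f = trans (cong (λ s → f x + (f y + s)) (∑-↭ p f)) (+-rotate (f x) (f y) (∑ ys f))
  ∑-↭ (Perm.trans p q)  f = trans (∑-↭ p f) (∑-↭ q f)

  ∑-filter : {P : A → Set} (P? : Decidable P) (xs : List A) (f : A → ℤ) →
    ∑ (filter P? xs) f ≡ ∑ xs (λ x → ⟦ P? x ⟧ * f x)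
  ∑-filter P? []       f = refl
  ∑-filter P? (x ∷ xs) f with does (P? x)
  ... | true  = cong₂ _+_ (sym (ℤ.*-identityˡ (f x))) (∑-filter P? xs f)
  ... | false = trans (∑-filter P? xs f) (sym (ℤ.+-identityˡ _))

  length-filter : {P : A → Set} (P? : Decidable P) (xs : List A) →
    + length (filter P? xs) ≡ ∑ xs (λ x → ⟦ P? x ⟧)
  length-filter P? []       = refl
  length-filter P? (x ∷ xs) with does (P? x)
  ... | true  = cong (λ z → 1ℤ + z) (length-filter P? xs)
  ... | false = trans (length-filter P? xs) (sym (ℤ.+-identityˡ _))

  ∑-only : {xs : List A} {x : A} {f : A → ℤ} → Unique xs → x List.∈ xs →
    (∀ {y} → y List.∈ xs → y ≢ x → f y ≡ 0ℤ) → ∑ xs f ≡ f x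
  ∑-only {xs = y ∷ xs} {f = f} (y∉ ∷ u) (here refl) h =
    trans (cong (λ z → f y + z) (∑-zero xs (λ z∈ → h (there z∈) (λ z≡y → All.lookup y∉ z∈ (sym z≡y)))))
          (ℤ.+-identityʳ (f y))
  ∑-only {xs = y ∷ xs} {x} {f} (y∉ ∷ u) (there x∈) h =
    trans (cong₂ _+_ (h (here refl) (All.lookup y∉ x∈)) (∑-only u x∈ (h ∘ there)))
          (ℤ.+-identityˡ (f x))

  ∏-cong∈ : (xs : List A) {f g : A → ℤ} → (∀ {x} → x List.∈ xs → f x ≡ g x) → ∏ xs f ≡ ∏ xs g
  ∏-cong∈ []       h = refl
  ∏-cong∈ (x ∷ xs) h = cong₂ _*_ (h (here refl)) (∏-cong∈ xs (h ∘ there))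

  ∏-* : (xs : List A) (f g : A → ℤ) → ∏ xs (λ x → f x * g x) ≡ ∏ xs f * ∏ xs g
  ∏-* []       f g = refl
  ∏-* (x ∷ xs) f g = trans (cong (f x * g x *_) (∏-* xs f g)) (*-interchange (f x) (g x) (∏ xs f) (∏ xs g))

  ∏-const : (xs : List A) (c : ℤ) → ∏ xs (λ _ → c) ≡ c ^ length xs
  ∏-const []       c = refl
  ∏-const (x ∷ xs) c = cong (c *_) (∏-const xs c)

  ∏-one : (xs : List A) → ∏ xs (λ _ → 1ℤ) ≡ 1ℤ
  ∏-one xs = trans (∏-const xs 1ℤ) (ℤ.^-zeroˡ (length xs))

  ∏-↭ : {xs ys : List A} → xs ↭ ys → (f : A → ℤ) → ∏ xs f ≡ ∏ ys f
  ∏-↭ Perm.refl         f = refl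
  ∏-↭ (Perm.prep x p)   f = cong (f x *_) (∏-↭ p f)
  ∏-↭ (Perm.swap {xs} {ys} x y p) f = trans (cong (λ s → f x * (f y * s)) (∏-↭ p f)) (*-rotate (f x) (f y) (∏ ys f))
  ∏-↭ (Perm.trans p q)  f = trans (∏-↭ p f) (∏-↭ q f)

∑-map : {A B : Set} (h : A → B) (xs : List A) (f : B → ℤ) → ∑ (map h xs) f ≡ ∑ xs (f ∘ h)
∑-map h []       f = refl
∑-map h (x ∷ xs) f = cong (λ z → f (h x) + z) (∑-map h xs f)

∏-map : {A B : Set} (h : A → B) (xs : List A) (f : B → ℤ) → ∏ (map h xs) f ≡ ∏ xs (f ∘ h)
∏-map h []       f = refl
∏-map h (x ∷ xs) f = cong (f (h x) *_) (∏-map h xs f)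

∑-comm : {A B : Set} (xs : List A) (ys : List B) (f : A → B → ℤ) →
  ∑ xs (λ x → ∑ ys (f x)) ≡ ∑ ys (λ y → ∑ xs (λ x → f x y))
∑-comm []       ys f = sym (∑-zero ys (λ _ → refl))
∑-comm (x ∷ xs) ys f = trans (cong (λ z → ∑ ys (f x) + z) (∑-comm xs ys f)) (sym (∑-+ ys (f x) _))

∑-tabulate : {A : Set} {n : ℕ} (g : Fin n → A) (f : A → ℤ) → ∑ (tabulate g) f ≡ sum (f ∘ g)
∑-tabulate {n = zero}  g f = refl
∑-tabulate {n = suc n} g f = cong (λ z → f (g zero) + z) (∑-tabulate (g ∘ suc) f)

-- Determinants

-- Laplace expansion along the row r, where D gives the complementary minors;
-- equivalently, exterior multiplication of the alternating form D by r.
lap : {J : Set} → (J → ℤ) → (List J → ℤ) → List J → ℤ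
lap r D []       = 0ℤ
lap r D (c ∷ cs) = r c * D cs - lap r (λ ds → D (c ∷ ds)) cs

wedge : {J : Set} → List (J → ℤ) → (List J → ℤ) → List J → ℤ
wedge []       D = D
wedge (r ∷ rs) D = lap r (wedge rs D)

-- The form of degree 0 with value 1. Through it a `minor` vanishes on every list of columns that is
-- not exactly as long as its list of rows.
unit : {J : Set} → List J → ℤ
unit []      = 1ℤ
unit (_ ∷ _) = 0ℤ

minor : {J : Set} → List (J → ℤ) → List J → ℤ
minor rs = wedge rs unit

detL : {J : Set} → List J → (J → J → ℤ) → ℤ
detL xs A = minor (map A xs) xs

-- The sign of carrying one row past the rows, or one index past the indices, of the list.
sgL : {A : Set} → List A → ℤ
sgL []       = 1ℤ
sgL (_ ∷ xs) = - sgL xs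

sgL-∷ʳ : {A : Set} (xs : List A) (x : A) → sgL (xs ++ x ∷ []) ≡ - sgL xs
sgL-∷ʳ []       x = refl
sgL-∷ʳ (_ ∷ xs) x = cong -_ (sgL-∷ʳ xs x)

self-negative : ∀ {a} → a ≡ - a → a ≡ 0ℤ
self-negative {ℤ.+ zero}  _ = refl
self-negative {ℤ.+[1+ n ]} ()
self-negative {ℤ.-[1+ n ]} ()

module _ {J : Set} where

  lap-cong∈ : {r s : J → ℤ} {D E : List J → ℤ} (cs : List J) → (∀ {c} → c List.∈ cs → r c ≡ s c) →
    (∀ ds → D ds ≡ E ds) → lap r D cs ≡ lap s E cs
  lap-cong∈ []       r≡s D≡E = refl
  lap-cong∈ (c ∷ cs) r≡s D≡E =
    cong₂ _-_ (cong₂ _*_ (r≡s (here refl)) (D≡E cs)) (lap-cong∈ cs (r≡s ∘ there) (λ ds → D≡E (c ∷ ds)))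

  lap-congʳ : (r : J → ℤ) {D E : List J → ℤ} (cs : List J) → (∀ ds → D ds ≡ E ds) → lap r D cs ≡ lap r E cs
  lap-congʳ r cs = lap-cong∈ cs (λ _ → refl)

  lap-zeroˡ : {r : J → ℤ} (D : List J → ℤ) (cs : List J) → (∀ {c} → c List.∈ cs → r c ≡ 0ℤ) → lap r D cs ≡ 0ℤ
  lap-zeroˡ D []       h = refl
  lap-zeroˡ D (c ∷ cs) h rewrite h (here refl) | lap-zeroˡ (λ ds → D (c ∷ ds)) cs (h ∘ there) = refl

  lap-+ˡ : (r s : J → ℤ) (D : List J → ℤ) (cs : List J) →
    lap (λ c → r c + s c) D cs ≡ lap r D cs + lap s D cs
  lap-+ˡ r s D []       = refl
  lap-+ˡ r s D (c ∷ cs) =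
    trans (cong (λ z → (r c + s c) * D cs - z) (lap-+ˡ r s _ cs))
          (alg (r c) (s c) (D cs) (lap r (λ ds → D (c ∷ ds)) cs) (lap s (λ ds → D (c ∷ ds)) cs))
    where
    alg : ∀ a b d u v → (a + b) * d - (u + v) ≡ a * d - u + (b * d - v)
    alg = solve-∀

  lap-*ˡ : (k : ℤ) (r : J → ℤ) (D : List J → ℤ) (cs : List J) → lap (λ c → k * r c) D cs ≡ k * lap r D cs
  lap-*ˡ k r D []       = sym (ℤ.*-zeroʳ k)
  lap-*ˡ k r D (c ∷ cs) =
    trans (cong (λ z → k * r c * D cs - z) (lap-*ˡ k r _ cs))
          (alg k (r c) (D cs) (lap r (λ ds → D (c ∷ ds)) cs))
    where
    alg : ∀ k a d u → k * a * d - k * u ≡ k * (a * d - u)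
    alg = solve-∀

  lap-∑ : {I : Set} (is : List I) (a : I → ℤ) (b : I → J → ℤ) (D : List J → ℤ) (cs : List J) →
    lap (λ c → ∑ is (λ i → a i * b i c)) D cs ≡ ∑ is (λ i → a i * lap (b i) D cs)
  lap-∑ []       a b D cs = lap-zeroˡ D cs (λ _ → refl)
  lap-∑ (i ∷ is) a b D cs =
    trans (lap-+ˡ (λ c → a i * b i c) _ D cs) (cong₂ _+_ (lap-*ˡ (a i) (b i) D cs) (lap-∑ is a b D cs))

  lap-+ʳ : (r : J → ℤ) (D E : List J → ℤ) (cs : List J) →
    lap r (λ ds → D ds + E ds) cs ≡ lap r D cs + lap r E cs
  lap-+ʳ r D E []       = refl
  lap-+ʳ r D E (c ∷ cs) =
    trans (cong (λ z → r c * (D cs + E cs) - z) (lap-+ʳ r _ _ cs))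
          (alg (r c) (D cs) (E cs) (lap r (λ ds → D (c ∷ ds)) cs) (lap r (λ ds → E (c ∷ ds)) cs))
    where
    alg : ∀ a d e u v → a * (d + e) - (u + v) ≡ a * d - u + (a * e - v)
    alg = solve-∀

  lap-*ʳ : (k : ℤ) (r : J → ℤ) (D : List J → ℤ) (cs : List J) → lap r (λ ds → k * D ds) cs ≡ k * lap r D cs
  lap-*ʳ k r D []       = sym (ℤ.*-zeroʳ k)
  lap-*ʳ k r D (c ∷ cs) =
    trans (cong (λ z → r c * (k * D cs) - z) (lap-*ʳ k r _ cs))
          (alg k (r c) (D cs) (lap r (λ ds → D (c ∷ ds)) cs))
    where
    alg : ∀ k a d u → a * (k * d) - k * u ≡ k * (a * d - u)
    alg = solve-∀

  lap-negʳ : (r : J → ℤ) (D : List J → ℤ) (cs : List J) → lap r (λ ds → - D ds) cs ≡ - lap r D cs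
  lap-negʳ r D []       = refl
  lap-negʳ r D (c ∷ cs) =
    trans (cong (λ z → r c * (- D cs) - z) (lap-negʳ r _ cs)) (alg (r c) (D cs) (lap r (λ ds → D (c ∷ ds)) cs))
    where
    alg : ∀ a d u → a * (- d) - (- u) ≡ - (a * d - u)
    alg = solve-∀

  lap-subʳ : (r : J → ℤ) (D E : List J → ℤ) (cs : List J) →
    lap r (λ ds → D ds - E ds) cs ≡ lap r D cs - lap r E cs
  lap-subʳ r D E cs = trans (lap-+ʳ r D _ cs) (cong (λ z → lap r D cs + z) (lap-negʳ r E cs))

  -- Splitting off the first column `c` leaves on either side a term with `r c`, a term with `s c`
  -- and a double expansion along `cs`. The first two already match; the third is the induction
  -- hypothesis.
  lap-anti : (r s : J → ℤ) (D : List J → ℤ) (cs : List J) → lap r (lap s D) cs ≡ - lap s (lap r D) cs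
  lap-anti r s D []       = refl
  lap-anti r s D (c ∷ cs) = begin
    r c * lap s D cs - lap r (λ ds → s c * D ds - lap s D′ ds) cs
      ≡⟨ cong (λ z → r c * lap s D cs - z) (split r s) ⟩
    r c * lap s D cs - (s c * lap r D cs - lap r (lap s D′) cs)
      ≡⟨ cong (λ z → r c * lap s D cs - (s c * lap r D cs - z)) (lap-anti r s D′ cs) ⟩
    r c * lap s D cs - (s c * lap r D cs - (- lap s (lap r D′) cs))
      ≡⟨ alg (r c * lap s D cs) (s c * lap r D cs) (lap s (lap r D′) cs) ⟩
    - (s c * lap r D cs - (r c * lap s D cs - lap s (lap r D′) cs))
      ≡⟨ cong (λ z → - (s c * lap r D cs - z)) (split s r) ⟨
    - (s c * lap r D cs - lap s (λ ds → r c * D ds - lap r D′ ds) cs) ∎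
    where
    D′ : List J → ℤ
    D′ ds = D (c ∷ ds)
    split : ∀ r s → lap r (λ ds → s c * D ds - lap s D′ ds) cs ≡ s c * lap r D cs - lap r (lap s D′) cs
    split r s = trans (lap-subʳ r (λ ds → s c * D ds) (lap s D′) cs)
                      (cong (λ z → z - lap r (lap s D′) cs) (lap-*ʳ (s c) r D cs))
    alg : ∀ a b z → a - (b - (- z)) ≡ - (b - (a - z))
    alg = solve-∀

  lap-sq : (r : J → ℤ) (D : List J → ℤ) (cs : List J) → lap r (lap r D) cs ≡ 0ℤ
  lap-sq r D cs = self-negative (lap-anti r r D cs)

  -- Under b ∧ _, the other rows only matter modulo b.
  lap-absorb : {R : Set} (b : J → ℤ) (f g : R → J → ℤ) (t : R → ℤ) → (∀ r c → f r c ≡ g r c + t r * b c) →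
    (rs : List R) (D : List J → ℤ) (cs : List J) →
    lap b (wedge (map f rs) D) cs ≡ lap b (wedge (map g rs) D) cs
  lap-absorb b f g t f≡ []       D cs = refl
  lap-absorb b f g t f≡ (r ∷ rs) D cs = begin
    lap b (lap (f r) X) cs ≡⟨ lap-anti b (f r) X cs ⟩
    - lap (f r) (lap b X) cs ≡⟨ cong -_ (lap-cong∈ cs (λ {c} _ → f≡ r c) (λ _ → refl)) ⟩
    - lap (λ c → g r c + t r * b c) (lap b X) cs ≡⟨ cong -_ (lap-+ˡ (g r) _ _ cs) ⟩
    - (lap (g r) (lap b X) cs + lap (λ c → t r * b c) (lap b X) cs)
      ≡⟨ cong (λ z → - (lap (g r) (lap b X) cs + z)) (trans (lap-*ˡ (t r) b _ cs) (trans (cong (t r *_) (lap-sq b X cs)) (ℤ.*-zeroʳ (t r)))) ⟩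
    - (lap (g r) (lap b X) cs + 0ℤ) ≡⟨ cong -_ (ℤ.+-identityʳ _) ⟩
    - lap (g r) (lap b X) cs ≡⟨ cong -_ (lap-congʳ (g r) cs (lap-absorb b f g t f≡ rs D)) ⟩
    - lap (g r) (lap b Y) cs ≡⟨ lap-anti b (g r) Y cs ⟨
    lap b (lap (g r) Y) cs ∎
    where
    X = wedge (map f rs) D
    Y = wedge (map g rs) D

  lap-insert : {I : Set} (b : I → J → ℤ) (i : I) (ps qs : List I) (D : List J → ℤ) (cs : List J) →
    lap (b i) (wedge (map b (ps ++ qs)) D) cs ≡ sgL ps * wedge (map b (ps ++ i ∷ qs)) D cs
  lap-insert b i []       qs D cs = sym (ℤ.*-identityˡ _)
  lap-insert b i (p ∷ ps) qs D cs = begin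
    lap (b i) (lap (b p) X) cs ≡⟨ lap-anti (b i) (b p) X cs ⟩
    - lap (b p) (lap (b i) X) cs ≡⟨ cong -_ (lap-congʳ (b p) cs (lap-insert b i ps qs D)) ⟩
    - lap (b p) (λ ds → sgL ps * Y ds) cs ≡⟨ cong -_ (lap-*ʳ (sgL ps) (b p) Y cs) ⟩
    - (sgL ps * lap (b p) Y cs) ≡⟨ ℤ.neg-distribˡ-* (sgL ps) _ ⟩
    - sgL ps * lap (b p) Y cs ∎
    where
    X = wedge (map b (ps ++ qs)) D
    Y = wedge (map b (ps ++ i ∷ qs)) D

module _ {J : Set} where

  comb : {I : Set} → List I → (I → J → ℤ) → (I → ℤ) → J → ℤ
  comb is b a c = ∑ is (λ i → a i * b i c)

  -- The multiplicativity of the determinant, for rows. The first row is expanded as a combination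
  -- of the `b i`. Next to `b i` the other rows may drop their `b i` component, so the induction
  -- hypothesis applies with `i` removed from `is`, and reinserting `b i` in its place costs a sign.
  -- These are the signs of the Laplace expansion of `minor (a ∷ as) is`.
  wedge-comb : {I : Set} (b : I → J → ℤ) (as : List (I → ℤ)) (is : List I) → length as ≡ length is →
    (D : List J → ℤ) (cs : List J) →
    wedge (map (comb is b) as) D cs ≡ minor as is * wedge (map b is) D cs
  wedge-comb         b []       []       eq D cs = sym (ℤ.*-identityˡ _)
  wedge-comb {I = I} b (a ∷ as) is       eq D cs =
    trans (lap-∑ is a b X cs)
          (trans (pick [] is refl) (cong (_* Y) (ℤ.*-identityˡ (lap a (minor as) is))))
    where
    X = wedge (map (comb is b) as) D
    Y = wedge (map b is) D cs
    term : ∀ ps i qs → is ≡ ps ++ i ∷ qs → lap (b i) X cs ≡ minor as (ps ++ qs) * (sgL ps * Y)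
    term ps i qs refl = begin
      lap (b i) X cs
        ≡⟨ lap-absorb (b i) (comb is b) (comb (ps ++ qs) b) (λ a → a i) drop as D cs ⟩
      lap (b i) (wedge (map (comb (ps ++ qs) b) as) D) cs
        ≡⟨ lap-congʳ (b i) cs (wedge-comb b as (ps ++ qs) len D) ⟩
      lap (b i) (λ ds → minor as (ps ++ qs) * wedge (map b (ps ++ qs)) D ds) cs
        ≡⟨ lap-*ʳ (minor as (ps ++ qs)) (b i) _ cs ⟩
      minor as (ps ++ qs) * lap (b i) (wedge (map b (ps ++ qs)) D) cs
        ≡⟨ cong (minor as (ps ++ qs) *_) (lap-insert b i ps qs D cs) ⟩
      minor as (ps ++ qs) * (sgL ps * Y) ∎
      where
      drop : ∀ r c → comb (ps ++ i ∷ qs) b r c ≡ comb (ps ++ qs) b r c + r i * b i c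
      drop r c = trans (∑-++ ps (i ∷ qs) _)
        (trans (alg (∑ ps (λ i → r i * b i c)) (r i * b i c) (∑ qs (λ i → r i * b i c)))
               (cong (λ z → z + r i * b i c) (sym (∑-++ ps qs _))))
        where
        alg : ∀ x y z → x + (y + z) ≡ x + z + y
        alg = solve-∀
      len : length as ≡ length (ps ++ qs)
      len = ℕ.suc-injective (trans eq (trans (List.length-++ ps)
        (trans (ℕ.+-suc _ _) (cong suc (sym (List.length-++ ps))))))
    -- `ps` holds the indices already passed: `sgL ps` is the sign with which the expansion of
    -- `lap a` reaches its next term.
    pick : ∀ ps qs → is ≡ ps ++ qs →
      ∑ qs (λ i → a i * lap (b i) X cs) ≡ sgL ps * lap a (λ ds → minor as (ps ++ ds)) qs * Y
    pick ps []       e = sym (trans (cong (_* Y) (ℤ.*-zeroʳ (sgL ps))) (ℤ.*-zeroˡ Y))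
    pick ps (i ∷ qs) e = begin
      a i * lap (b i) X cs + ∑ qs (λ i → a i * lap (b i) X cs)
        ≡⟨ cong₂ _+_ (cong (a i *_) (term ps i qs e)) (pick (ps ++ i ∷ []) qs (trans e (sym (List.++-assoc ps (i ∷ []) qs)))) ⟩
      a i * (m * (sgL ps * Y)) + sgL (ps ++ i ∷ []) * lap a (λ ds → minor as ((ps ++ i ∷ []) ++ ds)) qs * Y
        ≡⟨ cong₂ (λ u v → a i * (m * (sgL ps * Y)) + u * v * Y) (sgL-∷ʳ ps i)
                 (lap-congʳ a qs (λ ds → cong (minor as) (List.++-assoc ps (i ∷ []) ds))) ⟩
      a i * (m * (sgL ps * Y)) + - sgL ps * l * Y
        ≡⟨ alg (a i) m (sgL ps) Y l ⟩
      sgL ps * (a i * m - l) * Y ∎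
      where
      m = minor as (ps ++ qs)
      l = lap a (λ ds → minor as (ps ++ i ∷ ds)) qs
      alg : ∀ a m s y l → a * (m * (s * y)) + - s * l * y ≡ s * (a * m - l) * y
      alg = solve-∀

  detL-* : (xs : List J) (A B : J → J → ℤ) →
    detL xs (λ i k → ∑ xs (λ j → A i j * B j k)) ≡ detL xs A * detL xs B
  detL-* xs A B = begin
    minor (map (comb xs B ∘ A) xs) xs ≡⟨ cong (λ rs → minor rs xs) (List.map-∘ xs) ⟩
    minor (map (comb xs B) (map A xs)) xs ≡⟨ wedge-comb B (map A xs) xs (List.length-map A xs) unit xs ⟩
    detL xs A * detL xs B ∎

  minor-cong∈ : {I : Set} {A B : I → J → ℤ} (is : List I) (cs : List J) →
    (∀ {i c} → i List.∈ is → c List.∈ cs → A i c ≡ B i c) →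
    minor (map A is) cs ≡ minor (map B is) cs
  minor-cong∈ = go unit
    where
    go : (D : List J → ℤ) {I : Set} {A B : I → J → ℤ} (is : List I) (cs : List J) →
      (∀ {i c} → i List.∈ is → c List.∈ cs → A i c ≡ B i c) →
      wedge (map A is) D cs ≡ wedge (map B is) D cs
    -- Columns that `lap` steps over stay in front of the list handed to the remaining rows; `ps`
    -- records them, so that the hypothesis still covers them.
    lap-go : (D : List J → ℤ) {I : Set} {A B : I → J → ℤ} {r s : J → ℤ} (is : List I) (ps cs : List J) →
      (∀ {c} → c List.∈ cs → r c ≡ s c) →
      (∀ {i c} → i List.∈ is → c List.∈ ps ++ cs → A i c ≡ B i c) →
      lap r (λ ds → wedge (map A is) D (ps ++ ds)) cs ≡ lap s (λ ds → wedge (map B is) D (ps ++ ds)) cs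
    go D []       cs h = refl
    go D (i ∷ is) cs h = lap-go D is [] cs (h (here refl)) (h ∘ there)
    lap-go D is ps []       r≡s h = refl
    lap-go D {A = A} {B} {r} {s} is ps (c ∷ cs) r≡s h = cong₂ _-_
      (cong₂ _*_ (r≡s (here refl)) (go D is (ps ++ cs) (λ i∈ c∈ → h i∈ (weaken c∈))))
      (trans (lap-congʳ r cs (λ ds → cong (wedge (map A is) D) (sym (List.++-assoc ps (c ∷ []) ds))))
        (trans (lap-go D is (ps ++ c ∷ []) cs (r≡s ∘ there) (λ {i} {d} i∈ d∈ → h i∈ (subst (d List.∈_) (List.++-assoc ps (c ∷ []) cs) d∈)))
          (lap-congʳ s cs (λ ds → cong (wedge (map B is) D) (List.++-assoc ps (c ∷ []) ds)))))
      where
      weaken : ∀ {d} → d List.∈ ps ++ cs → d List.∈ ps ++ c ∷ cs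
      weaken d∈ with List.∈-++⁻ ps d∈
      ... | inj₁ d∈ps = List.∈-++⁺ˡ d∈ps
      ... | inj₂ d∈cs = List.∈-++⁺ʳ ps (there d∈cs)

  detL-cong∈ : {A B : J → J → ℤ} (xs : List J) → (∀ {i j} → i List.∈ xs → j List.∈ xs → A i j ≡ B i j) →
    detL xs A ≡ detL xs B
  detL-cong∈ xs = minor-cong∈ xs xs

  Alternating : (List J → ℤ) → Set
  Alternating D = ∀ ps c d qs → D (ps ++ c ∷ d ∷ qs) ≡ - D (ps ++ d ∷ c ∷ qs)

  lap-alternating : (r : J → ℤ) (D : List J → ℤ) → Alternating D → Alternating (lap r D)
  lap-alternating r D alt []       c d qs =
    trans (cong (λ z → r c * D (d ∷ qs) - (r d * D (c ∷ qs) - z))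
                (trans (lap-congʳ r qs (λ ds → alt [] c d ds)) (lap-negʳ r _ qs)))
          (alg (r c * D (d ∷ qs)) (r d * D (c ∷ qs)) (lap r (λ ds → D (d ∷ c ∷ ds)) qs))
    where
    alg : ∀ a b z → a - (b - (- z)) ≡ - (b - (a - z))
    alg = solve-∀
  lap-alternating r D alt (p ∷ ps) c d qs =
    trans (cong₂ (λ u v → r p * u - v) (alt ps c d qs)
                 (lap-alternating r (λ ds → D (p ∷ ds)) (λ ps → alt (p ∷ ps)) ps c d qs))
          (alg (r p) (D (ps ++ d ∷ c ∷ qs)) (lap r (λ ds → D (p ∷ ds)) (ps ++ d ∷ c ∷ qs)))
    where
    alg : ∀ a b z → a * (- b) - (- z) ≡ - (a * b - z)
    alg = solve-∀

  minor-alternating : (rs : List (J → ℤ)) → Alternating (minor rs)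
  minor-alternating []       []       c d qs = refl
  minor-alternating []       (_ ∷ _)  c d qs = refl
  minor-alternating (r ∷ rs) = lap-alternating r (minor rs) (minor-alternating rs)

  wedge-alternating : (A : J → J → ℤ) (D : List J → ℤ) (cs : List J) → Alternating (λ xs → wedge (map A xs) D cs)
  wedge-alternating A D cs []       c d qs = lap-anti (A c) (A d) _ cs
  wedge-alternating A D cs (p ∷ ps) c d qs =
    trans (lap-congʳ (A p) cs (λ ds → wedge-alternating A D ds ps c d qs)) (lap-negʳ (A p) _ cs)

  parity : {xs ys : List J} → xs ↭ ys → ℤ
  parity Perm.refl         = 1ℤ
  parity (Perm.prep x p)   = parity p
  parity (Perm.swap x y p) = - parity p
  parity (Perm.trans p q)  = parity p * parity q

  parity-sq : {xs ys : List J} (p : xs ↭ ys) → parity p * parity p ≡ 1ℤ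
  parity-sq Perm.refl         = refl
  parity-sq (Perm.prep x p)   = parity-sq p
  parity-sq (Perm.swap x y p) = trans (neg*neg (parity p) (parity p)) (parity-sq p)
  parity-sq (Perm.trans p q)  = trans (*-interchange (parity p) (parity q) (parity p) (parity q)) (cong₂ _*_ (parity-sq p) (parity-sq q))

  alternating-↭ : {xs ys : List J} (p : xs ↭ ys) (D : List J → ℤ) → Alternating D → D xs ≡ parity p * D ys
  alternating-↭ Perm.refl         D alt = sym (ℤ.*-identityˡ _)
  alternating-↭ (Perm.prep x p)   D alt = alternating-↭ p (λ ds → D (x ∷ ds)) (λ ps → alt (x ∷ ps))
  alternating-↭ (Perm.swap {xs} {ys} x y p) D alt = begin
    D (x ∷ y ∷ xs) ≡⟨ alt [] x y xs ⟩
    - D (y ∷ x ∷ xs) ≡⟨ cong -_ (alternating-↭ p (λ ds → D (y ∷ x ∷ ds)) (λ ps → alt (y ∷ x ∷ ps))) ⟩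
    - (parity p * D (y ∷ x ∷ ys)) ≡⟨ ℤ.neg-distribˡ-* (parity p) _ ⟩
    - parity p * D (y ∷ x ∷ ys) ∎
  alternating-↭ (Perm.trans p q)  D alt =
    trans (alternating-↭ p D alt)
      (trans (cong (parity p *_) (alternating-↭ q D alt)) (sym (ℤ.*-assoc (parity p) _ _)))

  -- Rows and columns are rearranged by the same derivation `p`, so its sign enters squared.
  detL-↭ : {xs ys : List J} → xs ↭ ys → (A : J → J → ℤ) → detL xs A ≡ detL ys A
  detL-↭ {xs} {ys} p A = begin
    minor (map A xs) xs
      ≡⟨ alternating-↭ p (minor (map A xs)) (minor-alternating (map A xs)) ⟩
    parity p * minor (map A xs) ys
      ≡⟨ cong (parity p *_) (alternating-↭ p (λ zs → minor (map A zs) ys) (wedge-alternating A unit ys)) ⟩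
    parity p * (parity p * minor (map A ys) ys)
      ≡⟨ ℤ.*-assoc (parity p) _ _ ⟨
    parity p * parity p * minor (map A ys) ys
      ≡⟨ trans (cong (_* minor (map A ys) ys) (parity-sq p)) (ℤ.*-identityˡ _) ⟩
    minor (map A ys) ys ∎

  lap-++ : (r : J → ℤ) (D : List J → ℤ) (cs es : List J) → (∀ {c} → c List.∈ es → r c ≡ 0ℤ) →
    lap r D (cs ++ es) ≡ lap r (λ ds → D (ds ++ es)) cs
  lap-++ r D []       es h = lap-zeroˡ D es h
  lap-++ r D (c ∷ cs) es h = cong (λ z → r c * D (cs ++ es) - z) (lap-++ r (λ ds → D (c ∷ ds)) cs es h)

  wedge-++ : {I : Set} (A : I → J → ℤ) (is : List I) (D : List J → ℤ) (cs es : List J) →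
    (∀ {i c} → i List.∈ is → c List.∈ es → A i c ≡ 0ℤ) →
    wedge (map A is) D (cs ++ es) ≡ wedge (map A is) (λ ds → D (ds ++ es)) cs
  wedge-++ A []       D cs es h = refl
  wedge-++ A (i ∷ is) D cs es h =
    trans (lap-++ (A i) _ cs es (h (here refl)))
          (lap-congʳ (A i) cs (λ ds → wedge-++ A is D ds es (h ∘ there)))

  lap-square : {m : ℕ} (r : J → ℤ) (D E : List J → ℤ) (cs : List J) → length cs ≡ suc m →
    (∀ ds → length ds ≡ m → D ds ≡ E ds) → lap r D cs ≡ lap r E cs
  lap-square {zero}  r D E (c ∷ [])      eq h = cong (λ z → r c * z - 0ℤ) (h [] refl)
  lap-square {suc m} r D E (c ∷ cs) eq h =
    cong₂ (λ u v → r c * u - v) (h cs (ℕ.suc-injective eq))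
          (lap-square r _ _ cs (ℕ.suc-injective eq) (λ ds l → h (c ∷ ds) (cong suc l)))

  -- Each row consumes one column, so with equally many of both the form `E` is only ever evaluated
  -- at the empty list.
  wedge-square : (rs : List (J → ℤ)) (cs : List J) → length cs ≡ length rs → (E : List J → ℤ) →
    wedge rs E cs ≡ E [] * minor rs cs
  wedge-square []       []       eq E = sym (ℤ.*-identityʳ (E []))
  wedge-square (r ∷ rs) cs eq E =
    trans (lap-square r (wedge rs E) (λ ds → E [] * minor rs ds) cs eq (λ ds l → wedge-square rs ds l E))
          (lap-*ʳ (E []) r (minor rs) cs)

  wedge-concat : (rs ss : List (J → ℤ)) (D : List J → ℤ) (cs : List J) → wedge (rs ++ ss) D cs ≡ wedge rs (wedge ss D) cs
  wedge-concat []       ss D cs = refl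
  wedge-concat (r ∷ rs) ss D cs = lap-congʳ r cs (wedge-concat rs ss D)

  -- The rows of `xs` vanish on the columns `ys`, so their expansion runs inside `xs` and leaves
  -- precisely the columns `ys` to the remaining rows.
  detL-++ : (A : J → J → ℤ) (xs ys : List J) → (∀ {x y} → x List.∈ xs → y List.∈ ys → A x y ≡ 0ℤ) →
    detL (xs ++ ys) A ≡ detL xs A * detL ys A
  detL-++ A xs ys h = begin
    minor (map A (xs ++ ys)) (xs ++ ys) ≡⟨ cong (λ rs → minor rs (xs ++ ys)) (List.map-++ A xs ys) ⟩
    minor (map A xs ++ map A ys) (xs ++ ys) ≡⟨ wedge-concat (map A xs) (map A ys) unit (xs ++ ys) ⟩
    wedge (map A xs) (minor (map A ys)) (xs ++ ys) ≡⟨ wedge-++ A xs _ xs ys h ⟩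
    wedge (map A xs) (λ ds → minor (map A ys) (ds ++ ys)) xs
      ≡⟨ wedge-square (map A xs) xs (sym (List.length-map A xs)) _ ⟩
    detL ys A * detL xs A ≡⟨ ℤ.*-comm (detL ys A) _ ⟩
    detL xs A * detL ys A ∎

  -- Interchanging the two index blocks turns one triangular shape into the other.
  detL-++ᵀ : (A : J → J → ℤ) (xs ys : List J) → (∀ {x y} → x List.∈ xs → y List.∈ ys → A y x ≡ 0ℤ) →
    detL (xs ++ ys) A ≡ detL xs A * detL ys A
  detL-++ᵀ A xs ys h = begin
    detL (xs ++ ys) A ≡⟨ detL-↭ (Perm.++-comm xs ys) A ⟩
    detL (ys ++ xs) A ≡⟨ detL-++ A ys xs (λ y∈ x∈ → h x∈ y∈) ⟩
    detL ys A * detL xs A ≡⟨ ℤ.*-comm (detL ys A) _ ⟩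
    detL xs A * detL ys A ∎

  detL-diagonal : (A : J → J → ℤ) {xs : List J} → Unique xs →
    (∀ {x y} → x List.∈ xs → y List.∈ xs → x ≢ y → A x y ≡ 0ℤ) → detL xs A ≡ ∏ xs (λ x → A x x)
  detL-diagonal A []                  h = refl
  detL-diagonal A {x ∷ xs} (x∉ ∷ u) h = begin
    detL (x ∷ [] ++ xs) A ≡⟨ detL-++ A (x ∷ []) xs (λ { (here refl) y∈ → h (here refl) (there y∈) (All.lookup x∉ y∈) }) ⟩
    detL (x ∷ []) A * detL xs A ≡⟨ cong₂ _*_ (alg (A x x)) (detL-diagonal A u (λ x∈ y∈ → h (there x∈) (there y∈))) ⟩
    A x x * ∏ xs (λ x → A x x) ∎
    where
    alg : ∀ a → a * 1ℤ - 0ℤ ≡ a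
    alg = solve-∀

  detL-scale : (c : J → ℤ) (A : J → J → ℤ) (xs : List J) → detL xs (λ i j → c i * A i j) ≡ ∏ xs c * detL xs A
  detL-scale c A xs = go xs xs
    where
    go : ∀ ys cs → minor (map (λ i j → c i * A i j) ys) cs ≡ ∏ ys c * minor (map A ys) cs
    go []       cs = sym (ℤ.*-identityˡ _)
    go (y ∷ ys) cs = begin
      lap (λ j → c y * A y j) X cs ≡⟨ lap-*ˡ (c y) (A y) X cs ⟩
      c y * lap (A y) X cs ≡⟨ cong (c y *_) (lap-congʳ (A y) cs (go ys)) ⟩
      c y * lap (A y) (λ ds → ∏ ys c * Y ds) cs ≡⟨ cong (c y *_) (lap-*ʳ (∏ ys c) (A y) Y cs) ⟩
      c y * (∏ ys c * lap (A y) Y cs) ≡⟨ ℤ.*-assoc (c y) _ _ ⟨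
      c y * ∏ ys c * lap (A y) Y cs ∎
      where
      X = minor (map (λ i j → c i * A i j) ys)
      Y = minor (map A ys)

lap-map : {I J : Set} (f : I → J) (r : J → ℤ) (D : List J → ℤ) (cs : List I) →
  lap r D (map f cs) ≡ lap (r ∘ f) (D ∘ map f) cs
lap-map f r D []       = refl
lap-map f r D (c ∷ cs) = cong (λ z → r (f c) * D (map f cs) - z) (lap-map f r (λ ds → D (f c ∷ ds)) cs)

minor-map : {I J K : Set} (f : I → J) (g : K → J → ℤ) (rs : List K) (cs : List I) →
  minor (map g rs) (map f cs) ≡ minor (map (λ r → g r ∘ f) rs) cs
minor-map f g []       []       = refl
minor-map f g []       (_ ∷ _)  = refl
minor-map f g (r ∷ rs) cs =
  trans (lap-map f (g r) _ cs) (lap-congʳ (g r ∘ f) cs (minor-map f g rs))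

detL-map : {I J : Set} (f : I → J) (A : J → J → ℤ) (xs : List I) →
  detL (map f xs) A ≡ detL xs (λ i j → A (f i) (f j))
detL-map f A xs = trans (cong (λ rs → minor rs (map f xs)) (sym (List.map-∘ xs))) (minor-map f (A ∘ f) xs xs)

lap-tabulate : {J : Set} {n : ℕ} (r : J → ℤ) (D : List J → ℤ) (g : Fin (suc n) → J) →
  lap r D (tabulate g) ≡ sum (λ j → (-1ℤ ^ toℕ j) * r (g j) * D (tabulate (g ∘ punchIn j)))
lap-tabulate {n = zero}  r D g = alg (r (g zero)) (D [])
  where
  alg : ∀ a b → a * b - 0ℤ ≡ 1ℤ * a * b + 0ℤ
  alg = solve-∀
lap-tabulate {n = suc n} r D g = begin
  r (g zero) * D (tabulate (g ∘ suc)) - lap r (λ ds → D (g zero ∷ ds)) (tabulate (g ∘ suc))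
    ≡⟨ cong (λ z → r (g zero) * D (tabulate (g ∘ suc)) - z) (lap-tabulate r (λ ds → D (g zero ∷ ds)) (g ∘ suc)) ⟩
  r (g zero) * D (tabulate (g ∘ suc)) - sum t
    ≡⟨ cong₂ (λ u v → u * D (tabulate (g ∘ suc)) + v) (sym (ℤ.*-identityˡ (r (g zero)))) (neg-sum t) ⟩
  1ℤ * r (g zero) * D (tabulate (g ∘ suc)) + sum (λ j → - t j)
    ≡⟨ cong (λ z → 1ℤ * r (g zero) * D (tabulate (g ∘ suc)) + z) (sum-cong-≗ (λ j → alg (-1ℤ ^ toℕ j) (r (g (suc j))) (D (g zero ∷ tabulate (g ∘ suc ∘ punchIn j))))) ⟩
  sum (λ j → (-1ℤ ^ toℕ j) * r (g j) * D (tabulate (g ∘ punchIn j))) ∎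
  where
  t : Fin (suc n) → ℤ
  t j = (-1ℤ ^ toℕ j) * r (g (suc j)) * D (g zero ∷ tabulate (g ∘ suc ∘ punchIn j))
  alg : ∀ a b c → - (a * b * c) ≡ -1ℤ * a * b * c
  alg = solve-∀
  neg-sum : ∀ {n} (t : Fin n → ℤ) → - sum t ≡ sum (λ j → - t j)
  neg-sum {zero}  t = refl
  neg-sum {suc n} t = trans (ℤ.neg-distrib-+ (t zero) _) (cong (λ z → - t zero + z) (neg-sum (t ∘ suc)))

-- The passage from cofactor expansion over `Fin` to lists of arbitrary indices, which can be
-- permuted, concatenated and mapped.
det-minor : {J : Set} {n : ℕ} (f : Fin n → J → ℤ) (g : Fin n → J) →
  det (λ i j → f i (g j)) ≡ minor (tabulate f) (tabulate g)
det-minor {n = zero}  f g = refl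
det-minor {n = suc n} f g =
  trans (sum-cong-≗ (λ j → cong ((-1ℤ ^ toℕ j) * f zero (g j) *_) (det-minor (f ∘ suc) (g ∘ punchIn j))))
        (sym (lap-tabulate (f zero) (minor (tabulate (f ∘ suc))) g))

det-lookup : {J : Set} (xs : List J) (A : J → J → ℤ) → det (λ i j → A (lookup xs i) (lookup xs j)) ≡ detL xs A
det-lookup xs A = begin
  det (λ i j → A (lookup xs i) (lookup xs j)) ≡⟨ det-minor (A ∘ lookup xs) (lookup xs) ⟩
  minor (tabulate (A ∘ lookup xs)) (tabulate (lookup xs)) ≡⟨ cong₂ minor (sym (List.map-tabulate (lookup xs) A)) (List.tabulate-lookup xs) ⟩
  minor (map A (tabulate (lookup xs))) xs ≡⟨ cong (λ ys → minor (map A ys) xs) (List.tabulate-lookup xs) ⟩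
  detL xs A ∎

-- The boundary map of the full simplex

δ : ∀ {n} → Subset n → Subset n → ℤ
δ σ τ = ⟦ σ ≟ˢ τ ⟧

δ-same : ∀ {n} (σ : Subset n) → δ σ σ ≡ 1ℤ
δ-same σ = ⟦⟧-yes (σ ≟ˢ σ) refl

δ-diff : ∀ {n} {σ τ : Subset n} → σ ≢ τ → δ σ τ ≡ 0ℤ
δ-diff {σ = σ} {τ} = ⟦⟧-no (σ ≟ˢ τ)

δ-sym : ∀ {n} (σ τ : Subset n) → δ σ τ ≡ δ τ σ
δ-sym σ τ = ⟦⟧-iff (σ ≟ˢ τ) (τ ≟ˢ σ) sym sym

δ-∷ : ∀ {n} b (σ τ : Subset n) → δ (b ∷ σ) (b ∷ τ) ≡ δ σ τ
δ-∷ b σ τ = ⟦⟧-iff ((b ∷ σ) ≟ˢ (b ∷ τ)) (σ ≟ˢ τ) Vec.∷-injectiveʳ (cong (b ∷_))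

-- Deleting the first vertex comes with sign +, so on subsets containing or
-- missing it ∂ has the block form (-∂ 0 ; 1 ∂).
∂ : ∀ {n} → Subset n → Subset n → ℤ
∂ []            []            = 0ℤ
∂ (inside  ∷ σ) (inside  ∷ F) = - ∂ σ F
∂ (inside  ∷ σ) (outside ∷ F) = 0ℤ
∂ (outside ∷ σ) (inside  ∷ F) = δ σ F
∂ (outside ∷ σ) (outside ∷ F) = ∂ σ F

subsets-unique : ∀ n → Unique (subsets n)
subsets-unique zero    = [] ∷ []
subsets-unique (suc n) = Unique.++⁺
  (Unique.map⁺ Vec.∷-injectiveʳ (subsets-unique n))
  (Unique.map⁺ Vec.∷-injectiveʳ (subsets-unique n))
  disjoint
  where
  disjoint : ∀ {F} → ¬ (F List.∈ map (inside ∷_) (subsets n) × F List.∈ map (outside ∷_) (subsets n))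
  disjoint (p , q) with List.∈-map⁻ (inside ∷_) p | List.∈-map⁻ (outside ∷_) q
  ... | _ , _ , refl | _ , _ , ()

∈-subsets : ∀ {n} (F : Subset n) → F List.∈ subsets n
∈-subsets []            = here refl
∈-subsets (inside  ∷ F) = List.∈-++⁺ˡ (List.∈-map⁺ (inside ∷_) (∈-subsets F))
∈-subsets (outside ∷ F) = List.∈-++⁺ʳ _ (List.∈-map⁺ (outside ∷_) (∈-subsets F))

∑ˢ : ∀ {n} → (Subset n → ℤ) → ℤ
∑ˢ {n} = ∑ (subsets n)

∑ˢ-suc : ∀ n (f : Subset (suc n) → ℤ) → ∑ˢ f ≡ ∑ˢ (λ F → f (inside ∷ F)) + ∑ˢ (λ F → f (outside ∷ F))
∑ˢ-suc n f = trans (∑-++ (map (inside ∷_) (subsets n)) _ f)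
                     (cong₂ _+_ (∑-map (inside ∷_) (subsets n) f) (∑-map (outside ∷_) (subsets n) f))

∑ˢ-cong : ∀ {n} {f g : Subset n → ℤ} → (∀ F → f F ≡ g F) → ∑ˢ f ≡ ∑ˢ g
∑ˢ-cong {n} = ∑-cong (subsets n)

∑ˢ-zero : ∀ {n} {f : Subset n → ℤ} → (∀ F → f F ≡ 0ℤ) → ∑ˢ f ≡ 0ℤ
∑ˢ-zero {n} h = ∑-zero (subsets n) (λ {F} _ → h F)

∑ˢ-δ : ∀ {n} (f : Subset n → ℤ) (τ : Subset n) → ∑ˢ (λ ρ → f ρ * δ ρ τ) ≡ f τ
∑ˢ-δ {n} f τ = trans
  (∑-only {x = τ} (subsets-unique n) (∈-subsets τ)
    (λ {ρ} _ ρ≢τ → trans (cong (f ρ *_) (δ-diff ρ≢τ)) (ℤ.*-zeroʳ (f ρ))))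
  (trans (cong (f τ *_) (δ-same τ)) (ℤ.*-identityʳ (f τ)))

∑ˢ-δˡ : ∀ {n} (f : Subset n → ℤ) (τ : Subset n) → ∑ˢ (λ ρ → δ τ ρ * f ρ) ≡ f τ
∑ˢ-δˡ f τ = trans (∑ˢ-cong (λ ρ → trans (ℤ.*-comm (δ τ ρ) (f ρ)) (cong (f ρ *_) (δ-sym τ ρ)))) (∑ˢ-δ f τ)

-- In the block form the diagonal blocks of the square are again squares, and the lower left block
-- is `- ∂ + ∂`.
∂∂ : ∀ {n} (σ F : Subset n) → ∑ˢ (λ ρ → ∂ σ ρ * ∂ ρ F) ≡ 0ℤ
∂∂ []            []            = refl
∂∂ {suc n} (inside  ∷ σ) (inside  ∷ F) = trans (∑ˢ-suc n _) (cong₂ _+_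
  (trans (∑ˢ-cong (λ ρ → neg*neg (∂ σ ρ) (∂ ρ F))) (∂∂ σ F))
  (∑ˢ-zero (λ ρ → ℤ.*-zeroˡ (δ ρ F))))
∂∂ {suc n} (inside  ∷ σ) (outside ∷ F) = trans (∑ˢ-suc n _) (cong₂ _+_
  (∑ˢ-zero (λ ρ → ℤ.*-zeroʳ (- ∂ σ ρ)))
  (∑ˢ-zero (λ ρ → ℤ.*-zeroˡ (∂ ρ F))))
∂∂ {suc n} (outside ∷ σ) (inside  ∷ F) = trans (∑ˢ-suc n _) (trans
  (cong₂ _+_ (∑ˢ-δˡ (λ ρ → - ∂ ρ F) σ) (∑ˢ-δ (∂ σ) F))
  (ℤ.+-inverseˡ (∂ σ F)))
∂∂ {suc n} (outside ∷ σ) (outside ∷ F) = trans (∑ˢ-suc n _) (cong₂ _+_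
  (∑ˢ-zero (λ ρ → ℤ.*-zeroʳ (δ σ ρ)))
  (∂∂ σ F))

∂-support : ∀ {n} (ρ F : Subset n) → ∂ ρ F ≡ 0ℤ ⊎ ∃[ j ] j ∈ F × ρ ≡ F [ j ]≔ outside
∂-support []            []            = inj₁ refl
∂-support (inside  ∷ ρ) (inside  ∷ F) with ∂-support ρ F
... | inj₁ z            = inj₁ (cong -_ z)
... | inj₂ (j , j∈ , e) = inj₂ (suc j , there j∈ , cong (inside ∷_) e)
∂-support (inside  ∷ ρ) (outside ∷ F) = inj₁ refl
∂-support (outside ∷ ρ) (inside  ∷ F) with ρ ≟ˢ F
... | yes refl = inj₂ (zero , here , refl)
... | no ρ≢F   = inj₁ refl
∂-support (outside ∷ ρ) (outside ∷ F) with ∂-support ρ F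
... | inj₁ z            = inj₁ z
... | inj₂ (j , j∈ , e) = inj₂ (suc j , there j∈ , cong (outside ∷_) e)

-- Laplacians of families of subsets, and the near-cone recursion

-- Indexed by all subsets and open to families of mixed sizes, so that link and deletion lead to
-- matrices of the same kind, with no dimension to keep track of.
upLap : ∀ {n} {S : Subset n → Set} → Decidable S → Subset n → Subset n → ℤ
upLap S? σ τ = ∑ˢ (λ F → ∂ σ F * ⟦ S? F ⟧ * ∂ τ F)

χ : ∀ {n} {S : Subset n → Set} → Decidable S → ℤ → ℤ
χ {n} S? x = detL (subsets n) (λ σ τ → x * δ σ τ - upLap S? σ τ)

-- The fragment of shiftedness that one step of the recursion uses: only exchanges into the first
-- vertex. It says that boundaries of members of the deletion are supported in the link.
NearCone : ∀ {n} → (Subset (suc n) → Set) → Set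
NearCone S = ∀ {F} j → j ∈ F → S (outside ∷ F) → S (inside ∷ (F [ j ]≔ outside))

⟦⟧-idem : {P : Set} (d : Dec P) → ⟦ d ⟧ * ⟦ d ⟧ ≡ ⟦ d ⟧
⟦⟧-idem (yes _) = refl
⟦⟧-idem (no _)  = refl

module _ {n : ℕ} {S : Subset (suc n) → Set} (S? : Decidable S) (cone : NearCone S) where

  private
    N = subsets n
    m = length (subsets n)

    S₁? : Decidable (λ F → S (inside ∷ F))
    S₁? F = S? (inside ∷ F)

    S₀? : Decidable (λ F → S (outside ∷ F))
    S₀? F = S? (outside ∷ F)

    p : Subset n → ℤ
    p F = ⟦ S₁? F ⟧

  upLap-ii : ∀ σ τ → upLap S? (inside ∷ σ) (inside ∷ τ) ≡ upLap S₁? σ τ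
  upLap-ii σ τ = trans (∑ˢ-suc n _) (trans (cong₂ _+_
    (∑ˢ-cong (λ F → alg (∂ σ F) (p F) (∂ τ F)))
    (∑ˢ-zero (λ F → ℤ.*-zeroʳ (0ℤ * ⟦ S₀? F ⟧)))) (ℤ.+-identityʳ _))
    where
    alg : ∀ a b c → (- a) * b * (- c) ≡ a * b * c
    alg = solve-∀

  upLap-oi : ∀ σ τ → upLap S? (outside ∷ σ) (inside ∷ τ) ≡ - (p σ * ∂ τ σ)
  upLap-oi σ τ = trans (∑ˢ-suc n _) (trans (cong₂ _+_
    (trans (∑ˢ-cong (λ F → ℤ.*-assoc (δ σ F) (p F) (- ∂ τ F))) (∑ˢ-δˡ (λ F → p F * (- ∂ τ F)) σ))
    (∑ˢ-zero (λ F → ℤ.*-zeroʳ (∂ σ F * ⟦ S₀? F ⟧)))) (alg (p σ) (∂ τ σ)))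
    where
    alg : ∀ a b → a * (- b) + 0ℤ ≡ - (a * b)
    alg = solve-∀

  upLap-io : ∀ σ τ → upLap S? (inside ∷ σ) (outside ∷ τ) ≡ - (∂ σ τ * p τ)
  upLap-io σ τ = trans (∑ˢ-suc n _) (trans (cong₂ _+_
    (trans (∑ˢ-cong (λ F → cong ((- ∂ σ F) * p F *_) (δ-sym τ F))) (∑ˢ-δ (λ F → (- ∂ σ F) * p F) τ))
    (∑ˢ-zero (λ F → ℤ.*-zeroˡ (∂ τ F)))) (alg (∂ σ τ) (p τ)))
    where
    alg : ∀ a b → (- a) * b + 0ℤ ≡ - (a * b)
    alg = solve-∀

  upLap-oo : ∀ σ τ → upLap S? (outside ∷ σ) (outside ∷ τ) ≡ p σ * δ σ τ + upLap S₀? σ τ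
  upLap-oo σ τ = trans (∑ˢ-suc n _) (cong (λ z → z + upLap S₀? σ τ)
    (trans (∑ˢ-cong (λ F → trans (ℤ.*-assoc (δ σ F) (p F) (δ τ F)) (cong (λ z → δ σ F * (p F * z)) (δ-sym τ F))))
           (∑ˢ-δˡ (λ F → p F * δ F τ) σ)))

  -- The near-cone condition enters here: a nonzero `∂ ρ F` makes `ρ` a codimension one subset of
  -- `F`, and if `F` is in the deletion, `ρ` is in the link.
  cone-absorb : ∀ ρ F → ⟦ S₀? F ⟧ * (∂ ρ F * p ρ) ≡ ⟦ S₀? F ⟧ * ∂ ρ F
  cone-absorb ρ F with S₀? F | ∂-support ρ F
  ... | no _   | _ = trans (ℤ.*-zeroˡ (∂ ρ F * p ρ)) (sym (ℤ.*-zeroˡ (∂ ρ F)))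
  ... | yes _  | inj₁ z rewrite z = refl
  ... | yes sF | inj₂ (j , j∈ , refl) =
    cong (1ℤ *_) (trans (cong (∂ ρ F *_) (⟦⟧-yes (S₁? ρ) (cone j j∈ sF))) (ℤ.*-identityʳ (∂ ρ F)))

  -- This is the product `L_{S₀} P_{S₁} ∂ᵀ`. The projection is absorbed by the factor `∂ᵀ` ending
  -- `L_{S₀}`, and `∂ᵀ ∂ᵀ` remains.
  upLap-p∂ : ∀ σ τ → ∑ˢ (λ ρ → upLap S₀? σ ρ * (p ρ * ∂ τ ρ)) ≡ 0ℤ
  upLap-p∂ σ τ = begin
    ∑ˢ (λ ρ → upLap S₀? σ ρ * (p ρ * ∂ τ ρ))
      ≡⟨ ∑ˢ-cong (λ ρ → sym (∑-*ʳ N (p ρ * ∂ τ ρ) _)) ⟩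
    ∑ˢ (λ ρ → ∑ˢ (λ F → ∂ σ F * ⟦ S₀? F ⟧ * ∂ ρ F * (p ρ * ∂ τ ρ)))
      ≡⟨ ∑-comm N N _ ⟩
    ∑ˢ (λ F → ∑ˢ (λ ρ → ∂ σ F * ⟦ S₀? F ⟧ * ∂ ρ F * (p ρ * ∂ τ ρ)))
      ≡⟨ ∑ˢ-cong (λ F → trans (∑ˢ-cong (term F)) (∑-*ˡ N (∂ σ F * ⟦ S₀? F ⟧) _)) ⟩
    ∑ˢ (λ F → ∂ σ F * ⟦ S₀? F ⟧ * ∑ˢ (λ ρ → ∂ τ ρ * ∂ ρ F))
      ≡⟨ ∑ˢ-zero (λ F → trans (cong (∂ σ F * ⟦ S₀? F ⟧ *_) (∂∂ τ F)) (ℤ.*-zeroʳ (∂ σ F * ⟦ S₀? F ⟧))) ⟩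
    0ℤ ∎
    where
    alg₁ : ∀ a s d q t → a * s * d * (q * t) ≡ a * t * (s * (d * q))
    alg₁ = solve-∀
    alg₂ : ∀ a s d t → a * t * (s * d) ≡ a * s * (t * d)
    alg₂ = solve-∀
    term : ∀ F ρ → ∂ σ F * ⟦ S₀? F ⟧ * ∂ ρ F * (p ρ * ∂ τ ρ) ≡ ∂ σ F * ⟦ S₀? F ⟧ * (∂ τ ρ * ∂ ρ F)
    term F ρ = trans (alg₁ (∂ σ F) ⟦ S₀? F ⟧ (∂ ρ F) (p ρ) (∂ τ ρ))
      (trans (cong (∂ σ F * ∂ τ ρ *_) (cone-absorb ρ F)) (alg₂ (∂ σ F) ⟦ S₀? F ⟧ (∂ ρ F) (∂ τ ρ)))

  upLap-absorb : ∀ σ τ → p σ * upLap S₀? σ τ ≡ upLap S₀? σ τ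
  upLap-absorb σ τ = trans (sym (∑-*ˡ N (p σ) _)) (∑ˢ-cong λ F →
    trans (alg₁ (p σ) (∂ σ F) ⟦ S₀? F ⟧ (∂ τ F)) (trans (cong (_* ∂ τ F) (cone-absorb σ F)) (alg₂ (∂ σ F) ⟦ S₀? F ⟧ (∂ τ F))))
    where
    alg₁ : ∀ q a s b → q * (a * s * b) ≡ s * (a * q) * b
    alg₁ = solve-∀
    alg₂ : ∀ a s b → s * a * b ≡ a * s * b
    alg₂ = solve-∀

  module _ (x : ℤ) where

    private
      y = x - 1ℤ

      M : Subset (suc n) → Subset (suc n) → ℤ
      M σ τ = x * δ σ τ - upLap S? σ τ

      -- Clears the lower left block of x - L.
      V : Subset (suc n) → Subset (suc n) → ℤ
      V (inside  ∷ σ) (inside  ∷ τ) = y * δ σ τ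
      V (inside  ∷ σ) (outside ∷ τ) = 0ℤ
      V (outside ∷ σ) (inside  ∷ τ) = - (p σ * ∂ τ σ)
      V (outside ∷ σ) (outside ∷ τ) = δ σ τ

      R : Subset n → Subset n → ℤ
      R σ τ = (x - p σ) * δ σ τ - upLap S₀? σ τ

      MV : Subset (suc n) → Subset (suc n) → ℤ
      MV σ τ = ∑ˢ (λ ρ → M σ ρ * V ρ τ)

    -- As the projection is idempotent, `a aᵀ` is `L_{S₁}`. Writing `L` for it,
    -- `(x - L) (x - 1) - L` equals `x (x - 1 - L)`.
    MV-ii : ∀ σ τ → MV (inside ∷ σ) (inside ∷ τ) ≡ x * (y * δ σ τ - upLap S₁? σ τ)
    MV-ii σ τ = begin
      MV (inside ∷ σ) (inside ∷ τ)
        ≡⟨ ∑ˢ-suc n _ ⟩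
      ∑ˢ (λ ρ → M (inside ∷ σ) (inside ∷ ρ) * (y * δ ρ τ)) + ∑ˢ (λ ρ → M (inside ∷ σ) (outside ∷ ρ) * (- (p ρ * ∂ τ ρ)))
        ≡⟨ cong₂ _+_ first (trans (∑ˢ-cong second) (∑-*ˡ N -1ℤ _)) ⟩
      (x * δ σ τ - upLap S₁? σ τ) * y + -1ℤ * upLap S₁? σ τ
        ≡⟨ alg x (δ σ τ) (upLap S₁? σ τ) ⟩
      x * (y * δ σ τ - upLap S₁? σ τ) ∎
      where
      alg : ∀ x d l → (x * d - l) * (x - 1ℤ) + -1ℤ * l ≡ x * ((x - 1ℤ) * d - l)
      alg = solve-∀
      first : ∑ˢ (λ ρ → M (inside ∷ σ) (inside ∷ ρ) * (y * δ ρ τ)) ≡ (x * δ σ τ - upLap S₁? σ τ) * y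
      first = trans (∑ˢ-cong (λ ρ → trans (sym (ℤ.*-assoc (M (inside ∷ σ) (inside ∷ ρ)) y (δ ρ τ)))
                       (cong (λ z → z * y * δ ρ τ) (cong₂ _-_ (cong (x *_) (δ-∷ inside σ ρ)) (upLap-ii σ ρ)))))
                    (∑ˢ-δ (λ ρ → (x * δ σ ρ - upLap S₁? σ ρ) * y) τ)
      alg₂ : ∀ x a q b → (x * 0ℤ - (- (a * q))) * (- (q * b)) ≡ -1ℤ * (a * (q * q) * b)
      alg₂ = solve-∀
      second : ∀ ρ → M (inside ∷ σ) (outside ∷ ρ) * (- (p ρ * ∂ τ ρ)) ≡ -1ℤ * (∂ σ ρ * p ρ * ∂ τ ρ)
      second ρ = trans (cong (_* (- (p ρ * ∂ τ ρ))) (cong₂ (λ u v → x * u - v) (δ-diff {σ = inside ∷ σ} {outside ∷ ρ} (λ ())) (upLap-io σ ρ)))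
        (trans (alg₂ x (∂ σ ρ) (p ρ) (∂ τ ρ)) (cong (λ z → -1ℤ * (∂ σ ρ * z * ∂ τ ρ)) (⟦⟧-idem (S₁? ρ))))

    M-oo : ∀ σ τ → M (outside ∷ σ) (outside ∷ τ) ≡ R σ τ
    M-oo σ τ = trans (cong₂ (λ u v → x * u - v) (δ-∷ outside σ τ) (upLap-oo σ τ)) (alg x (p σ) (δ σ τ) (upLap S₀? σ τ))
      where
      alg : ∀ x q d l → x * d - (q * d + l) ≡ (x - q) * d - l
      alg = solve-∀

    -- On rows in the link `x - P_{S₁}` acts as `x - 1`, which cancels the contribution `aᵀ y` of
    -- the left block; rows outside it vanish in `aᵀ`. The part with `L_{S₀}` is zero by `upLap-p∂`.
    MV-oi : ∀ σ τ → MV (outside ∷ σ) (inside ∷ τ) ≡ 0ℤ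
    MV-oi σ τ = begin
      MV (outside ∷ σ) (inside ∷ τ)
        ≡⟨ ∑ˢ-suc n _ ⟩
      ∑ˢ (λ ρ → M (outside ∷ σ) (inside ∷ ρ) * (y * δ ρ τ)) + ∑ˢ (λ ρ → M (outside ∷ σ) (outside ∷ ρ) * (- (p ρ * ∂ τ ρ)))
        ≡⟨ cong₂ _+_ first (trans (∑ˢ-cong second) (trans (∑-+ N _ _)
             (cong₂ _+_ (∑ˢ-δˡ (λ ρ → - ((x - p σ) * (p ρ * ∂ τ ρ))) σ) (upLap-p∂ σ τ)))) ⟩
      p σ * ∂ τ σ * y + (- ((x - p σ) * (p σ * ∂ τ σ)) + 0ℤ)
        ≡⟨ alg x (p σ) (∂ τ σ) ⟩
      (p σ * p σ - p σ) * ∂ τ σ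
        ≡⟨ cong (_* ∂ τ σ) (trans (cong (λ z → z - p σ) (⟦⟧-idem (S₁? σ))) (ℤ.+-inverseʳ (p σ))) ⟩
      0ℤ * ∂ τ σ
        ≡⟨ ℤ.*-zeroˡ (∂ τ σ) ⟩
      0ℤ ∎
      where
      alg : ∀ x q d → q * d * (x - 1ℤ) + (- ((x - q) * (q * d)) + 0ℤ) ≡ (q * q - q) * d
      alg = solve-∀
      alg₁ : ∀ x q → x * 0ℤ - (- q) ≡ q
      alg₁ = solve-∀
      first : ∑ˢ (λ ρ → M (outside ∷ σ) (inside ∷ ρ) * (y * δ ρ τ)) ≡ p σ * ∂ τ σ * y
      first = trans (∑ˢ-cong (λ ρ → trans (sym (ℤ.*-assoc (M (outside ∷ σ) (inside ∷ ρ)) y (δ ρ τ)))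
                       (cong (λ z → z * y * δ ρ τ)
                         (trans (cong₂ (λ u v → x * u - v) (δ-diff {σ = outside ∷ σ} {inside ∷ ρ} (λ ())) (upLap-oi σ ρ))
                                (alg₁ x (p σ * ∂ ρ σ))))))
                    (∑ˢ-δ (λ ρ → p σ * ∂ ρ σ * y) τ)
      alg₂ : ∀ x q d l r → (((x - q) * d) - l) * (- r) ≡ d * (- ((x - q) * r)) + l * r
      alg₂ = solve-∀
      second : ∀ ρ → M (outside ∷ σ) (outside ∷ ρ) * (- (p ρ * ∂ τ ρ)) ≡
        δ σ ρ * (- ((x - p σ) * (p ρ * ∂ τ ρ))) + upLap S₀? σ ρ * (p ρ * ∂ τ ρ)
      second ρ = trans (cong (_* (- (p ρ * ∂ τ ρ))) (M-oo σ ρ)) (alg₂ x (p σ) (δ σ ρ) (upLap S₀? σ ρ) (p ρ * ∂ τ ρ))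

    MV-oo : ∀ σ τ → MV (outside ∷ σ) (outside ∷ τ) ≡ R σ τ
    MV-oo σ τ = trans (∑ˢ-suc n _) (trans (cong₂ _+_
      (∑ˢ-zero (λ ρ → ℤ.*-zeroʳ (M (outside ∷ σ) (inside ∷ ρ))))
      (trans (∑ˢ-δ (λ ρ → M (outside ∷ σ) (outside ∷ ρ)) τ) (M-oo σ τ))) (ℤ.+-identityˡ (R σ τ)))

    ∈-in⁻ : ∀ {F b} → F List.∈ map (b ∷_) N → ∃[ G ] F ≡ b ∷ G
    ∈-in⁻ F∈ with List.∈-map⁻ (_ ∷_) F∈
    ... | G , _ , e = G , e

    detL-δ : ∀ (c : Subset n → ℤ) → detL N (λ σ τ → c σ * δ σ τ) ≡ ∏ N c
    detL-δ c = trans (detL-diagonal _ (subsets-unique n) (λ {σ} {τ} _ _ σ≢τ → trans (cong (c σ *_) (δ-diff σ≢τ)) (ℤ.*-zeroʳ (c σ))))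
      (∏-cong∈ N (λ {σ} _ → trans (cong (c σ *_) (δ-same σ)) (ℤ.*-identityʳ (c σ))))

    detL-V : detL (subsets (suc n)) V ≡ y ^ m
    detL-V = begin
      detL (subsets (suc n)) V
        ≡⟨ detL-++ V (map (inside ∷_) N) (map (outside ∷_) N) zeros ⟩
      detL (map (inside ∷_) N) V * detL (map (outside ∷_) N) V
        ≡⟨ cong₂ _*_ (trans (detL-map (inside ∷_) V N) (trans (detL-δ (λ _ → y)) (∏-const N y)))
                     (trans (detL-map (outside ∷_) V N) (trans (detL-cong∈ N (λ {σ} {τ} _ _ → sym (ℤ.*-identityˡ (δ σ τ))))
                        (trans (detL-δ (λ _ → 1ℤ)) (∏-one N)))) ⟩
      y ^ m * 1ℤ
        ≡⟨ ℤ.*-identityʳ (y ^ m) ⟩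
      y ^ m ∎
      where
      zeros : ∀ {F G} → F List.∈ map (inside ∷_) N → G List.∈ map (outside ∷_) N → V F G ≡ 0ℤ
      zeros F∈ G∈ with ∈-in⁻ F∈ | ∈-in⁻ G∈
      ... | _ , refl | _ , refl = refl

    χ-schur : χ S? x * y ^ m ≡ x ^ m * χ S₁? y * detL N R
    χ-schur = begin
      χ S? x * y ^ m
        ≡⟨ cong (χ S? x *_) detL-V ⟨
      χ S? x * detL (subsets (suc n)) V
        ≡⟨ detL-* (subsets (suc n)) M V ⟨
      detL (subsets (suc n)) MV
        ≡⟨ detL-++ᵀ MV (map (inside ∷_) N) (map (outside ∷_) N) zeros ⟩
      detL (map (inside ∷_) N) MV * detL (map (outside ∷_) N) MV
        ≡⟨ cong₂ _*_ (trans (detL-map (inside ∷_) MV N) (trans (detL-cong∈ N (λ {σ} {τ} _ _ → MV-ii σ τ))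
                        (trans (detL-scale (λ _ → x) _ N) (cong (_* χ S₁? y) (∏-const N x)))))
                     (trans (detL-map (outside ∷_) MV N) (detL-cong∈ N (λ {σ} {τ} _ _ → MV-oo σ τ))) ⟩
      x ^ m * χ S₁? y * detL N R ∎
      where
      zeros : ∀ {F G} → F List.∈ map (inside ∷_) N → G List.∈ map (outside ∷_) N → MV G F ≡ 0ℤ
      zeros F∈ G∈ with ∈-in⁻ F∈ | ∈-in⁻ G∈
      ... | τ , refl | σ , refl = MV-oi σ τ

    off : ℤ → Subset n → ℤ
    off z F = if does (S₁? F) then 1ℤ else z

    -- On rows in the link, `R` and `y - L_{S₀}` coincide. On the other rows `L_{S₀}` is zero by
    -- `upLap-absorb`, leaving `x` and `y` times the identity, and the factors `off y` and `off x`
    -- even these out.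
    χ-without : ∏ N (off x) * χ S₀? y ≡ ∏ N (off y) * detL N R
    χ-without = begin
      ∏ N (off x) * χ S₀? y ≡⟨ detL-scale (off x) _ N ⟨
      detL N (λ σ τ → off x σ * (y * δ σ τ - upLap S₀? σ τ))
                                                ≡⟨ detL-cong∈ N (λ {σ} {τ} _ _ → step σ τ) ⟩
      detL N (λ σ τ → off y σ * R σ τ) ≡⟨ detL-scale (off y) R N ⟩
      ∏ N (off y) * detL N R ∎
      where
      alg : ∀ x d → x * ((x - 1ℤ) * d - 0ℤ) ≡ (x - 1ℤ) * ((x - 0ℤ) * d - 0ℤ)
      alg = solve-∀
      step : ∀ σ τ → off x σ * (y * δ σ τ - upLap S₀? σ τ) ≡ off y σ * R σ τ
      step σ τ with does (S₁? σ) | upLap-absorb σ τ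
      ... | true  | _ = refl
      ... | false | e rewrite sym e | ℤ.*-zeroˡ (upLap S₀? σ τ) = alg x (δ σ τ)

    χ-recursion : χ S? x * (y ^ m * ∏ N (off y)) ≡ x ^ m * ∏ N (off x) * (χ S₁? y * χ S₀? y)
    χ-recursion = begin
      χ S? x * (y ^ m * oy) ≡⟨ ℤ.*-assoc (χ S? x) (y ^ m) oy ⟨
      χ S? x * y ^ m * oy ≡⟨ cong (_* oy) χ-schur ⟩
      x ^ m * c₁ * d * oy ≡⟨ alg (x ^ m) c₁ d oy ⟩
      x ^ m * c₁ * (oy * d) ≡⟨ cong (x ^ m * c₁ *_) χ-without ⟨
      x ^ m * c₁ * (ox * c₀) ≡⟨ alg₂ (x ^ m) c₁ ox c₀ ⟩
      x ^ m * ox * (c₁ * c₀) ∎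
      where
      ox = ∏ N (off x)
      oy = ∏ N (off y)
      c₁ = χ S₁? y
      c₀ = χ S₀? y
      d = detL N R
      alg : ∀ a b c e → a * b * c * e ≡ a * b * (e * c)
      alg = solve-∀
      alg₂ : ∀ a b c e → a * b * (c * e) ≡ a * c * (b * e)
      alg₂ = solve-∀

-- Swap-closed families

move : ∀ {n} → Fin n → Fin n → Subset n → Subset n
move i j F = (F [ j ]≔ outside) [ i ]≔ inside

-- Shiftedness by single exchanges, for any family of subsets. In this form it is inherited by link
-- and deletion of the first vertex.
SwapClosed : ∀ {n} → (Subset n → Set) → Set
SwapClosed S = ∀ {F} i j → i Fin.< j → i ∉ F → j ∈ F → S F → S (move i j F)

swapClosed-∷ : ∀ {n} b {S : Subset (suc n) → Set} → SwapClosed S → SwapClosed (λ F → S (b ∷ F))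
swapClosed-∷ b sc i j i<j i∉ j∈ = sc (suc i) (suc j) (ℕ.s≤s i<j) (λ { (there i∈) → i∉ i∈ }) (there j∈)

swapClosed⇒nearCone : ∀ {n} {S : Subset (suc n) → Set} → SwapClosed S → NearCone S
swapClosed⇒nearCone sc j j∈ = sc zero (suc j) (ℕ.s≤s ℕ.z≤n) (λ ()) (there j∈)

card : ∀ {n} {S : Subset n → Set} → Decidable S → ℕ
card {n} S? = length (filter S? (subsets n))

card-∑ : ∀ {n} {S : Subset n → Set} (S? : Decidable S) → + card S? ≡ ∑ˢ (λ F → ⟦ S? F ⟧)
card-∑ {n} S? = length-filter S? (subsets n)

card-suc : ∀ {n} {S : Subset (suc n) → Set} (S? : Decidable S) →
  card S? ≡ card (S? ∘ (inside ∷_)) ℕ.+ card (S? ∘ (outside ∷_))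
card-suc {n} S? = ℤ.+-injective (trans (card-∑ S?) (trans (∑ˢ-suc n _)
  (cong₂ _+_ (sym (card-∑ (S? ∘ (inside ∷_)))) (sym (card-∑ (S? ∘ (outside ∷_)))))))

length-filter-mono : {A : Set} {P Q : A → Set} (P? : Decidable P) (Q? : Decidable Q) → (∀ x → P x → Q x) →
  (xs : List A) → length (filter P? xs) ℕ.≤ length (filter Q? xs)
length-filter-mono P? Q? h []       = ℕ.z≤n
length-filter-mono P? Q? h (x ∷ xs) with P? x | Q? x
... | yes p | yes q = ℕ.s≤s (length-filter-mono P? Q? h xs)
... | yes p | no ¬q = ⊥-elim (¬q (h x p))
... | no ¬p | yes q = ℕ.m≤n⇒m≤1+n (length-filter-mono P? Q? h xs)
... | no ¬p | no ¬q = length-filter-mono P? Q? h xs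

length-filter-¬ : {A : Set} {P : A → Set} (P? : Decidable P) (xs : List A) →
  length (filter P? xs) ℕ.+ length (filter (¬? ∘ P?) xs) ≡ length xs
length-filter-¬ P? []       = refl
length-filter-¬ P? (x ∷ xs) with does (P? x)
... | true  = cong suc (length-filter-¬ P? xs)
... | false = trans (ℕ.+-suc _ _) (cong suc (length-filter-¬ P? xs))

∏-unless : {A : Set} {P : A → Set} (P? : Decidable P) (xs : List A) (z : ℤ) →
  ∏ xs (λ x → if does (P? x) then 1ℤ else z) ≡ z ^ length (filter (¬? ∘ P?) xs)
∏-unless P? []       z = refl
∏-unless P? (x ∷ xs) z with does (P? x)
... | true  = trans (ℤ.*-identityˡ _) (∏-unless P? xs z)
... | false = cong (z *_) (∏-unless P? xs z)

-- Follows the splitting used by `χ-recursion`: the degree sequences of link and deletion add up to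
-- the tail. `degrees-∑` identifies the entries with the usual counts.
degrees : ∀ {n} {S : Subset n → Set} → Decidable S → Vec ℕ n
degrees {zero}  S? = []
degrees {suc n} S? =
  card (S? ∘ (inside ∷_)) ∷ zipWith ℕ._+_ (degrees (S? ∘ (inside ∷_))) (degrees (S? ∘ (outside ∷_)))

-- The value on the empty vector is the convention that a degree sequence continues with 0, which
-- makes the last exponent in `Ψ` the last degree itself.
first : ∀ {n} → Vec ℕ n → ℕ
first []      = 0
first (d ∷ _) = d

Nonincreasing : ∀ {n} → Vec ℕ n → Set
Nonincreasing []      = ⊤
Nonincreasing (d ∷ e) = first e ≤ d × Nonincreasing e

first-+ : ∀ {n} (a b : Vec ℕ n) → first (zipWith ℕ._+_ a b) ≡ first a ℕ.+ first b
first-+ []      []      = refl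
first-+ (_ ∷ _) (_ ∷ _) = refl

nonincreasing-+ : ∀ {n} (a b : Vec ℕ n) → Nonincreasing a → Nonincreasing b → Nonincreasing (zipWith ℕ._+_ a b)
nonincreasing-+ []      []      _        _        = tt
nonincreasing-+ (d ∷ a) (e ∷ b) (p , p′) (q , q′) =
  subst (ℕ._≤ d ℕ.+ e) (sym (first-+ a b)) (ℕ.+-mono-≤ p q) , nonincreasing-+ a b p′ q′

-- For the first two vertices, members containing both count on either side, and swapping sends
-- those containing only the second to those containing only the first. Later vertices are compared
-- within link and deletion.
degrees-nonincreasing : ∀ {n} {S : Subset n → Set} (S? : Decidable S) → SwapClosed S → Nonincreasing (degrees S?)
degrees-nonincreasing {zero}  S? sc = tt
degrees-nonincreasing {suc n} {S} S? sc =
  bound S? sc ,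
  nonincreasing-+ (degrees (S? ∘ (inside ∷_))) (degrees (S? ∘ (outside ∷_)))
    (degrees-nonincreasing (S? ∘ (inside ∷_)) (swapClosed-∷ inside sc)) (degrees-nonincreasing (S? ∘ (outside ∷_)) (swapClosed-∷ outside sc))
  where
  bound : ∀ {n} {S : Subset (suc n) → Set} (S? : Decidable S) → SwapClosed S →
    first (zipWith ℕ._+_ (degrees (S? ∘ (inside ∷_))) (degrees (S? ∘ (outside ∷_)))) ≤ card (S? ∘ (inside ∷_))
  bound {zero}  S? sc = ℕ.z≤n
  bound {suc n} S? sc = subst (card (S? ∘ (inside ∷_) ∘ (inside ∷_)) ℕ.+ card (S? ∘ (outside ∷_) ∘ (inside ∷_)) ≤_)
    (sym (card-suc (S? ∘ (inside ∷_))))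
    (ℕ.+-monoʳ-≤ (card (S? ∘ (inside ∷_) ∘ (inside ∷_)))
      (length-filter-mono (S? ∘ (outside ∷_) ∘ (inside ∷_)) (S? ∘ (inside ∷_) ∘ (outside ∷_))
        (λ F → sc zero (suc zero) (ℕ.s≤s ℕ.z≤n) (λ ()) (there here)) (subsets n)))

-- For nonincreasing d this is the product of x - r over the entries r ≠ 0 of
-- the conjugate partition: r occurs d_r - d_{r+1} times.
Ψ : ∀ {n} → Vec ℕ n → ℤ → ℤ
Ψ []      x = 1ℤ
Ψ (d ∷ e) x = (x - 1ℤ) ^ (d ℕ.∸ first e) * Ψ e (x - 1ℤ)

-- Monotonicity makes the truncated differences of neighbouring entries true differences, and those
-- are additive.
Ψ-+ : ∀ {n} (a b : Vec ℕ n) → Nonincreasing a → Nonincreasing b → ∀ x → Ψ (zipWith ℕ._+_ a b) x ≡ Ψ a x * Ψ b x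
Ψ-+ []      []      _        _        x = refl
Ψ-+ (d ∷ a) (e ∷ b) (p , p′) (q , q′) x = begin
  y ^ (d ℕ.+ e ℕ.∸ first (zipWith ℕ._+_ a b)) * Ψ (zipWith ℕ._+_ a b) y
    ≡⟨ cong₂ _*_ (cong (y ^_) exponent) (Ψ-+ a b p′ q′ y) ⟩
  y ^ (u ℕ.+ v) * (Ψ a y * Ψ b y)
    ≡⟨ cong (_* (Ψ a y * Ψ b y)) (ℤ.^-distribˡ-+-* y u v) ⟩
  y ^ u * y ^ v * (Ψ a y * Ψ b y)
    ≡⟨ *-interchange (y ^ u) (y ^ v) (Ψ a y) (Ψ b y) ⟩
  y ^ u * Ψ a y * (y ^ v * Ψ b y) ∎
  where
  y = x - 1ℤ
  u = d ℕ.∸ first a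
  v = e ℕ.∸ first b
  exponent : d ℕ.+ e ℕ.∸ first (zipWith ℕ._+_ a b) ≡ u ℕ.+ v
  exponent = begin
    d ℕ.+ e ℕ.∸ first (zipWith ℕ._+_ a b) ≡⟨ cong (d ℕ.+ e ℕ.∸_) (first-+ a b) ⟩
    d ℕ.+ e ℕ.∸ (first a ℕ.+ first b) ≡⟨ ℕ.∸-+-assoc (d ℕ.+ e) (first a) (first b) ⟨
    d ℕ.+ e ℕ.∸ first a ℕ.∸ first b ≡⟨ cong (ℕ._∸ first b) (ℕ.+-∸-comm e p) ⟩
    u ℕ.+ e ℕ.∸ first b ≡⟨ ℕ.+-∸-assoc u q ⟩
    u ℕ.+ v ∎

^-nonzero : ∀ {i} n → i ≢ 0ℤ → i ^ n ≢ 0ℤ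
^-nonzero {i} n i≢0 = i≢0 ∘ ℤ.i^n≡0⇒i≡0 i n

*-cancelʳ : ∀ {i j k} → k ≢ 0ℤ → i * k ≡ j * k → i ≡ j
*-cancelʳ {i} {j} {k} k≢0 = ℤ.*-cancelʳ-≡ i j k {{ℤ.≢-nonZero k≢0}}

length-subsets-suc : ∀ n → length (subsets (suc n)) ≡ length (subsets n) ℕ.+ length (subsets n)
length-subsets-suc n = trans (List.length-++ (map (inside ∷_) (subsets n)))
  (cong₂ ℕ._+_ (List.length-map (inside ∷_) (subsets n)) (List.length-map (outside ∷_) (subsets n)))

-- The eigenvalue 0 has multiplicity `2 ^ n - d₁`; the power on the left keeps the exponents free of
-- subtraction. Every step of the recursion replaces `t` by `t - 1` and cancels powers of the
-- latter, so `t` has to start above `n`.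
χ-swapClosed : ∀ {n} {S : Subset n → Set} (S? : Decidable S) → SwapClosed S → ∀ t → n ℕ.< t →
  χ S? (+ t) * (+ t) ^ first (degrees S?) ≡ (+ t) ^ length (subsets n) * Ψ (degrees S?) (+ t)
χ-swapClosed {zero}  S? sc t       n<t = alg (+ t) ⟦ S? [] ⟧
  where
  alg : ∀ x s → ((x * 1ℤ - (0ℤ * s * 0ℤ + 0ℤ)) * 1ℤ - 0ℤ) * 1ℤ ≡ x * 1ℤ * 1ℤ
  alg = solve-∀
χ-swapClosed {suc n} {S} S? sc (suc t) (ℕ.s≤s n<t) = *-cancelʳ {k = y ^ m * y ^ m} y²≢0 (begin
  X * x ^ p * (y ^ m * y ^ m)
    ≡⟨ cong (λ z → X * x ^ p * (y ^ m * z)) y^m ⟩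
  X * x ^ p * (y ^ m * (y ^ ha * y ^ hb * y ^ r * y ^ q))
    ≡⟨ alg₁ X (x ^ p) (y ^ m) (y ^ ha) (y ^ hb) (y ^ r) (y ^ q) ⟩
  X * (y ^ m * y ^ q) * (x ^ p * y ^ ha * y ^ hb * y ^ r)
    ≡⟨ cong (_* (x ^ p * y ^ ha * y ^ hb * y ^ r)) recursion ⟩
  x ^ m * x ^ q * (a * b) * (x ^ p * y ^ ha * y ^ hb * y ^ r)
    ≡⟨ alg₂ (x ^ m) (x ^ q) a b (x ^ p) (y ^ ha) (y ^ hb) (y ^ r) ⟩
  x ^ m * (x ^ p * x ^ q) * (y ^ r * ((a * y ^ ha) * (b * y ^ hb)))
    ≡⟨ cong₂ (λ u v → x ^ m * u * (y ^ r * v)) x^m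
         (cong₂ _*_ (χ-swapClosed S₁? (swapClosed-∷ inside sc) t n<t) (χ-swapClosed S₀? (swapClosed-∷ outside sc) t n<t)) ⟩
  x ^ m * x ^ m * (y ^ r * ((y ^ m * Ψ d₁ y) * (y ^ m * Ψ d₀ y)))
    ≡⟨ alg₃ (x ^ m) (y ^ r) (y ^ m) (Ψ d₁ y) (Ψ d₀ y) ⟩
  x ^ m * x ^ m * (y ^ r * (Ψ d₁ y * Ψ d₀ y)) * (y ^ m * y ^ m)
    ≡⟨ cong₂ (λ u v → u * (y ^ r * v) * (y ^ m * y ^ m)) x^2m
         (sym (Ψ-+ d₁ d₀ (degrees-nonincreasing S₁? (swapClosed-∷ inside sc)) (degrees-nonincreasing S₀? (swapClosed-∷ outside sc)) y)) ⟩
  x ^ length (subsets (suc n)) * (y ^ r * Ψ (zipWith ℕ._+_ d₁ d₀) y) * (y ^ m * y ^ m) ∎)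
  where
  S₁? : Decidable (λ F → S (inside ∷ F))
  S₁? F = S? (inside ∷ F)
  S₀? : Decidable (λ F → S (outside ∷ F))
  S₀? F = S? (outside ∷ F)
  x = + suc t
  y = + t
  X = χ S? x
  a = χ S₁? y
  b = χ S₀? y
  m = length (subsets n)
  p = card S₁?
  q = length (filter (¬? ∘ S₁?) (subsets n))
  d₁ = degrees S₁?
  d₀ = degrees S₀?
  ha = first d₁
  hb = first d₀
  r = p ℕ.∸ first (zipWith ℕ._+_ d₁ d₀)
  y²≢0 : y ^ m * y ^ m ≢ 0ℤ
  y²≢0 e = ^-nonzero (m ℕ.+ m) y≢0 (trans (ℤ.^-distribˡ-+-* y m m) e)
    where
    y≢0 : y ≢ 0ℤ
    y≢0 e = ℕ.<⇒≢ (ℕ.≤-<-trans ℕ.z≤n n<t) (sym (ℤ.+-injective e))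
  -- `p` is the degree of the first vertex, `ha + hb` that of the second (0 if there is none) and
  -- `r` their difference; `q` counts the subsets outside the link.
  m≡ : ha ℕ.+ hb ℕ.+ r ℕ.+ q ≡ m
  m≡ = begin
    ha ℕ.+ hb ℕ.+ r ℕ.+ q ≡⟨ cong (λ h → h ℕ.+ r ℕ.+ q) (first-+ d₁ d₀) ⟨
    first (zipWith ℕ._+_ d₁ d₀) ℕ.+ r ℕ.+ q ≡⟨ cong (ℕ._+ q) (ℕ.m+[n∸m]≡n (proj₁ (degrees-nonincreasing S? sc))) ⟩
    p ℕ.+ q ≡⟨ length-filter-¬ S₁? (subsets n) ⟩
    m ∎
  y^m : y ^ m ≡ y ^ ha * y ^ hb * y ^ r * y ^ q
  y^m = begin
    y ^ m ≡⟨ cong (y ^_) m≡ ⟨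
    y ^ (ha ℕ.+ hb ℕ.+ r ℕ.+ q) ≡⟨ ℤ.^-distribˡ-+-* y (ha ℕ.+ hb ℕ.+ r) q ⟩
    y ^ (ha ℕ.+ hb ℕ.+ r) * y ^ q ≡⟨ cong (_* y ^ q) (ℤ.^-distribˡ-+-* y (ha ℕ.+ hb) r) ⟩
    y ^ (ha ℕ.+ hb) * y ^ r * y ^ q ≡⟨ cong (λ z → z * y ^ r * y ^ q) (ℤ.^-distribˡ-+-* y ha hb) ⟩
    y ^ ha * y ^ hb * y ^ r * y ^ q ∎
  x^m : x ^ p * x ^ q ≡ x ^ m
  x^m = trans (sym (ℤ.^-distribˡ-+-* x p q)) (cong (x ^_) (length-filter-¬ S₁? (subsets n)))
  x^2m : x ^ m * x ^ m ≡ x ^ length (subsets (suc n))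
  x^2m = trans (sym (ℤ.^-distribˡ-+-* x m m)) (cong (x ^_) (sym (length-subsets-suc n)))
  recursion : X * (y ^ m * y ^ q) ≡ x ^ m * x ^ q * (a * b)
  recursion = begin
    X * (y ^ m * y ^ q) ≡⟨ cong (λ z → X * (y ^ m * z)) (∏-unless S₁? (subsets n) y) ⟨
    _ ≡⟨ χ-recursion S? (swapClosed⇒nearCone sc) x ⟩
    _ ≡⟨ cong (λ z → x ^ m * z * (a * b)) (∏-unless S₁? (subsets n) x) ⟩
    x ^ m * x ^ q * (a * b) ∎
  alg₁ : ∀ X xp ym a b r q → X * xp * (ym * (a * b * r * q)) ≡ X * (ym * q) * (xp * a * b * r)
  alg₁ = solve-∀
  alg₂ : ∀ xm xq a b xp u v r → xm * xq * (a * b) * (xp * u * v * r) ≡ xm * (xp * xq) * (r * ((a * u) * (b * v)))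
  alg₂ = solve-∀
  alg₃ : ∀ xm r ym u v → xm * xm * (r * ((ym * u) * (ym * v))) ≡ xm * xm * (r * (u * v)) * (ym * ym)
  alg₃ = solve-∀

-- Homogeneous polynomials in two variables

-- Two variables allow the same polynomial to be used at `b = 1`, where it is a characteristic
-- polynomial, and at `a = 1`, where its linear coefficient in `b` is minus the trace.
hom : ∀ {N} → Vec ℤ (suc N) → ℤ → ℤ → ℤ
hom {zero}  (c ∷ []) a b = c
hom {suc N} (c ∷ cs) a b = c * b ^ suc N + a * hom cs a b

Homogeneous : ℕ → (ℤ → ℤ → ℤ) → Set
Homogeneous N f = ∃[ cs ] ∀ a b → f a b ≡ hom {N} cs a b

homogeneous-cong : ∀ {N f g} → (∀ a b → g a b ≡ f a b) → Homogeneous N f → Homogeneous N g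
homogeneous-cong g≡f (cs , h) = cs , λ a b → trans (g≡f a b) (h a b)

homogeneous-zero : ∀ N → Homogeneous N (λ _ _ → 0ℤ)
homogeneous-zero zero    = 0ℤ ∷ [] , λ a b → refl
homogeneous-zero (suc N) with homogeneous-zero N
... | cs , h = 0ℤ ∷ cs , λ a b → sym (cong₂ _+_ (ℤ.*-zeroˡ (b ^ suc N)) (trans (cong (a *_) (sym (h a b))) (ℤ.*-zeroʳ a)))

homogeneous-+ : ∀ {N f g} → Homogeneous N f → Homogeneous N g → Homogeneous N (λ a b → f a b + g a b)
homogeneous-+ (cs , hf) (ds , hg) with add cs ds
  where
  add : ∀ {N} (cs ds : Vec ℤ (suc N)) → ∃[ es ] ∀ a b → hom cs a b + hom ds a b ≡ hom {N} es a b
  add {zero}  (c ∷ []) (d ∷ []) = c + d ∷ [] , λ a b → refl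
  add {suc N} (c ∷ cs) (d ∷ ds) with add cs ds
  ... | es , h = c + d ∷ es , λ a b → trans (alg c d (b ^ suc N) a (hom cs a b) (hom ds a b)) (cong (λ z → (c + d) * b ^ suc N + a * z) (h a b))
    where
    alg : ∀ c d b a u v → c * b + a * u + (d * b + a * v) ≡ (c + d) * b + a * (u + v)
    alg = solve-∀
... | es , h = es , λ a b → trans (cong₂ _+_ (hf a b) (hg a b)) (h a b)

homogeneous-scale : ∀ {N f} k → Homogeneous N f → Homogeneous N (λ a b → k * f a b)
homogeneous-scale k (cs , hf) with scale cs
  where
  scale : ∀ {N} (cs : Vec ℤ (suc N)) → ∃[ es ] ∀ a b → k * hom cs a b ≡ hom {N} es a b
  scale {zero}  (c ∷ []) = k * c ∷ [] , λ a b → refl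
  scale {suc N} (c ∷ cs) with scale cs
  ... | es , h = k * c ∷ es , λ a b → trans (alg k c (b ^ suc N) a (hom cs a b)) (cong (λ z → k * c * b ^ suc N + a * z) (h a b))
    where
    alg : ∀ k c b a u → k * (c * b + a * u) ≡ k * c * b + a * (k * u)
    alg = solve-∀
... | es , h = es , λ a b → trans (cong (k *_) (hf a b)) (h a b)

homogeneous-a* : ∀ {N f} → Homogeneous N f → Homogeneous (suc N) (λ a b → a * f a b)
homogeneous-a* {N} {f} (cs , hf) = 0ℤ ∷ cs , λ a b →
  trans (cong (a *_) (hf a b)) (sym (trans (cong (λ z → z + a * hom cs a b) (ℤ.*-zeroˡ (b ^ suc N))) (ℤ.+-identityˡ _)))

homogeneous-b* : ∀ {N f} → Homogeneous N f → Homogeneous (suc N) (λ a b → b * f a b)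
homogeneous-b* (cs , hf) with shift cs
  where
  shift : ∀ {N} (cs : Vec ℤ (suc N)) → ∃[ es ] ∀ a b → b * hom cs a b ≡ hom {suc N} es a b
  shift {zero}  (c ∷ []) = c ∷ 0ℤ ∷ [] , λ a b → alg c a b
    where
    alg : ∀ c a b → b * c ≡ c * (b * 1ℤ) + a * 0ℤ
    alg = solve-∀
  shift {suc N} (c ∷ cs) with shift cs
  ... | es , h = c ∷ es , λ a b → trans (alg c (b ^ suc N) b a (hom cs a b)) (cong (λ z → c * (b * b ^ suc N) + a * z) (h a b))
    where
    alg : ∀ c p b a u → b * (c * p + a * u) ≡ c * (b * p) + a * (b * u)
    alg = solve-∀
... | es , h = es , λ a b → trans (cong (b *_) (hf a b)) (h a b)

-- Agreement of polynomials is available only above `n` in one application and only at perfect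
-- squares in the other.
Unboundedly : (ℕ → Set) → Set
Unboundedly P = ∀ B → ∃[ t ] B ℕ.< t × P t

-- At a zero `t > ∣ c ∣` the constant coefficient `c` is a multiple of `t`, hence 0. What remains is
-- divisible by `t`, and the quotient vanishes at the same arguments.
hom-vanishes : ∀ {N} (cs : Vec ℤ (suc N)) → Unboundedly (λ t → hom cs (+ t) 1ℤ ≡ 0ℤ) → ∀ a b → hom cs a b ≡ 0ℤ
hom-vanishes {zero}  (c ∷ []) zeros a b = proj₂ (proj₂ (zeros 0))
hom-vanishes {suc N} (c ∷ cs) zeros a b =
  cong₂ _+_ (trans (cong (_* b ^ suc N) c≡0) (ℤ.*-zeroˡ (b ^ suc N)))
            (trans (cong (a *_) (hom-vanishes cs zeros′ a b)) (ℤ.*-zeroʳ a))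
  where
  constant : ∀ t → hom (c ∷ cs) (+ t) 1ℤ ≡ c + + t * hom cs (+ t) 1ℤ
  constant t = cong (λ z → z + + t * hom cs (+ t) 1ℤ) (trans (cong (c *_) (ℤ.^-zeroˡ (suc N))) (ℤ.*-identityʳ c))
  small : ∀ t h → ℤ.∣ c ∣ ℕ.< t → c ≡ + t * h → c ≡ 0ℤ
  small t h c<t e with h ℤ.≟ 0ℤ
  ... | yes refl = trans e (ℤ.*-zeroʳ (+ t))
  ... | no h≢0   = ⊥-elim (ℕ.<⇒≱ c<t (subst (t ≤_) (sym (trans (cong ℤ.∣_∣ e) (ℤ.abs-* (+ t) h)))
                     (ℕ.m≤m*n t ℤ.∣ h ∣ {{ℕ.≢-nonZero (h≢0 ∘ ℤ.∣i∣≡0⇒i≡0)}})))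
  c≡0 : c ≡ 0ℤ
  c≡0 with zeros ℤ.∣ c ∣
  ... | t , c<t , z = small t (- hom cs (+ t) 1ℤ) c<t (alg c (+ t) (hom cs (+ t) 1ℤ) (trans (sym (constant t)) z))
    where
    alg₁ : ∀ c t h → c ≡ c + t * h - t * h
    alg₁ = solve-∀
    alg₂ : ∀ t h → 0ℤ - t * h ≡ t * (- h)
    alg₂ = solve-∀
    alg : ∀ c t h → c + t * h ≡ 0ℤ → c ≡ t * (- h)
    alg c t h e = trans (alg₁ c t h) (trans (cong (λ z → z - t * h) e) (alg₂ t h))
  zeros′ : Unboundedly (λ t → hom cs (+ t) 1ℤ ≡ 0ℤ)
  zeros′ B with zeros B
  ... | t , B<t , z with ℤ.i*j≡0⇒i≡0∨j≡0 (+ t) (trans (sym (trans (constant t)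
                           (trans (cong (λ z → z + + t * hom cs (+ t) 1ℤ) c≡0) (ℤ.+-identityˡ _)))) z)
  ...   | inj₁ t≡0 = ⊥-elim (ℕ.<⇒≢ (ℕ.≤-<-trans ℕ.z≤n B<t) (sym (ℤ.+-injective t≡0)))
  ...   | inj₂ h≡0 = t , B<t , h≡0

homogeneous-unique : ∀ {N f g} → Homogeneous N f → Homogeneous N g →
  Unboundedly (λ t → f (+ t) 1ℤ ≡ g (+ t) 1ℤ) → ∀ a b → f a b ≡ g a b
homogeneous-unique {f = f} {g} hf hg agree a b with homogeneous-+ hf (homogeneous-scale -1ℤ hg)
... | cs , h = ℤ.i-j≡0⇒i≡j (f a b) (g a b)
    (trans (sym (neg (f a b) (g a b))) (trans (h a b) (hom-vanishes cs zeros a b)))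
  where
  neg : ∀ u v → u + -1ℤ * v ≡ u - v
  neg = solve-∀
  zeros : Unboundedly (λ t → hom cs (+ t) 1ℤ ≡ 0ℤ)
  zeros B with agree B
  ... | t , B<t , e = t , B<t , trans (sym (h (+ t) 1ℤ)) (trans (neg (f (+ t) 1ℤ) _) (ℤ.i≡j⇒i-j≡0 e))

-- Characteristic polynomials

∑-allFin : ∀ {n} (f : Fin n → ℤ) → ∑ (allFin n) f ≡ sum f
∑-allFin = ∑-tabulate id

det-cong : ∀ {N} {A B : Matrix N N} → (∀ i j → A i j ≡ B i j) → det A ≡ det B
det-cong {zero}  h = refl
det-cong {suc N} h = sum-cong-≗ (λ j → cong₂ (λ u v → (-1ℤ ^ toℕ j) * u * v) (h zero j) (det-cong (λ a b → h (suc a) (punchIn j b))))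

homogeneous-sum : ∀ {n N} {f : Fin n → ℤ → ℤ → ℤ} → (∀ j → Homogeneous N (f j)) → Homogeneous N (λ a b → sum (λ j → f j a b))
homogeneous-sum {zero}  {N} h = homogeneous-zero N
homogeneous-sum {suc n}     h = homogeneous-+ (h zero) (homogeneous-sum (h ∘ suc))

det-homogeneous : ∀ {N} (U V : Matrix N N) → Homogeneous N (λ a b → det (λ i j → a * U i j + b * V i j))
det-homogeneous {zero}  U V = 1ℤ ∷ [] , λ a b → refl
det-homogeneous {suc N} U V = homogeneous-sum λ j →
  let s = -1ℤ ^ toℕ j
      h = det-homogeneous (λ a b → U (suc a) (punchIn j b)) (λ a b → V (suc a) (punchIn j b))
  in homogeneous-cong (λ a b → alg s a (U zero j) b (V zero j) (det (λ i k → a * U (suc i) (punchIn j k) + b * V (suc i) (punchIn j k))))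
       (homogeneous-+ (homogeneous-scale (s * U zero j) (homogeneous-a* h)) (homogeneous-scale (s * V zero j) (homogeneous-b* h)))
  where
  alg : ∀ s a u b v d → s * (a * u + b * v) * d ≡ s * u * (a * d) + s * v * (b * d)
  alg = solve-∀

∏-homogeneous : (νs : List ℤ) → Homogeneous (length νs) (λ a b → ∏ νs (λ ν → a - b * ν))
∏-homogeneous []       = 1ℤ ∷ [] , λ a b → refl
∏-homogeneous (ν ∷ νs) = homogeneous-cong (λ a b → alg a b ν (∏ νs (λ ν → a - b * ν)))
  (homogeneous-+ (homogeneous-a* (∏-homogeneous νs)) (homogeneous-scale (- ν) (homogeneous-b* (∏-homogeneous νs))))
  where
  alg : ∀ a b v p → (a - b * v) * p ≡ a * p + (- v) * (b * p)
  alg = solve-∀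

split-homogeneous : ∀ z (νs : List ℤ) → Homogeneous (z ℕ.+ length νs) (λ a b → a ^ z * ∏ νs (λ ν → a - b * ν))
split-homogeneous zero    νs = homogeneous-cong (λ a b → ℤ.*-identityˡ _) (∏-homogeneous νs)
split-homogeneous (suc z) νs = homogeneous-cong (λ a b → ℤ.*-assoc a _ _) (homogeneous-a* (split-homogeneous z νs))

𝟙 : ∀ {N} → Matrix N N
𝟙 = scalar 1ℤ

scalar-diag : ∀ {N} x (i : Fin N) → scalar x i i ≡ x
scalar-diag x i with i Fin.≟ i
... | yes _  = refl
... | no i≢i = ⊥-elim (i≢i refl)

scalar-off : ∀ {N} x {i j : Fin N} → i ≢ j → scalar x i j ≡ 0ℤ
scalar-off x {i} {j} i≢j with i Fin.≟ j
... | yes i≡j = ⊥-elim (i≢j i≡j)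
... | no _    = refl

scalar-𝟙 : ∀ {N} x (i j : Fin N) → scalar x i j ≡ x * 𝟙 i j
scalar-𝟙 x i j with i Fin.≟ j
... | yes _ = sym (ℤ.*-identityʳ x)
... | no _  = sym (ℤ.*-zeroʳ x)

𝟙-suc : ∀ {N} (i j : Fin N) → 𝟙 (suc i) (suc j) ≡ 𝟙 i j
𝟙-suc i j with i Fin.≟ j
... | yes _ = refl
... | no _  = refl

charHom : ∀ {N} → Matrix N N → ℤ → ℤ → ℤ
charHom A a b = det (λ i j → a * 𝟙 i j + b * (- A i j))

charHom-charPoly : ∀ {N} (A : Matrix N N) x → charHom A x 1ℤ ≡ charPoly A x
charHom-charPoly A x = det-cong (λ i j → cong₂ _+_ (sym (scalar-𝟙 x i j)) (ℤ.*-identityˡ (- A i j)))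

charHom-homogeneous : ∀ {N} (A : Matrix N N) → Homogeneous N (charHom A)
charHom-homogeneous A = det-homogeneous 𝟙 (λ i j → - A i j)

charPoly-unique : ∀ {N} (A : Matrix N N) z (νs : List ℤ) → z ℕ.+ length νs ≡ N →
  Unboundedly (λ t → charPoly A (+ t) ≡ (+ t) ^ z * ∏ νs (λ ν → + t - ν)) →
  ∀ a b → charHom A a b ≡ a ^ z * ∏ νs (λ ν → a - b * ν)
charPoly-unique A z νs refl agree = homogeneous-unique (charHom-homogeneous A) (split-homogeneous z νs) agree′
  where
  agree′ : Unboundedly (λ t → charHom A (+ t) 1ℤ ≡ (+ t) ^ z * ∏ νs (λ ν → + t - 1ℤ * ν))
  agree′ B with agree B
  ... | t , B<t , e = t , B<t , trans (charHom-charPoly A (+ t)) (trans e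
          (cong ((+ t) ^ z *_) (∏-cong∈ νs (λ {ν} _ → cong (λ v → + t - v) (sym (ℤ.*-identityˡ ν))))))

-- Modulo b², a determinant det (1 - b A) is 1 - b tr A.

-- Each term of the expansion along the first row either takes its entry from the first column or
-- keeps that column in its minor.
det-divisible : ∀ {N} (M : Matrix (suc N) (suc N)) b (v : Fin (suc N) → ℤ) → (∀ i → M i zero ≡ b * v i) → ∃[ e ] det M ≡ b * e
sum-divisible : ∀ {n} b (f : Fin n → ℤ) → (∀ j → ∃[ e ] f j ≡ b * e) → ∃[ e ] sum f ≡ b * e
sum-divisible {zero}  b f h = 0ℤ , sym (ℤ.*-zeroʳ b)
sum-divisible {suc n} b f h with h zero | sum-divisible b (f ∘ suc) (h ∘ suc)
... | e , p | e′ , q = e + e′ , trans (cong₂ _+_ p q) (sym (ℤ.*-distribˡ-+ b e e′))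

det-divisible {N} M b v col = sum-divisible b _ term
  where
  alg₁ : ∀ b v d → 1ℤ * (b * v) * d ≡ b * (v * d)
  alg₁ = solve-∀
  alg₂ : ∀ s m b e → s * m * (b * e) ≡ b * (s * m * e)
  alg₂ = solve-∀
  term : ∀ j → ∃[ e ] (-1ℤ ^ toℕ j) * M zero j * det (λ a c → M (suc a) (punchIn j c)) ≡ b * e
  term zero = _ , trans (cong (λ z → 1ℤ * z * det (λ a c → M (suc a) (suc c))) (col zero)) (alg₁ b (v zero) _)
  term (suc {suc N′} j) with det-divisible (λ a c → M (suc a) (punchIn (suc j) c)) b (v ∘ suc) (col ∘ suc)
  ... | e , p = _ , trans (cong ((-1ℤ ^ suc (toℕ j)) * M zero (suc j) *_) p) (alg₂ (-1ℤ ^ suc (toℕ j)) (M zero (suc j)) b e)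

-- In the expansion along the first row, a term with column `suc j` has one factor `b` from its
-- entry and a second one from its minor, whose first column lies below the diagonal. Modulo `b²`
-- only the corner term is left, and induction applies to its minor.
charHom-trace : ∀ {N} (A : Matrix N N) b → ∃[ e ] charHom A 1ℤ b ≡ 1ℤ - b * sum (λ i → A i i) + b * b * e
charHom-trace {zero}  A b = 0ℤ , sym (alg b)
  where
  alg : ∀ b → 1ℤ - b * 0ℤ + b * b * 0ℤ ≡ 1ℤ
  alg = solve-∀
charHom-trace {suc N} A b with charHom-trace (λ i j → A (suc i) (suc j)) b | sum-divisible (b * b) _ term
  where
  term : ∀ j → ∃[ e ] (-1ℤ ^ suc (toℕ j)) * (1ℤ * 𝟙 zero (suc j) + b * (- A zero (suc j))) *
                      det (λ i k → 1ℤ * 𝟙 (suc i) (punchIn (suc j) k) + b * (- A (suc i) (punchIn (suc j) k))) ≡ b * b * e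
  term = go {N} {A}
    where
    alg₁ : ∀ z → 1ℤ * 0ℤ + z ≡ z
    alg₁ = solve-∀
    alg₂ : ∀ s b a e → s * (b * a) * (b * e) ≡ b * b * (s * a * e)
    alg₂ = solve-∀
    go : ∀ {N} {A : Matrix (suc N) (suc N)} (j : Fin N) →
      ∃[ e ] (-1ℤ ^ suc (toℕ j)) * (1ℤ * 𝟙 zero (suc j) + b * (- A zero (suc j))) *
                      det (λ i k → 1ℤ * 𝟙 (suc i) (punchIn (suc j) k) + b * (- A (suc i) (punchIn (suc j) k))) ≡ b * b * e
    go {suc N} {A} j with det-divisible (λ i k → 1ℤ * 𝟙 (suc i) (punchIn (suc j) k) + b * (- A (suc i) (punchIn (suc j) k)))
                     b (λ i → - A (suc i) zero) (λ i → alg₁ (b * (- A (suc i) zero)))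
    ... | e , p = _ , trans (cong₂ (λ u v → (-1ℤ ^ suc (toℕ j)) * u * v) (alg₁ (b * (- A zero (suc j)))) p)
                            (alg₂ (-1ℤ ^ suc (toℕ j)) b (- A zero (suc j)) e)
... | e , p | e′ , q = _ , trans (cong₂ _+_ (cong (1ℤ * (1ℤ * 1ℤ + b * (- A zero zero)) *_)
        (trans (det-cong (λ i j → cong (λ u → 1ℤ * u + b * (- A (suc i) (suc j))) (𝟙-suc i j))) p)) q)
      (alg (A zero zero) b (sum (λ i → A (suc i) (suc i))) e e′)
  where
  alg : ∀ a b t e e′ → 1ℤ * (1ℤ * 1ℤ + b * (- a)) * (1ℤ - b * t + b * b * e) + b * b * e′ ≡
    1ℤ - b * (a + t) + b * b * (e + a * t - b * a * e + e′)
  alg = solve-∀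

∏-trace : (νs : List ℤ) (b : ℤ) → ∃[ e ] ∏ νs (λ ν → 1ℤ - b * ν) ≡ 1ℤ - b * ∑ νs id + b * b * e
∏-trace []       b = 0ℤ , sym (alg b)
  where
  alg : ∀ b → 1ℤ - b * 0ℤ + b * b * 0ℤ ≡ 1ℤ
  alg = solve-∀
∏-trace (ν ∷ νs) b with ∏-trace νs b
... | e , p = _ , trans (cong ((1ℤ - b * ν) *_) p) (alg b ν (∑ νs id) e)
  where
  alg : ∀ b v s e → (1ℤ - b * v) * (1ℤ - b * s + b * b * e) ≡ 1ℤ - b * (v + s) + b * b * (e + v * s - b * v * e)
  alg = solve-∀

-- Take `b = ∣ d ∣ + 1`: a nonzero multiple of it exceeds `d` in absolute value.
multiple-of-all : ∀ d → (∀ b → b ≢ 0ℤ → ∃[ e ] d ≡ b * e) → d ≡ 0ℤ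
multiple-of-all d h with h (+ suc ℤ.∣ d ∣) (λ ())
... | e , p with e ℤ.≟ 0ℤ
...   | yes refl = trans p (ℤ.*-zeroʳ (+ suc ℤ.∣ d ∣))
...   | no e≢0   = ⊥-elim (ℕ.1+n≰n (subst (suc ℤ.∣ d ∣ ≤_) (sym (trans (cong ℤ.∣_∣ p) (ℤ.abs-* (+ suc ℤ.∣ d ∣) e)))
                     (ℕ.m≤m*n (suc ℤ.∣ d ∣) ℤ.∣ e ∣ {{ℕ.≢-nonZero (e≢0 ∘ ℤ.∣i∣≡0⇒i≡0)}})))

-- The remainders in `charHom-trace` and `∏-trace` may vary with `b`, so coefficients cannot be
-- compared directly. Equating the two expansions shows instead that every `b ≠ 0` divides the
-- difference of the two sums.
trace-of-split : ∀ {N} (A : Matrix N N) z (νs : List ℤ) → (∀ a b → charHom A a b ≡ a ^ z * ∏ νs (λ ν → a - b * ν)) →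
  sum (λ i → A i i) ≡ ∑ νs id
trace-of-split A z νs split = ℤ.i-j≡0⇒i≡j _ _ (multiple-of-all (t - s) multiple)
  where
  t = sum (λ i → A i i)
  s = ∑ νs id
  alg : ∀ b t s e e′ → 1ℤ - b * t + b * b * e ≡ 1ℤ - b * s + b * b * e′ → b * (t - s) ≡ b * (b * (e - e′))
  alg b t s e e′ h = trans (alg₁ b t s e e′) (trans (cong (λ z → b * b * e - z + (1ℤ - b * s)) h) (alg₂ b s e e′))
    where
    alg₁ : ∀ b t s e e′ → b * (t - s) ≡ b * b * e - (1ℤ - b * t + b * b * e) + (1ℤ - b * s)
    alg₁ = solve-∀
    alg₂ : ∀ b s e e′ → b * b * e - (1ℤ - b * s + b * b * e′) + (1ℤ - b * s) ≡ b * (b * (e - e′))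
    alg₂ = solve-∀
  multiple : ∀ b → b ≢ 0ℤ → ∃[ e ] t - s ≡ b * e
  multiple b b≢0 with charHom-trace A b | ∏-trace νs b
  ... | e , p | e′ , q = e - e′ , ℤ.*-cancelˡ-≡ b (t - s) (b * (e - e′)) {{ℤ.≢-nonZero b≢0}}
        (alg b t s e e′ (trans (sym p) (trans (split 1ℤ b) (trans (cong (_* ∏ νs (λ ν → 1ℤ - b * ν)) (ℤ.^-zeroˡ z)) (trans (ℤ.*-identityˡ _) q)))))

-- The square of a matrix and its trace

det-allFin : ∀ {N} (A : Matrix N N) → det A ≡ detL (allFin N) A
det-allFin A = trans (det-minor A id) (cong (λ rs → minor rs (allFin _)) (sym (List.map-tabulate id A)))

square : ∀ {N} → Matrix N N → Matrix N N
square {N} A i k = ∑ (allFin N) (λ j → A i j * A j k)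

∑-𝟙ˡ : ∀ {N} x (i : Fin N) (f : Fin N → ℤ) → ∑ (allFin N) (λ j → scalar x i j * f j) ≡ x * f i
∑-𝟙ˡ x i f = trans (∑-only (Unique.allFin⁺ _) (List.∈-allFin i) (λ {j} _ j≢i → trans (cong (_* f j) (scalar-off x (j≢i ∘ sym))) (ℤ.*-zeroˡ (f j))))
                   (cong (_* f i) (scalar-diag x i))

∑-𝟙ʳ : ∀ {N} x (k : Fin N) (f : Fin N → ℤ) → ∑ (allFin N) (λ j → f j * scalar x j k) ≡ f k * x
∑-𝟙ʳ x k f = trans (∑-only (Unique.allFin⁺ _) (List.∈-allFin k) (λ {j} _ j≢k → trans (cong (f j *_) (scalar-off x j≢k)) (ℤ.*-zeroʳ (f j))))
                   (cong (f k *_) (scalar-diag x k))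

-- `x² - A²` factors as `(x - A) (x + A)`. The determinant of the second factor is rewritten through
-- `charPoly A (- x)`, so that a splitting of `charPoly A` can be inserted in both places.
charPoly-square : ∀ {N} (A : Matrix N N) x → charPoly (square A) (x * x) ≡ charPoly A x * (-1ℤ ^ N * charPoly A (- x))
charPoly-square {N} A x = begin
  det (λ i j → scalar (x * x) i j - square A i j) ≡⟨ det-cong (λ i k → sym (coefficient i k)) ⟩
  det (λ i k → ∑ (allFin N) (λ j → M i j * P j k)) ≡⟨ det-allFin {N} _ ⟩
  detL (allFin N) (λ i k → ∑ (allFin N) (λ j → M i j * P j k)) ≡⟨ detL-* (allFin N) M P ⟩
  detL (allFin N) M * detL (allFin N) P ≡⟨ cong₂ _*_ (sym (det-allFin M)) negated ⟩
  charPoly A x * (-1ℤ ^ N * charPoly A (- x)) ∎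
  where
  M P : Matrix N N
  M i j = scalar x i j - A i j
  P i j = scalar x i j + A i j
  coefficient : ∀ i k → ∑ (allFin N) (λ j → M i j * P j k) ≡ scalar (x * x) i k - square A i k
  coefficient i k = begin
    ∑ (allFin N) (λ j → M i j * P j k)
      ≡⟨ ∑-cong (allFin N) (λ j → expand (scalar x i j) (A i j) (scalar x j k) (A j k)) ⟩
    ∑ (allFin N) (λ j → (scalar x i j * P j k + (- A i j) * scalar x j k) + -1ℤ * (A i j * A j k))
      ≡⟨ ∑-+ (allFin N) _ _ ⟩
    ∑ (allFin N) (λ j → scalar x i j * P j k + (- A i j) * scalar x j k) + ∑ (allFin N) (λ j → -1ℤ * (A i j * A j k))
      ≡⟨ cong₂ _+_ (trans (∑-+ (allFin N) _ _) (cong₂ _+_ (∑-𝟙ˡ x i (λ j → P j k)) (∑-𝟙ʳ x k (λ j → - A i j)))) (∑-*ˡ (allFin N) -1ℤ _) ⟩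
    x * P i k + (- A i k) * x + -1ℤ * square A i k
      ≡⟨ cong (λ u → x * (u + A i k) + (- A i k) * x + -1ℤ * square A i k) (scalar-𝟙 x i k) ⟩
    x * (x * 𝟙 i k + A i k) + (- A i k) * x + -1ℤ * square A i k
      ≡⟨ collect x (𝟙 i k) (A i k) (square A i k) ⟩
    x * x * 𝟙 i k - square A i k
      ≡⟨ cong (λ z → z - square A i k) (scalar-𝟙 (x * x) i k) ⟨
    scalar (x * x) i k - square A i k ∎
    where
    expand : ∀ s a s′ a′ → (s - a) * (s′ + a′) ≡ (s * (s′ + a′) + (- a) * s′) + -1ℤ * (a * a′)
    expand = solve-∀
    collect : ∀ x e a q → x * (x * e + a) + (- a) * x + -1ℤ * q ≡ x * x * e - q
    collect = solve-∀
  negated : detL (allFin N) P ≡ -1ℤ ^ N * charPoly A (- x)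
  negated = begin
    detL (allFin N) P
      ≡⟨ detL-cong∈ (allFin N) (λ {i} {j} _ _ → trans (cong (λ u → u + A i j) (scalar-𝟙 x i j)) (trans (alg x (𝟙 i j) (A i j)) (cong (λ u → -1ℤ * (u - A i j)) (sym (scalar-𝟙 (- x) i j))))) ⟩
    detL (allFin N) (λ i j → -1ℤ * (scalar (- x) i j - A i j))
      ≡⟨ detL-scale (λ _ → -1ℤ) _ (allFin N) ⟩
    ∏ (allFin N) (λ _ → -1ℤ) * detL (allFin N) (λ i j → scalar (- x) i j - A i j)
      ≡⟨ cong₂ _*_ (trans (∏-const (allFin N) -1ℤ) (cong (-1ℤ ^_) (List.length-tabulate {n = N} id))) (sym (det-allFin {N} _)) ⟩
    -1ℤ ^ N * charPoly A (- x) ∎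
    where
    alg : ∀ x e a → x * e + a ≡ -1ℤ * ((- x) * e - a)
    alg = solve-∀

product-∏ : ∀ x (μs : List ℤ) → product (map (λ μ → x - μ) μs) ≡ ∏ μs (λ μ → x - μ)
product-∏ x []       = refl
product-∏ x (μ ∷ μs) = cong ((x - μ) *_) (product-∏ x μs)

trace-square : ∀ {N} (A : Matrix N N) (μs : List ℤ) → NonzeroEigenvalues A μs →
  sum (λ i → square A i i) ≡ ∑ μs (λ μ → μ * μ)
trace-square {N} A μs spec = trans
  (trace-of-split (square A) z νs (charPoly-unique (square A) z νs (trans (cong (z ℕ.+_) (List.length-map _ μs)) total) agree))
  (∑-map (λ μ → μ * μ) μs id)
  where
  open NonzeroEigenvalues spec
  νs = map (λ μ → μ * μ) μs
  -- Each of the `z + length μs` linear factors absorbs one sign, which turns `- x` into `x` and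
  -- `- x - μ` into `x + μ`.
  signs : ∀ x z μs → (-1ℤ ^ (z ℕ.+ length μs)) * ((- x) ^ z * ∏ μs (λ μ → - x - μ)) ≡ x ^ z * ∏ μs (λ μ → x + μ)
  signs x zero    []       = refl
  signs x zero    (μ ∷ μs) = trans (alg (-1ℤ ^ length μs) x μ (∏ μs (λ μ → - x - μ))) (trans (cong ((x + μ) *_) (signs x zero μs)) (alg₂ x μ (∏ μs (λ μ → x + μ))))
    where
    alg : ∀ s x m p → -1ℤ * s * (1ℤ * ((- x - m) * p)) ≡ (x + m) * (s * (1ℤ * p))
    alg = solve-∀
    alg₂ : ∀ x m p → (x + m) * (1ℤ * p) ≡ 1ℤ * ((x + m) * p)
    alg₂ = solve-∀
  signs x (suc z) μs = trans (alg (-1ℤ ^ (z ℕ.+ length μs)) x ((- x) ^ z) (∏ μs (λ μ → - x - μ)))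
    (trans (cong (x *_) (signs x z μs)) (sym (ℤ.*-assoc x (x ^ z) _)))
    where
    alg : ∀ s x p q → -1ℤ * s * ((- x) * p * q) ≡ x * (s * (p * q))
    alg = solve-∀
  pow-sq : ∀ x z → x ^ z * x ^ z ≡ (x * x) ^ z
  pow-sq x zero    = refl
  pow-sq x (suc z) = trans (*-interchange x (x ^ z) x (x ^ z)) (cong (x * x *_) (pow-sq x z))
  value : ∀ x → charPoly (square A) (x * x) ≡ (x * x) ^ z * ∏ νs (λ ν → x * x - ν)
  value x = begin
    charPoly (square A) (x * x)
      ≡⟨ charPoly-square A x ⟩
    charPoly A x * (-1ℤ ^ N * charPoly A (- x))
      ≡⟨ cong₂ (λ u v → u * (-1ℤ ^ N * v)) (at x) (at (- x)) ⟩
    x ^ z * ∏ μs (λ μ → x - μ) * (-1ℤ ^ N * ((- x) ^ z * ∏ μs (λ μ → - x - μ)))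
      ≡⟨ cong (λ k → x ^ z * ∏ μs (λ μ → x - μ) * (-1ℤ ^ k * ((- x) ^ z * ∏ μs (λ μ → - x - μ)))) total ⟨
    x ^ z * ∏ μs (λ μ → x - μ) * (-1ℤ ^ (z ℕ.+ length μs) * ((- x) ^ z * ∏ μs (λ μ → - x - μ)))
      ≡⟨ cong (x ^ z * ∏ μs (λ μ → x - μ) *_) (signs x z μs) ⟩
    x ^ z * ∏ μs (λ μ → x - μ) * (x ^ z * ∏ μs (λ μ → x + μ))
      ≡⟨ *-interchange (x ^ z) (∏ μs (λ μ → x - μ)) (x ^ z) (∏ μs (λ μ → x + μ)) ⟩
    x ^ z * x ^ z * (∏ μs (λ μ → x - μ) * ∏ μs (λ μ → x + μ))
      ≡⟨ cong₂ _*_ (pow-sq x z) (trans (sym (∏-* μs _ _)) (trans (∏-cong∈ μs (λ {μ} _ → difference x μ)) (sym (∏-map (λ μ → μ * μ) μs _)))) ⟩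
    (x * x) ^ z * ∏ νs (λ ν → x * x - ν) ∎
    where
    at : ∀ x → charPoly A x ≡ x ^ z * ∏ μs (λ μ → x - μ)
    at x = trans (splits x) (cong (x ^ z *_) (product-∏ x μs))
    difference : ∀ x m → (x - m) * (x + m) ≡ x * x - m * m
    difference = solve-∀
  agree : Unboundedly (λ t → charPoly (square A) (+ t) ≡ (+ t) ^ z * ∏ νs (λ ν → + t - ν))
  agree B = suc B ℕ.* suc B , ℕ.m≤m*n (suc B) (suc B) ,
    subst (λ t → charPoly (square A) t ≡ t ^ z * ∏ νs (λ ν → t - ν)) (sym (ℤ.pos-* (suc B) (suc B))) (value (+ suc B))

-- Subsets under permutations and deletions

∈-lookup : ∀ {n} {F : Subset n} {v} → v ∈ F → Vec.lookup F v ≡ inside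
∈-lookup = Vec.[]=⇒lookup

lookup-∈ : ∀ {n} {F : Subset n} {v} → Vec.lookup F v ≡ inside → v ∈ F
lookup-∈ {F = F} {v} = Vec.lookup⇒[]= v F

subset-ext : ∀ {n} {F G : Subset n} → (∀ v → Vec.lookup F v ≡ Vec.lookup G v) → F ≡ G
subset-ext {F = F} {G} h = trans (sym (Vec.tabulate∘lookup F)) (trans (Vec.tabulate-cong h) (Vec.tabulate∘lookup G))

perm-injective : ∀ {n} (π : Permutation′ n) {u v} → π ⟨$⟩ʳ u ≡ π ⟨$⟩ʳ v → u ≡ v
perm-injective π e = trans (sym (inverseˡ π)) (trans (cong (π ⟨$⟩ˡ_) e) (inverseˡ π))

lookup-preimage : ∀ {n} (π : Permutation′ n) (F : Subset n) v → Vec.lookup (preimage π F) v ≡ Vec.lookup F (π ⟨$⟩ʳ v)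
lookup-preimage π F v = Vec.lookup∘tabulate _ v

∈-preimage⁺ : ∀ {n} (π : Permutation′ n) {F : Subset n} {v} → π ⟨$⟩ʳ v ∈ F → v ∈ preimage π F
∈-preimage⁺ π {F} {v} h = lookup-∈ (trans (lookup-preimage π F v) (∈-lookup h))

∈-preimage⁻ : ∀ {n} (π : Permutation′ n) {F : Subset n} {v} → v ∈ preimage π F → π ⟨$⟩ʳ v ∈ F
∈-preimage⁻ π {F} {v} h = lookup-∈ (trans (sym (lookup-preimage π F v)) (∈-lookup h))

preimage-injective : ∀ {n} (π : Permutation′ n) {F G : Subset n} → preimage π F ≡ preimage π G → F ≡ G
preimage-injective π {F} {G} e = subset-ext λ w → begin
  Vec.lookup F w ≡⟨ cong (Vec.lookup F) (inverseʳ π) ⟨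
  Vec.lookup F (π ⟨$⟩ʳ (π ⟨$⟩ˡ w)) ≡⟨ lookup-preimage π F _ ⟨
  Vec.lookup (preimage π F) (π ⟨$⟩ˡ w) ≡⟨ cong (λ H → Vec.lookup H (π ⟨$⟩ˡ w)) e ⟩
  Vec.lookup (preimage π G) (π ⟨$⟩ˡ w) ≡⟨ lookup-preimage π G _ ⟩
  Vec.lookup G (π ⟨$⟩ʳ (π ⟨$⟩ˡ w)) ≡⟨ cong (Vec.lookup G) (inverseʳ π) ⟩
  Vec.lookup G w ∎

preimage-update : ∀ {n} (π : Permutation′ n) (F : Subset n) x b →
  preimage π (F [ π ⟨$⟩ʳ x ]≔ b) ≡ preimage π F [ x ]≔ b
preimage-update π F x b = subset-ext λ v → trans (lookup-preimage π (F [ π ⟨$⟩ʳ x ]≔ b) v) (go v)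
  where
  go : ∀ v → Vec.lookup (F [ π ⟨$⟩ʳ x ]≔ b) (π ⟨$⟩ʳ v) ≡ Vec.lookup (preimage π F [ x ]≔ b) v
  go v with v Fin.≟ x
  ... | yes refl = trans (Vec.lookup∘update (π ⟨$⟩ʳ v) F b) (sym (Vec.lookup∘update v (preimage π F) b))
  ... | no v≢x   = trans (Vec.lookup∘update′ (v≢x ∘ perm-injective π) F b)
                     (trans (sym (lookup-preimage π F v)) (sym (Vec.lookup∘update′ v≢x (preimage π F) b)))

minus-update : ∀ {n} (F : Subset n) x → F Subset.- x ≡ F [ x ]≔ outside
minus-update (b ∷ F) zero    = cong (outside ∷_) (Subset.p─⊥≡p F)
minus-update (b ∷ F) (suc x) = cong (b ∷_) (minus-update F x)

∉-deleted : ∀ {n} (F : Subset n) x → x ∉ F [ x ]≔ outside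
∉-deleted F x x∈ with trans (sym (∈-lookup x∈)) (Vec.lookup∘update x F outside)
... | ()

∈-deleted⁺ : ∀ {n} {F : Subset n} {v x} → v ∈ F → v ≢ x → v ∈ F [ x ]≔ outside
∈-deleted⁺ {F = F} v∈ v≢x = lookup-∈ (trans (Vec.lookup∘update′ v≢x F outside) (∈-lookup v∈))

∈-deleted⁻ : ∀ {n} {F : Subset n} {v x} → v ∈ F [ x ]≔ outside → v ∈ F × v ≢ x
∈-deleted⁻ {F = F} {v} {x} v∈ = lookup-∈ (trans (sym (Vec.lookup∘update′ v≢x F outside)) (∈-lookup v∈)) , v≢x
  where
  v≢x : v ≢ x
  v≢x refl = ∉-deleted F x v∈

unique-↭ : {A : Set} {xs ys : List A} → Unique xs → Unique ys →
  (∀ {x} → x List.∈ xs → x List.∈ ys) → (∀ {x} → x List.∈ ys → x List.∈ xs) → xs ↭ ys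
unique-↭ u u′ f g = ∼bag⇒↭ (unique∧set⇒bag u u′ (mk⇔ f g))

-- Signs of orderings with respect to a key

sign : {A : Set} → (A → ℕ) → A → A → ℤ
sign κ x y = if does (κ y ℕ.<? κ x) then -1ℤ else 1ℤ

-- For `κ` injective on the list, this is the sign of the permutation that sorts the list by `κ`.
-- One key serves all subsets at once.
ε : {A : Set} → (A → ℕ) → List A → ℤ
ε κ []       = 1ℤ
ε κ (x ∷ xs) = ∏ xs (sign κ x) * ε κ xs

module _ {A : Set} where

  sign-sq : ∀ (κ : A → ℕ) x y → sign κ x y * sign κ x y ≡ 1ℤ
  sign-sq κ x y with does (κ y ℕ.<? κ x)
  ... | true  = refl
  ... | false = refl

  sign-descent : ∀ (κ : A → ℕ) {x y} → κ y ℕ.< κ x → sign κ x y ≡ -1ℤ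
  sign-descent κ {x} {y} p = cong (λ b → if b then -1ℤ else 1ℤ) (dec-true (κ y ℕ.<? κ x) p)

  sign-ascent : ∀ (κ : A → ℕ) {x y} → ¬ κ y ℕ.< κ x → sign κ x y ≡ 1ℤ
  sign-ascent κ {x} {y} ¬p = cong (λ b → if b then -1ℤ else 1ℤ) (dec-false (κ y ℕ.<? κ x) ¬p)

  sign-self : ∀ (κ : A → ℕ) x → sign κ x x ≡ 1ℤ
  sign-self κ x = sign-ascent κ (ℕ.<-irrefl refl)

  sign-anti : ∀ (κ : A → ℕ) {x y} → κ x ≢ κ y → sign κ x y ≡ - sign κ y x
  sign-anti κ {x} {y} x≢y with ℕ.<-cmp (κ x) (κ y)
  ... | tri< p _ ¬q = trans (sign-ascent κ ¬q) (cong -_ (sym (sign-descent κ p)))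
  ... | tri≈ _ e _  = ⊥-elim (x≢y e)
  ... | tri> ¬p _ q = trans (sign-descent κ q) (cong -_ (sym (sign-ascent κ ¬p)))

  sign-cong : ∀ {κ κ′ : A → ℕ} {x y} → κ x ≡ κ′ x → κ y ≡ κ′ y → sign κ x y ≡ sign κ′ x y
  sign-cong p q rewrite p | q = refl

  ∏-sq : ∀ (κ : A → ℕ) x xs → ∏ xs (sign κ x) * ∏ xs (sign κ x) ≡ 1ℤ
  ∏-sq κ x xs = trans (sym (∏-* xs _ _)) (trans (∏-cong∈ xs (λ {y} _ → sign-sq κ x y)) (∏-one xs))

  ε-sq : ∀ (κ : A → ℕ) xs → ε κ xs * ε κ xs ≡ 1ℤ
  ε-sq κ []       = refl
  ε-sq κ (x ∷ xs) = trans (*-interchange (∏ xs (sign κ x)) (ε κ xs) (∏ xs (sign κ x)) (ε κ xs)) (cong₂ _*_ (∏-sq κ x xs) (ε-sq κ xs))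

  ε-cong∈ : ∀ {κ κ′ : A → ℕ} xs → (∀ {x} → x List.∈ xs → κ x ≡ κ′ x) → ε κ xs ≡ ε κ′ xs
  ε-cong∈ []       h = refl
  ε-cong∈ {κ} {κ′} (x ∷ xs) h = cong₂ _*_ (∏-cong∈ xs (λ y∈ → sign-cong {κ} {κ′} (h (here refl)) (h (there y∈)))) (ε-cong∈ xs (h ∘ there))

  ε-suc : ∀ (κ : A → ℕ) xs → ε (suc ∘ κ) xs ≡ ε κ xs
  ε-suc κ []       = refl
  ε-suc κ (x ∷ xs) = cong (∏ xs (sign κ x) *_) (ε-suc κ xs)

  -- Relative to a list, since `position` gives all absent vertices the same value, the length.
  InjectiveOn : List A → (A → ℕ) → Set
  InjectiveOn xs κ = ∀ {x y} → x List.∈ xs → y List.∈ xs → κ x ≡ κ y → x ≡ y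

  -- An adjacent transposition changes the sign with respect to every key.
  ε-↭ : ∀ {κ κ′ : A → ℕ} {xs ys} → xs ↭ ys → InjectiveOn xs κ → InjectiveOn xs κ′ → ε κ xs * ε κ′ xs ≡ ε κ ys * ε κ′ ys
  ε-↭ Perm.refl       i i′ = refl
  ε-↭ {κ} {κ′} (Perm.prep {xs} {ys} x p) i i′ = begin
    ∏ xs (sign κ x) * ε κ xs * (∏ xs (sign κ′ x) * ε κ′ xs) ≡⟨ *-interchange (∏ xs (sign κ x)) (ε κ xs) (∏ xs (sign κ′ x)) (ε κ′ xs) ⟩
    ∏ xs (sign κ x) * ∏ xs (sign κ′ x) * (ε κ xs * ε κ′ xs)
      ≡⟨ cong₂ _*_ (cong₂ _*_ (∏-↭ p (sign κ x)) (∏-↭ p (sign κ′ x))) (ε-↭ p (λ a b → i (there a) (there b)) (λ a b → i′ (there a) (there b))) ⟩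
    ∏ ys (sign κ x) * ∏ ys (sign κ′ x) * (ε κ ys * ε κ′ ys) ≡⟨ *-interchange (∏ ys (sign κ x)) (ε κ ys) (∏ ys (sign κ′ x)) (ε κ′ ys) ⟨
    ∏ ys (sign κ x) * ε κ ys * (∏ ys (sign κ′ x) * ε κ′ ys) ∎
  ε-↭ {κ} {κ′} (Perm.swap {xs} {ys} x y p) i i′ = begin
    sign κ x y * X * (Y * e) * (sign κ′ x y * X′ * (Y′ * e′))
      ≡⟨ alg (sign κ x y) X Y e (sign κ′ x y) X′ Y′ e′ ⟩
    sign κ x y * sign κ′ x y * (Y * (X * e) * (Y′ * (X′ * e′)))
      ≡⟨ cong (_* (Y * (X * e) * (Y′ * (X′ * e′)))) both ⟩
    sign κ y x * sign κ′ y x * (Y * (X * e) * (Y′ * (X′ * e′)))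
      ≡⟨ alg₂ (sign κ y x) X Y e (sign κ′ y x) X′ Y′ e′ ⟩
    sign κ y x * sign κ′ y x * (Y * X * Y′ * X′) * (e * e′)
      ≡⟨ cong₂ (λ u v → sign κ y x * sign κ′ y x * u * v)
           (cong₂ _*_ (cong₂ _*_ (cong₂ _*_ (∏-↭ p (sign κ y)) (∏-↭ p (sign κ x))) (∏-↭ p (sign κ′ y))) (∏-↭ p (sign κ′ x)))
           (ε-↭ p (λ a b → i (there (there a)) (there (there b))) (λ a b → i′ (there (there a)) (there (there b)))) ⟩
    sign κ y x * sign κ′ y x * (∏ ys (sign κ y) * ∏ ys (sign κ x) * ∏ ys (sign κ′ y) * ∏ ys (sign κ′ x)) * (ε κ ys * ε κ′ ys)
      ≡⟨ alg₃ (sign κ y x) (∏ ys (sign κ x)) (∏ ys (sign κ y)) (ε κ ys) (sign κ′ y x) (∏ ys (sign κ′ x)) (∏ ys (sign κ′ y)) (ε κ′ ys) ⟩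
    sign κ y x * ∏ ys (sign κ y) * (∏ ys (sign κ x) * ε κ ys) * (sign κ′ y x * ∏ ys (sign κ′ y) * (∏ ys (sign κ′ x) * ε κ′ ys)) ∎
    where
    X = ∏ xs (sign κ x)
    Y = ∏ xs (sign κ y)
    X′ = ∏ xs (sign κ′ x)
    Y′ = ∏ xs (sign κ′ y)
    e = ε κ xs
    e′ = ε κ′ xs
    both : sign κ x y * sign κ′ x y ≡ sign κ y x * sign κ′ y x
    both with κ x ℕ.≟ κ y | κ′ x ℕ.≟ κ′ y
    ... | yes q | _     with refl ← i (here refl) (there (here refl)) q = refl
    ... | no _  | yes q with refl ← i′ (here refl) (there (here refl)) q = refl
    ... | no q  | no q′ = trans (cong₂ _*_ (sign-anti κ q) (sign-anti κ′ q′)) (neg*neg (sign κ y x) (sign κ′ y x))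
    alg : ∀ s X Y e s′ X′ Y′ e′ → s * X * (Y * e) * (s′ * X′ * (Y′ * e′)) ≡ s * s′ * (Y * (X * e) * (Y′ * (X′ * e′)))
    alg = solve-∀
    alg₂ : ∀ s X Y e s′ X′ Y′ e′ → s * s′ * (Y * (X * e) * (Y′ * (X′ * e′))) ≡ s * s′ * (Y * X * Y′ * X′) * (e * e′)
    alg₂ = solve-∀
    alg₃ : ∀ s X Y e s′ X′ Y′ e′ → s * s′ * (Y * X * Y′ * X′) * (e * e′) ≡ s * Y * (X * e) * (s′ * Y′ * (X′ * e′))
    alg₃ = solve-∀
  ε-↭ (Perm.trans p q) i i′ = trans (ε-↭ p i i′)
    (ε-↭ q (λ a b → i (back a) (back b)) (λ a b → i′ (back a) (back b)))
    where
    back : ∀ {x} → x List.∈ _ → x List.∈ _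
    back = Perm.∈-resp-↭ (Perm.↭-sym p)

  removeAt-⊆ : ∀ xs i {v : A} → v List.∈ removeAt xs i → v List.∈ xs
  removeAt-⊆ (x ∷ xs) zero    v∈          = there v∈
  removeAt-⊆ (x ∷ xs) (suc i) (here refl) = here refl
  removeAt-⊆ (x ∷ xs) (suc i) (there v∈)  = there (removeAt-⊆ xs i v∈)

  removeAt-∈ : ∀ xs i {v : A} → v List.∈ xs → v ≢ lookup xs i → v List.∈ removeAt xs i
  removeAt-∈ (x ∷ xs) zero    (here refl) v≢ = ⊥-elim (v≢ refl)
  removeAt-∈ (x ∷ xs) zero    (there v∈)  v≢ = v∈
  removeAt-∈ (x ∷ xs) (suc i) (here refl) v≢ = here refl
  removeAt-∈ (x ∷ xs) (suc i) (there v∈)  v≢ = there (removeAt-∈ xs i v∈ v≢)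

  removeAt-≢ : ∀ {xs} → Unique xs → ∀ i {v : A} → v List.∈ removeAt xs i → v ≢ lookup xs i
  removeAt-≢ (x∉ ∷ u) zero    v∈          refl = All.lookup x∉ v∈ refl
  removeAt-≢ {x ∷ xs} (x∉ ∷ u) (suc i) (here refl) e = All.lookup x∉ (List.∈-lookup i) e
  removeAt-≢ (x∉ ∷ u) (suc i) (there v∈)  e    = removeAt-≢ u i v∈ e

  removeAt-unique : ∀ {xs : List A} → Unique xs → ∀ i → Unique (removeAt xs i)
  removeAt-unique (x∉ ∷ u) zero    = u
  removeAt-unique {x ∷ xs} (x∉ ∷ u) (suc i) = All.tabulate (λ v∈ → All.lookup x∉ (removeAt-⊆ xs i v∈)) ∷ removeAt-unique u i

  ∏-removeAt : ∀ xs i (f : A → ℤ) → ∏ xs f ≡ f (lookup xs i) * ∏ (removeAt xs i) f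
  ∏-removeAt (x ∷ xs) zero    f = refl
  ∏-removeAt (x ∷ xs) (suc i) f = trans (cong (f x *_) (∏-removeAt xs i f)) (*-rotate (f x) (f (lookup xs i)) _)

  -- Removing the entry `x` at `i` loses the signs of its pairs. Those with later entries occur as
  -- `sign κ x _`; those with the `toℕ i` earlier ones have their arguments reversed, and turning
  -- them around costs `(-1) ^ toℕ i`.
  ε-removeAt : ∀ (κ : A → ℕ) → (∀ {x y} → κ x ≡ κ y → x ≡ y) → ∀ {xs} → Unique xs → ∀ i →
    (-1ℤ ^ toℕ i) * ε κ (removeAt xs i) ≡ ε κ xs * ∏ xs (sign κ (lookup xs i))
  ε-removeAt κ inj {x ∷ xs} (x∉ ∷ u) zero = begin
    1ℤ * ε κ xs ≡⟨ cong (_* ε κ xs) (∏-sq κ x xs) ⟨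
    P * P * ε κ xs ≡⟨ alg P (ε κ xs) ⟩
    P * ε κ xs * (1ℤ * P) ≡⟨ cong (λ s → P * ε κ xs * (s * P)) (sign-self κ x) ⟨
    P * ε κ xs * (sign κ x x * P) ∎
    where
    P = ∏ xs (sign κ x)
    alg : ∀ p e → p * p * e ≡ p * e * (1ℤ * p)
    alg = solve-∀
  ε-removeAt κ inj {z ∷ xs} (z∉ ∷ u) (suc i) = begin
    -1ℤ * (-1ℤ ^ toℕ i) * (Q * ε κ (removeAt xs i))
      ≡⟨ alg (-1ℤ ^ toℕ i) Q (ε κ (removeAt xs i)) ⟩
    -1ℤ * (Q * ((-1ℤ ^ toℕ i) * ε κ (removeAt xs i)))
      ≡⟨ cong (λ e → -1ℤ * (Q * e)) (ε-removeAt κ inj u i) ⟩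
    -1ℤ * (Q * (ε κ xs * ∏ xs (sign κ x)))
      ≡⟨ cong (λ s → - s * (Q * (ε κ xs * ∏ xs (sign κ x)))) (sign-sq κ x z) ⟨
    - (sign κ x z * sign κ x z) * (Q * (ε κ xs * ∏ xs (sign κ x)))
      ≡⟨ alg₂ (sign κ x z) Q (ε κ xs) (∏ xs (sign κ x)) ⟩
    (- sign κ x z) * Q * ε κ xs * (sign κ x z * ∏ xs (sign κ x))
      ≡⟨ cong (λ s → s * Q * ε κ xs * (sign κ x z * ∏ xs (sign κ x))) (sign-anti κ z≢x) ⟨
    sign κ z x * Q * ε κ xs * (sign κ x z * ∏ xs (sign κ x))
      ≡⟨ cong (λ p → p * ε κ xs * (sign κ x z * ∏ xs (sign κ x))) (∏-removeAt xs i (sign κ z)) ⟨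
    ∏ xs (sign κ z) * ε κ xs * (sign κ x z * ∏ xs (sign κ x)) ∎
    where
    x = lookup xs i
    Q = ∏ (removeAt xs i) (sign κ z)
    z≢x : κ z ≢ κ x
    z≢x e = All.lookup z∉ (List.∈-lookup i) (inj e)
    alg : ∀ s q e → -1ℤ * s * (q * e) ≡ -1ℤ * (q * (s * e))
    alg = solve-∀
    alg₂ : ∀ s q e p → - (s * s) * (q * (e * p)) ≡ (- s) * q * e * (s * p)
    alg₂ = solve-∀

module _ {n : ℕ} where

  position-head : ∀ (x : Fin n) xs → position x (x ∷ xs) ≡ 0
  position-head x xs with x Fin.≟ x
  ... | yes _  = refl
  ... | no x≢x = ⊥-elim (x≢x refl)

  position-tail : ∀ {x v : Fin n} xs → v ≢ x → position v (x ∷ xs) ≡ suc (position v xs)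
  position-tail {x} {v} xs v≢x with v Fin.≟ x
  ... | yes e = ⊥-elim (v≢x e)
  ... | no _  = refl

  position-injective : ∀ (xs : List (Fin n)) → InjectiveOn xs (λ v → position v xs)
  position-injective (z ∷ xs) {x} {y} x∈ y∈ e with x Fin.≟ z | y Fin.≟ z
  ... | yes p | yes q = trans p (sym q)
  ... | no p  | no q  = position-injective xs (tail x∈ p) (tail y∈ q) (ℕ.suc-injective e)
    where
    tail : ∀ {v} → v List.∈ z ∷ xs → v ≢ z → v List.∈ xs
    tail (here v≡z) v≢z = ⊥-elim (v≢z v≡z)
    tail (there v∈) v≢z = v∈

  ε-position : ∀ {xs : List (Fin n)} → Unique xs → ε (λ v → position v xs) xs ≡ 1ℤ
  ε-position []                  = refl
  ε-position {x ∷ xs} (x∉ ∷ u) = cong₂ _*_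
    (trans (∏-cong∈ xs first-sign) (∏-one xs))
    (trans (ε-cong∈ {κ′ = λ v → suc (position v xs)} xs (λ {v} v∈ → position-tail xs (λ e → All.lookup x∉ v∈ (sym e)))) (trans (ε-suc (λ v → position v xs) xs) (ε-position u)))
    where
    first-sign : ∀ {y} → y List.∈ xs → sign (λ v → position v (x ∷ xs)) x y ≡ 1ℤ
    first-sign _ rewrite position-head x xs = refl

  inversion : List (Fin n) → (Fin n → ℕ) → Fin n → Fin n → ℤ
  inversion xs κ u v = if does (position u xs ℕ.<? position v xs) ∧ does (κ v ℕ.<? κ u) then -1ℤ else 1ℤ

  ∏-inversion : ∀ κ {xs : List (Fin n)} → Unique xs → ∏ xs (λ u → ∏ xs (inversion xs κ u)) ≡ ε κ xs
  ∏-inversion κ []                  = refl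
  ∏-inversion κ {x ∷ xs} (x∉ ∷ u) = cong₂ _*_
    (trans (cong₂ _*_ head-head (∏-cong∈ xs head-tail)) (ℤ.*-identityˡ _))
    (trans (∏-cong∈ xs (λ u∈ → trans (cong₂ _*_ (tail-head u∈) (∏-cong∈ xs (tail-tail u∈))) (ℤ.*-identityˡ _))) (∏-inversion κ u))
    where
    pos : ∀ {v} → v List.∈ xs → position v (x ∷ xs) ≡ suc (position v xs)
    pos v∈ = position-tail xs (λ e → All.lookup x∉ v∈ (sym e))
    head-head : inversion (x ∷ xs) κ x x ≡ 1ℤ
    head-head rewrite position-head x xs = refl
    head-tail : ∀ {v} → v List.∈ xs → inversion (x ∷ xs) κ x v ≡ sign κ x v
    head-tail v∈ rewrite position-head x xs | pos v∈ = refl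
    tail-head : ∀ {v} → v List.∈ xs → inversion (x ∷ xs) κ v x ≡ 1ℤ
    tail-head v∈ rewrite position-head x xs = refl
    tail-tail : ∀ {v w} → v List.∈ xs → w List.∈ xs → inversion (x ∷ xs) κ v w ≡ inversion xs κ v w
    tail-tail v∈ w∈ rewrite pos v∈ | pos w∈ = refl

^-length-filter : {A : Set} {P : A → Set} (P? : Decidable P) (xs : List A) (z : ℤ) →
  z ^ length (filter P? xs) ≡ ∏ xs (λ x → if does (P? x) then z else 1ℤ)
^-length-filter P? []       z = refl
^-length-filter P? (x ∷ xs) z with does (P? x)
... | true  = cong (z *_) (^-length-filter P? xs z)
... | false = trans (^-length-filter P? xs z) (sym (ℤ.*-identityˡ _))

∏-++ : {A : Set} (xs ys : List A) (f : A → ℤ) → ∏ (xs ++ ys) f ≡ ∏ xs f * ∏ ys f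
∏-++ []       ys f = sym (ℤ.*-identityˡ _)
∏-++ (x ∷ xs) ys f = trans (cong (f x *_) (∏-++ xs ys f)) (sym (ℤ.*-assoc (f x) _ _))

∏-cartesianProduct : {A B : Set} (xs : List A) (ys : List B) (f : A × B → ℤ) →
  ∏ (cartesianProduct xs ys) f ≡ ∏ xs (λ x → ∏ ys (λ y → f (x , y)))
∏-cartesianProduct []       ys f = refl
∏-cartesianProduct (x ∷ xs) ys f = trans (∏-++ (map (x ,_) ys) _ f)
  (cong₂ _*_ (∏-map (x ,_) ys f) (∏-cartesianProduct xs ys f))

-- Inversions from `xs` to `ys` are descents of `xs` for the key "position in `ys`". For that key
-- `ys` itself has sign 1, and the product of the signs for two keys is invariant under
-- rearrangement.
sgn-ε : ∀ {n} (κ : Fin n → ℕ) → (∀ {x y} → κ x ≡ κ y → x ≡ y) → ∀ {xs ys : List (Fin n)} → Unique xs → Unique ys →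
  xs ↭ ys → sgn xs ys ≡ ε κ xs * ε κ ys
sgn-ε κ inj {xs} {ys} u u′ p = begin
  sgn xs ys ≡⟨ ^-length-filter _ (cartesianProduct xs xs) -1ℤ ⟩
  ∏ (cartesianProduct xs xs) _ ≡⟨ ∏-cartesianProduct xs xs _ ⟩
  ∏ xs (λ u → ∏ xs (inversion xs κ′ u)) ≡⟨ ∏-inversion κ′ u ⟩
  ε κ′ xs ≡⟨ ℤ.*-identityˡ (ε κ′ xs) ⟨
  1ℤ * ε κ′ xs ≡⟨ cong (_* ε κ′ xs) (ε-sq κ xs) ⟨
  ε κ xs * ε κ xs * ε κ′ xs ≡⟨ ℤ.*-assoc (ε κ xs) _ _ ⟩
  ε κ xs * (ε κ xs * ε κ′ xs) ≡⟨ cong (ε κ xs *_) (ε-↭ p (λ _ _ → inj) κ′-injective) ⟩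
  ε κ xs * (ε κ ys * ε κ′ ys) ≡⟨ cong (λ z → ε κ xs * (ε κ ys * z)) (ε-position u′) ⟩
  ε κ xs * (ε κ ys * 1ℤ) ≡⟨ cong (ε κ xs *_) (ℤ.*-identityʳ (ε κ ys)) ⟩
  ε κ xs * ε κ ys ∎
  where
  κ′ : Fin _ → ℕ
  κ′ v = position v ys
  κ′-injective : InjectiveOn xs κ′
  κ′-injective a b = position-injective ys (Perm.∈-resp-↭ p a) (Perm.∈-resp-↭ p b)

-- Incidence numbers, up to signs of the chosen orderings

-- The parity of the number of members of `F` before `y`, as a sign.
below : ∀ {n} → Fin n → Subset n → ℤ
below zero    F             = 1ℤ
below (suc y) (inside  ∷ F) = - below y F
below (suc y) (outside ∷ F) = below y F

∂-deleted : ∀ {n} {F : Subset n} {y} → y ∈ F → ∂ (F [ y ]≔ outside) F ≡ below y F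
∂-deleted {F = inside ∷ F}  {zero}  here       = δ-same F
∂-deleted {F = inside ∷ F}  {suc y} (there y∈) = cong -_ (∂-deleted y∈)
∂-deleted {F = outside ∷ F} {suc y} (there y∈) = ∂-deleted y∈

filter-map : {A B : Set} {P : B → Set} (P? : Decidable P) (f : A → B) (xs : List A) →
  filter P? (map f xs) ≡ map f (filter (P? ∘ f) xs)
filter-map P? f []       = refl
filter-map P? f (x ∷ xs) with does (P? (f x))
... | true  = cong (f x ∷_) (filter-map P? f xs)
... | false = filter-map P? f xs

increasing-inside : ∀ {n} (F : Subset n) → increasing (inside ∷ F) ≡ zero ∷ map suc (increasing F)
increasing-outside : ∀ {n} (F : Subset n) → increasing (outside ∷ F) ≡ map suc (increasing F)
increasing-suc : ∀ {n} b (F : Subset n) → filter (Subset._∈? (b ∷ F)) (tabulate suc) ≡ map suc (increasing F)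
increasing-suc b F = begin
  filter (Subset._∈? (b ∷ F)) (tabulate suc) ≡⟨ cong (filter (Subset._∈? (b ∷ F))) (List.map-tabulate id suc) ⟨
  filter (Subset._∈? (b ∷ F)) (map suc (allFin _)) ≡⟨ filter-map (Subset._∈? (b ∷ F)) suc (allFin _) ⟩
  map suc (filter (λ v → suc v Subset.∈? (b ∷ F)) (allFin _))
    ≡⟨ cong (map suc) (List.filter-≐ (λ v → suc v Subset.∈? (b ∷ F)) (Subset._∈? F) ((λ { (there v∈) → v∈ }) , there) (allFin _)) ⟩
  map suc (increasing F) ∎
increasing-inside F  = cong (zero ∷_) (increasing-suc inside F)
increasing-outside F = increasing-suc outside F

below-∏ : ∀ {n} y (F : Subset n) → ∏ (increasing F) (sign toℕ y) ≡ below y F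
below-∏ zero    F = trans (∏-cong∈ (increasing F) (λ _ → refl)) (∏-one (increasing F))
below-∏ (suc y) (inside ∷ F)  =
  trans (cong (λ xs → ∏ xs (sign toℕ (suc y))) (increasing-inside F)) (trans (cong (-1ℤ *_) (trans (∏-map suc (increasing F) (sign toℕ (suc y))) (below-∏ y F))) (ℤ.-1*i≡-i (below y F)))
below-∏ (suc y) (outside ∷ F) =
  trans (cong (λ xs → ∏ xs (sign toℕ (suc y))) (increasing-outside F)) (trans (∏-map suc (increasing F) (sign toℕ (suc y))) (below-∏ y F))

increasing-unique : ∀ {n} (F : Subset n) → Unique (increasing F)
increasing-unique F = Unique.filter⁺ (Subset._∈? F) (Unique.allFin⁺ _)

module _ {n : ℕ} (o : Orientation n) (π : Permutation′ n) where

  private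
    κ : Fin n → ℕ
    κ v = toℕ (π ⟨$⟩ʳ v)

    κ-injective : ∀ {x y} → κ x ≡ κ y → x ≡ y
    κ-injective = perm-injective π ∘ Fin.toℕ-injective

  -- Compares the chosen ordering with the increasing order of the new labels. These signs form the
  -- diagonal matrix that relates the given Laplacian to the standard one.
  orderingSign : Subset n → ℤ
  orderingSign F = ε κ (vertices (o (preimage π F)))

  orderingSign-sq : ∀ F → orderingSign F * orderingSign F ≡ 1ℤ
  orderingSign-sq F = ε-sq κ (vertices (o (preimage π F)))

  -- `sgn-ε` splits the sign of the rearrangement into signs of the two orderings involved, and
  -- `ε-removeAt` trades the position of the removed vertex for the number of members with smaller
  -- label, which gives the sign in `∂`. If no removal yields `σ`, then `∂-support` forces the entry
  -- of `∂` to be 0.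
  incidence-∂ : ∀ σ F → incidence o (preimage π σ) (preimage π F) ≡ orderingSign σ * orderingSign F * ∂ σ F
  incidence-∂ σ F with Fin.any? (λ i → preimage π σ ≟ˢ (preimage π F Subset.- lookup (vertices (o (preimage π F))) i))
  ... | yes (i , e) = begin
    (-1ℤ ^ toℕ i) * sgn (removeAt xs i) ys
      ≡⟨ cong ((-1ℤ ^ toℕ i) *_) (sgn-ε κ κ-injective (removeAt-unique (unique (o (preimage π F))) i) (unique (o (preimage π σ))) rest↭) ⟩
    (-1ℤ ^ toℕ i) * (ε κ (removeAt xs i) * orderingSign σ)
      ≡⟨ ℤ.*-assoc (-1ℤ ^ toℕ i) _ _ ⟨
    (-1ℤ ^ toℕ i) * ε κ (removeAt xs i) * orderingSign σ
      ≡⟨ cong (_* orderingSign σ) (ε-removeAt κ κ-injective (unique (o (preimage π F))) i) ⟩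
    orderingSign F * ∏ xs (sign κ x) * orderingSign σ
      ≡⟨ cong (λ p → orderingSign F * p * orderingSign σ) count ⟩
    orderingSign F * ∂ σ F * orderingSign σ
      ≡⟨ alg (orderingSign F) (∂ σ F) (orderingSign σ) ⟩
    orderingSign σ * orderingSign F * ∂ σ F ∎
    where
    xs = vertices (o (preimage π F))
    ys = vertices (o (preimage π σ))
    x = lookup xs i
    alg : ∀ a b c → a * b * c ≡ c * a * b
    alg = solve-∀
    to-F : ∀ {v} → v List.∈ xs → v ∈ preimage π F
    to-F {v} = Equivalence.to (complete (o (preimage π F)) v)
    from-F : ∀ {v} → v ∈ preimage π F → v List.∈ xs
    from-F {v} = Equivalence.from (complete (o (preimage π F)) v)
    e′ : preimage π σ ≡ preimage π F [ x ]≔ outside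
    e′ = trans e (minus-update (preimage π F) x)
    x∈F : π ⟨$⟩ʳ x ∈ F
    x∈F = ∈-preimage⁻ π (to-F (List.∈-lookup i))
    σ≡ : σ ≡ F [ π ⟨$⟩ʳ x ]≔ outside
    σ≡ = preimage-injective π (trans e′ (sym (preimage-update π F x outside)))
    rest↭ : removeAt xs i ↭ ys
    rest↭ = unique-↭ (removeAt-unique (unique (o (preimage π F))) i) (unique (o (preimage π σ)))
      (λ {v} v∈ → Equivalence.from (complete (o (preimage π σ)) v)
        (subst (v ∈_) (sym e′) (∈-deleted⁺ (to-F (removeAt-⊆ xs i v∈)) (removeAt-≢ (unique (o (preimage π F))) i v∈))))
      (λ {v} v∈ → let v∈F , v≢x = ∈-deleted⁻ (subst (v ∈_) e′ (Equivalence.to (complete (o (preimage π σ)) v) v∈))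
                  in removeAt-∈ xs i (from-F v∈F) v≢x)
    image↭ : map (π ⟨$⟩ʳ_) xs ↭ increasing F
    image↭ = unique-↭ (Unique.map⁺ (perm-injective π) (unique (o (preimage π F)))) (increasing-unique F)
      (λ w∈ → let v , v∈ , w≡ = List.∈-map⁻ (π ⟨$⟩ʳ_) w∈
              in List.∈-filter⁺ (Subset._∈? F) (List.∈-allFin _) (subst (_∈ F) (sym w≡) (∈-preimage⁻ π (to-F v∈))))
      (λ {w} w∈ → subst (List._∈ map (π ⟨$⟩ʳ_) xs) (inverseʳ π)
        (List.∈-map⁺ (π ⟨$⟩ʳ_) (from-F (∈-preimage⁺ π (subst (_∈ F) (sym (inverseʳ π)) (proj₂ (List.∈-filter⁻ (Subset._∈? F) {xs = allFin n} w∈)))))))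
    count : ∏ xs (sign κ x) ≡ ∂ σ F
    count = begin
      ∏ xs (sign κ x) ≡⟨ ∏-map (π ⟨$⟩ʳ_) xs (sign toℕ (π ⟨$⟩ʳ x)) ⟨
      ∏ (map (π ⟨$⟩ʳ_) xs) (sign toℕ (π ⟨$⟩ʳ x)) ≡⟨ ∏-↭ image↭ _ ⟩
      ∏ (increasing F) (sign toℕ (π ⟨$⟩ʳ x)) ≡⟨ below-∏ (π ⟨$⟩ʳ x) F ⟩
      below (π ⟨$⟩ʳ x) F ≡⟨ ∂-deleted x∈F ⟨
      ∂ (F [ π ⟨$⟩ʳ x ]≔ outside) F ≡⟨ cong (λ τ → ∂ τ F) σ≡ ⟨
      ∂ σ F ∎
  ... | no none with ∂-support σ F
  ...   | inj₁ z = sym (trans (cong (orderingSign σ * orderingSign F *_) z) (ℤ.*-zeroʳ (orderingSign σ * orderingSign F)))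
  ...   | inj₂ (j , j∈ , σ≡) = ⊥-elim (none (Any.index x∈ , trans σ′≡ (cong (preimage π F Subset.-_) (lookup-index x∈))))
    where
    x = π ⟨$⟩ˡ j
    xs = vertices (o (preimage π F))
    x∈ : x List.∈ xs
    x∈ = Equivalence.from (complete (o (preimage π F)) x) (∈-preimage⁺ π (subst (_∈ F) (sym (inverseʳ π)) j∈))
    σ′≡ : preimage π σ ≡ preimage π F Subset.- x
    σ′≡ = begin
      preimage π σ ≡⟨ cong (preimage π) σ≡ ⟩
      preimage π (F [ j ]≔ outside) ≡⟨ cong (λ y → preimage π (F [ y ]≔ outside)) (inverseʳ π) ⟨
      preimage π (F [ π ⟨$⟩ʳ x ]≔ outside) ≡⟨ preimage-update π F x outside ⟩
      preimage π F [ x ]≔ outside ≡⟨ minus-update (preimage π F) x ⟨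
      preimage π F Subset.- x ∎

-- The characteristic polynomial of the up-Laplacian

filter-partition : {A : Set} {P : A → Set} (P? : Decidable P) (xs : List A) → xs ↭ filter P? xs ++ filter (¬? ∘ P?) xs
filter-partition P? []       = Perm.refl
filter-partition P? (x ∷ xs) with does (P? x)
... | true  = Perm.prep x (filter-partition P? xs)
... | false = Perm.trans (Perm.prep x (filter-partition P? xs)) (Perm.↭-sym (Perm.shift x (filter P? xs) _))

lap-scaleᶜ : {J : Set} (c r : J → ℤ) (D : List J → ℤ) (cs : List J) →
  lap (λ j → r j * c j) (λ ds → D ds * ∏ ds c) cs ≡ lap r D cs * ∏ cs c
lap-scaleᶜ c r D []       = refl
lap-scaleᶜ c r D (d ∷ cs) = begin
  r d * c d * (D cs * ∏ cs c) - lap (λ j → r j * c j) (λ ds → D (d ∷ ds) * (c d * ∏ ds c)) cs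
    ≡⟨ cong (λ z → r d * c d * (D cs * ∏ cs c) - z) (trans
         (lap-congʳ (λ j → r j * c j) cs (λ ds → alg (D (d ∷ ds)) (c d) (∏ ds c)))
         (trans (lap-scaleᶜ c r (λ ds → c d * D (d ∷ ds)) cs) (cong (_* ∏ cs c) (lap-*ʳ (c d) r _ cs)))) ⟩
  r d * c d * (D cs * ∏ cs c) - c d * lap r (λ ds → D (d ∷ ds)) cs * ∏ cs c
    ≡⟨ alg₂ (r d) (c d) (D cs) (∏ cs c) (lap r (λ ds → D (d ∷ ds)) cs) ⟩
  (r d * D cs - lap r (λ ds → D (d ∷ ds)) cs) * (c d * ∏ cs c) ∎
  where
  alg : ∀ a b p → a * (b * p) ≡ b * a * p
  alg = solve-∀
  alg₂ : ∀ r c D p l → r * c * (D * p) - c * l * p ≡ (r * D - l) * (c * p)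
  alg₂ = solve-∀

minor-scaleᶜ : {I J : Set} (c : J → ℤ) (A : I → J → ℤ) (is : List I) (cs : List J) →
  minor (map (λ i j → A i j * c j) is) cs ≡ minor (map A is) cs * ∏ cs c
minor-scaleᶜ c A []       []       = refl
minor-scaleᶜ c A []       (d ∷ cs) = sym (ℤ.*-zeroˡ (c d * ∏ cs c))
minor-scaleᶜ c A (i ∷ is) cs       =
  trans (lap-congʳ (λ j → A i j * c j) cs (minor-scaleᶜ c A is)) (lap-scaleᶜ c (A i) (minor (map A is)) cs)

detL-conjugate : {J : Set} (c : J → ℤ) → (∀ j → c j * c j ≡ 1ℤ) → (A : J → J → ℤ) (xs : List J) →
  detL xs (λ i j → c i * (A i j * c j)) ≡ detL xs A
detL-conjugate c c² A xs = begin
  detL xs (λ i j → c i * (A i j * c j)) ≡⟨ detL-scale c _ xs ⟩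
  ∏ xs c * detL xs (λ i j → A i j * c j) ≡⟨ cong (∏ xs c *_) (minor-scaleᶜ c A xs xs) ⟩
  ∏ xs c * (detL xs A * ∏ xs c) ≡⟨ alg (∏ xs c) (detL xs A) ⟩
  ∏ xs c * ∏ xs c * detL xs A ≡⟨ cong (_* detL xs A) (∏-* xs c c) ⟨
  ∏ xs (λ x → c x * c x) * detL xs A ≡⟨ cong (_* detL xs A) (trans (∏-cong∈ xs (λ {x} _ → c² x)) (∏-one xs)) ⟩
  1ℤ * detL xs A ≡⟨ ℤ.*-identityˡ _ ⟩
  detL xs A ∎
  where
  alg : ∀ p d → p * (d * p) ≡ p * p * d
  alg = solve-∀

unique-lookup : {A : Set} {xs : List A} → Unique xs → ∀ {i j} → lookup xs i ≡ lookup xs j → i ≡ j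
unique-lookup (x∉ ∷ u) {zero}  {zero}  e = refl
unique-lookup (x∉ ∷ u) {zero}  {suc j} e = ⊥-elim (All.lookup x∉ (List.∈-lookup j) e)
unique-lookup (x∉ ∷ u) {suc i} {zero}  e = ⊥-elim (All.lookup x∉ (List.∈-lookup i) (sym e))
unique-lookup (x∉ ∷ u) {suc i} {suc j} e = cong suc (unique-lookup u e)

sum-lookup : {A : Set} (xs : List A) (f : A → ℤ) → sum (λ i → f (lookup xs i)) ≡ ∑ xs f
sum-lookup xs f = trans (sym (∑-tabulate (lookup xs) f)) (cong (λ ys → ∑ ys f) (List.tabulate-lookup xs))

-- Faces of a fixed size under relabelling

FaceOfSize : ∀ {n} → SimplicialComplex n → ℕ → Subset n → Set
FaceOfSize K m F = ∣ F ∣ ≡ m × Face K F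

faceOfSize? : ∀ {n} (K : SimplicialComplex n) m → Decidable (FaceOfSize K m)
faceOfSize? K m F = (∣ F ∣ ℕ.≟ m) ×-dec face? K F

∈-faces⁺ : ∀ {n} (K : SimplicialComplex n) m {F} → FaceOfSize K m F → F List.∈ facesOfSize K m
∈-faces⁺ K m {F} = List.∈-filter⁺ (faceOfSize? K m) (∈-subsets F)

∈-faces⁻ : ∀ {n} (K : SimplicialComplex n) m {F} → F List.∈ facesOfSize K m → FaceOfSize K m F
∈-faces⁻ {n} K m F∈ = proj₂ (List.∈-filter⁻ (faceOfSize? K m) {xs = subsets n} F∈)

faces-unique : ∀ {n} (K : SimplicialComplex n) m → Unique (facesOfSize K m)
faces-unique {n} K m = Unique.filter⁺ (faceOfSize? K m) (subsets-unique n)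

∣∣-∑ : ∀ {n} (F : Subset n) → + ∣ F ∣ ≡ sum (λ v → if Vec.lookup F v then 1ℤ else 0ℤ)
∣∣-∑ []            = refl
∣∣-∑ (inside  ∷ F) = cong (λ z → 1ℤ + z) (∣∣-∑ F)
∣∣-∑ (outside ∷ F) = trans (∣∣-∑ F) (sym (ℤ.+-identityˡ _))

∣preimage∣ : ∀ {n} (π : Permutation′ n) (F : Subset n) → ∣ preimage π F ∣ ≡ ∣ F ∣
∣preimage∣ π F = ℤ.+-injective (begin
  + ∣ preimage π F ∣ ≡⟨ ∣∣-∑ (preimage π F) ⟩
  sum (λ v → if Vec.lookup (preimage π F) v then 1ℤ else 0ℤ)
    ≡⟨ sum-cong-≗ (λ v → cong (λ b → if b then 1ℤ else 0ℤ) (lookup-preimage π F v)) ⟩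
  sum (λ v → if Vec.lookup F (π ⟨$⟩ʳ v) then 1ℤ else 0ℤ) ≡⟨ sum-permute (λ v → if Vec.lookup F v then 1ℤ else 0ℤ) π ⟨
  sum (λ v → if Vec.lookup F v then 1ℤ else 0ℤ) ≡⟨ ∣∣-∑ F ⟨
  + ∣ F ∣ ∎)

∣deleted∣ : ∀ {n} {F : Subset n} {j} → j ∈ F → suc ∣ F [ j ]≔ outside ∣ ≡ ∣ F ∣
∣deleted∣ {F = inside ∷ F}  here       = refl
∣deleted∣ {F = inside ∷ F}  (there j∈) = cong suc (∣deleted∣ j∈)
∣deleted∣ {F = outside ∷ F} (there j∈) = ∣deleted∣ j∈

preimage-surjective : ∀ {n} (π : Permutation′ n) (F : Subset n) → ∃[ G ] F ≡ preimage π G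
preimage-surjective {n} π F = G , subset-ext λ v → sym (begin
  Vec.lookup (preimage π G) v ≡⟨ lookup-preimage π G v ⟩
  Vec.lookup G (π ⟨$⟩ʳ v) ≡⟨ Vec.lookup∘tabulate _ (π ⟨$⟩ʳ v) ⟩
  Vec.lookup F (π ⟨$⟩ˡ (π ⟨$⟩ʳ v)) ≡⟨ cong (Vec.lookup F) (inverseˡ π) ⟩
  Vec.lookup F v ∎)
  where
  G : Subset n
  G = Vec.tabulate (λ w → Vec.lookup F (π ⟨$⟩ˡ w))

subsets-preimage : ∀ {n} (π : Permutation′ n) → subsets n ↭ map (preimage π) (subsets n)
subsets-preimage {n} π = unique-↭ (subsets-unique n) (Unique.map⁺ (preimage-injective π) (subsets-unique n))
  (λ {F} _ → let G , e = preimage-surjective π F in subst (List._∈ _) (sym e) (List.∈-map⁺ (preimage π) (∈-subsets G)))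
  (λ {F} _ → ∈-subsets F)

faces-relabel : ∀ {n} (π : Permutation′ n) (K : SimplicialComplex n) m →
  facesOfSize K m ↭ map (preimage π) (facesOfSize (relabel π K) m)
faces-relabel π K m = unique-↭ (faces-unique K m) (Unique.map⁺ (preimage-injective π) (faces-unique (relabel π K) m))
  (λ {F} F∈ → let G , e = preimage-surjective π F
                  s , f = ∈-faces⁻ K m F∈
              in subst (List._∈ _) (sym e) (List.∈-map⁺ (preimage π)
                   (∈-faces⁺ (relabel π K) m {G} (trans (sym (∣preimage∣ π G)) (trans (cong ∣_∣ (sym e)) s) , subst (Face K) e f))))
  (λ {F} F∈ → let G , G∈ , e = List.∈-map⁻ (preimage π) F∈
                  s , f = ∈-faces⁻ (relabel π K) m G∈
              in ∈-faces⁺ K m (trans (cong ∣_∣ e) (trans (∣preimage∣ π G) s) , subst (Face K) (sym e) f))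

∑-faces : ∀ {n} (K : SimplicialComplex n) m (f : Subset n → ℤ) → ∑ (facesOfSize K m) f ≡ ∑ˢ (λ F → ⟦ faceOfSize? K m F ⟧ * f F)
∑-faces {n} K m f = ∑-filter (faceOfSize? K m) (subsets n) f

upLapᵒ : ∀ {n} (K : SimplicialComplex n) → Orientation n → ℕ → Subset n → Subset n → ℤ
upLapᵒ K o k σ τ = ∑ (facesOfSize K (suc k)) (λ F → incidence o σ F * incidence o τ F)

charPoly-detL : ∀ {n} (K : SimplicialComplex n) (o : Orientation n) k x →
  charPoly (upLaplacian K o k) x ≡ detL (facesOfSize K k) (λ σ τ → x * δ σ τ - upLapᵒ K o k σ τ)
charPoly-detL K o k x = trans (det-cong (λ i j → cong₂ _-_ (scalar-δ i j) (sum-lookup (facesOfSize K (suc k)) _)))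
                              (det-lookup R (λ σ τ → x * δ σ τ - upLapᵒ K o k σ τ))
  where
  R = facesOfSize K k
  scalar-δ : ∀ i j → scalar x i j ≡ x * δ (lookup R i) (lookup R j)
  scalar-δ i j with i Fin.≟ j
  ... | yes refl = sym (trans (cong (x *_) (δ-same (lookup R i))) (ℤ.*-identityʳ x))
  ... | no i≢j   = sym (trans (cong (x *_) (δ-diff (i≢j ∘ unique-lookup (faces-unique K k)))) (ℤ.*-zeroʳ x))

-- Relabelling permutes rows and columns alike, and passing from the chosen orderings to the
-- increasing ones conjugates by the diagonal matrix `orderingSign`. Neither changes the
-- determinant.
charPoly-relabel : ∀ {n} (π : Permutation′ n) (K : SimplicialComplex n) (o : Orientation n) k x →
  charPoly (upLaplacian K o k) x ≡
  detL (facesOfSize (relabel π K) k) (λ σ τ → x * δ σ τ - upLap (faceOfSize? (relabel π K) (suc k)) σ τ)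
charPoly-relabel {n} π K o k x = begin
  charPoly (upLaplacian K o k) x
    ≡⟨ charPoly-detL K o k x ⟩
  detL (facesOfSize K k) A
    ≡⟨ detL-↭ (faces-relabel π K k) A ⟩
  detL (map (preimage π) R) A
    ≡⟨ detL-map (preimage π) A R ⟩
  detL R (λ σ τ → A (preimage π σ) (preimage π τ))
    ≡⟨ detL-cong∈ R (λ {σ} {τ} _ _ → coefficient σ τ) ⟩
  detL R (λ σ τ → e σ * ((x * δ σ τ - upLap S? σ τ) * e τ))
    ≡⟨ detL-conjugate e (orderingSign-sq o π) _ R ⟩
  detL R (λ σ τ → x * δ σ τ - upLap S? σ τ) ∎
  where
  K′ = relabel π K
  R = facesOfSize K′ k
  S? = faceOfSize? K′ (suc k)
  e = orderingSign o π
  A : Subset n → Subset n → ℤ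
  A σ τ = x * δ σ τ - upLapᵒ K o k σ τ
  δ-preimage : ∀ σ τ → δ (preimage π σ) (preimage π τ) ≡ e σ * (δ σ τ * e τ)
  δ-preimage σ τ with σ ≟ˢ τ
  ... | yes refl = trans (δ-same (preimage π σ)) (sym (trans (cong (e σ *_) (ℤ.*-identityˡ (e σ))) (orderingSign-sq o π σ)))
  ... | no σ≢τ   = trans (δ-diff (σ≢τ ∘ preimage-injective π)) (sym (trans (cong (e σ *_) (ℤ.*-zeroˡ (e τ))) (ℤ.*-zeroʳ (e σ))))
  term : ∀ σ τ F → incidence o (preimage π σ) (preimage π F) * incidence o (preimage π τ) (preimage π F) ≡
    e σ * e τ * (∂ σ F * ∂ τ F)
  term σ τ F = trans (cong₂ _*_ (incidence-∂ o π σ F) (incidence-∂ o π τ F))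
    (trans (alg (e σ) (e τ) (e F) (∂ σ F) (∂ τ F)) (trans (cong (_* (e σ * e τ * (∂ σ F * ∂ τ F))) (orderingSign-sq o π F)) (ℤ.*-identityˡ _)))
    where
    alg : ∀ a b f s t → a * f * s * (b * f * t) ≡ f * f * (a * b * (s * t))
    alg = solve-∀
  laplacian : ∀ σ τ → upLapᵒ K o k (preimage π σ) (preimage π τ) ≡ e σ * e τ * upLap S? σ τ
  laplacian σ τ = begin
    upLapᵒ K o k (preimage π σ) (preimage π τ)
      ≡⟨ trans (∑-↭ (faces-relabel π K (suc k)) _) (∑-map (preimage π) (facesOfSize K′ (suc k)) _) ⟩
    ∑ (facesOfSize K′ (suc k)) (λ F → incidence o (preimage π σ) (preimage π F) * incidence o (preimage π τ) (preimage π F))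
      ≡⟨ trans (∑-cong (facesOfSize K′ (suc k)) (term σ τ)) (∑-*ˡ (facesOfSize K′ (suc k)) (e σ * e τ) _) ⟩
    e σ * e τ * ∑ (facesOfSize K′ (suc k)) (λ F → ∂ σ F * ∂ τ F)
      ≡⟨ cong (e σ * e τ *_) (trans (∑-faces K′ (suc k) _) (∑ˢ-cong (λ F → alg ⟦ S? F ⟧ (∂ σ F) (∂ τ F)))) ⟩
    e σ * e τ * upLap S? σ τ ∎
    where
    alg : ∀ a b c → a * (b * c) ≡ b * a * c
    alg = solve-∀
  coefficient : ∀ σ τ → A (preimage π σ) (preimage π τ) ≡ e σ * ((x * δ σ τ - upLap S? σ τ) * e τ)
  coefficient σ τ = trans (cong₂ (λ u v → x * u - v) (δ-preimage σ τ) (laplacian σ τ)) (alg x (e σ) (e τ) (δ σ τ) (upLap S? σ τ))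
    where
    alg : ∀ x a b d l → x * (a * (d * b)) - a * b * l ≡ a * ((x * d - l) * b)
    alg = solve-∀

-- Every codimension one subset of a face is a face, so a set that is not a face of size `k` has a
-- zero column in the Laplacian and contributes a factor `x`.
χ-faces : ∀ {n} (K : SimplicialComplex n) k x →
  χ (faceOfSize? K (suc k)) x ≡
  detL (facesOfSize K k) (λ σ τ → x * δ σ τ - upLap (faceOfSize? K (suc k)) σ τ) *
          x ^ length (filter (¬? ∘ faceOfSize? K k) (subsets n))
χ-faces {n} K k x = begin
  detL (subsets n) M ≡⟨ detL-↭ (filter-partition Q? (subsets n)) M ⟩
  detL (R ++ T) M ≡⟨ detL-++ M R T zeros ⟩
  detL R M * detL T M ≡⟨ cong (detL R M *_) scalar-block ⟩
  detL R M * x ^ length T ∎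
  where
  Q? = faceOfSize? K k
  S? = faceOfSize? K (suc k)
  R = facesOfSize K k
  T = filter (¬? ∘ Q?) (subsets n)
  M : Subset n → Subset n → ℤ
  M σ τ = x * δ σ τ - upLap S? σ τ
  outside-T : ∀ {τ} → τ List.∈ T → ¬ FaceOfSize K k τ
  outside-T τ∈ = proj₂ (List.∈-filter⁻ (¬? ∘ Q?) {xs = subsets n} τ∈)
  upLap-zero : ∀ σ {τ} → ¬ FaceOfSize K k τ → upLap S? σ τ ≡ 0ℤ
  upLap-zero σ {τ} ¬f = ∑ˢ-zero term
    where
    term : ∀ F → ∂ σ F * ⟦ S? F ⟧ * ∂ τ F ≡ 0ℤ
    term F with ∂-support τ F
    ... | inj₁ z = trans (cong (∂ σ F * ⟦ S? F ⟧ *_) z) (ℤ.*-zeroʳ (∂ σ F * ⟦ S? F ⟧))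
    ... | inj₂ (j , j∈ , τ≡) = trans (cong (λ s → ∂ σ F * s * ∂ τ F) (⟦⟧-no (S? F) not-face))
            (trans (cong (_* ∂ τ F) (ℤ.*-zeroʳ (∂ σ F))) (ℤ.*-zeroˡ (∂ τ F)))
      where
      not-face : ¬ FaceOfSize K (suc k) F
      not-face (s , f) = ¬f (ℕ.suc-injective (trans (cong (suc ∘ ∣_∣) τ≡) (trans (∣deleted∣ j∈) s)) ,
        closed K (λ v∈ → proj₁ (∈-deleted⁻ (subst (_ ∈_) τ≡ v∈))) f)
  M-zero : ∀ {σ τ} → τ List.∈ T → σ ≢ τ → M σ τ ≡ 0ℤ
  M-zero {σ} {τ} τ∈ σ≢τ = trans (cong₂ (λ u v → x * u - v) (δ-diff σ≢τ) (upLap-zero σ (outside-T τ∈))) (alg x)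
    where
    alg : ∀ x → x * 0ℤ - 0ℤ ≡ 0ℤ
    alg = solve-∀
  zeros : ∀ {σ τ} → σ List.∈ R → τ List.∈ T → M σ τ ≡ 0ℤ
  zeros {σ} σ∈ τ∈ = M-zero {σ} τ∈ (λ { refl → outside-T τ∈ (∈-faces⁻ K k σ∈) })
  scalar-block : detL T M ≡ x ^ length T
  scalar-block = trans (detL-diagonal M (Unique.filter⁺ (¬? ∘ Q?) (subsets-unique n)) (λ {σ} _ τ∈ → M-zero {σ} τ∈))
    (trans (∏-cong∈ T (λ {τ} τ∈ → trans (cong₂ (λ u v → x * u - v) (δ-same τ) (upLap-zero τ (outside-T τ∈))) (alg x))) (∏-const T x))
    where
    alg : ∀ x → x * 1ℤ - 0ℤ ≡ x
    alg = solve-∀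

-- Shifted complexes are swap-closed

infix 4 _≤*_

_≤*_ : ∀ {n} → List (Fin n) → List (Fin n) → Set
_≤*_ = Pointwise Fin._≤_

≤*-suc : ∀ {n} {xs ys : List (Fin n)} → xs ≤* ys → map suc xs ≤* map suc ys
≤*-suc = Pointwise.map⁺ suc suc ∘ Pointwise.map ℕ.s≤s

≤*-refl : ∀ {n} {xs : List (Fin n)} → xs ≤* xs
≤*-refl = Pointwise.refl ℕ.≤-refl

-- Dropping `j` and putting the first vertex in front moves the entries before `j` one place back,
-- so each place up to that of `j` receives an earlier vertex.
raise-head : ∀ {n} {F : Subset n} {j} → j ∈ F → zero ∷ map suc (increasing (F [ j ]≔ outside)) ≤* map suc (increasing F)
raise-head {F = inside ∷ F} here =
  subst₂ (λ xs ys → zero ∷ map suc xs ≤* map suc ys) (sym (increasing-outside F)) (sym (increasing-inside F))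
    (ℕ.z≤n ∷ ≤*-refl)
raise-head {F = inside ∷ F} {suc j} (there j∈) =
  subst₂ (λ xs ys → zero ∷ map suc xs ≤* map suc ys) (sym (increasing-inside (F [ j ]≔ outside))) (sym (increasing-inside F))
    (ℕ.z≤n ∷ ≤*-suc (raise-head j∈))
raise-head {F = outside ∷ F} {suc j} (there j∈) =
  subst₂ (λ xs ys → zero ∷ map suc xs ≤* map suc ys) (sym (increasing-outside (F [ j ]≔ outside))) (sym (increasing-outside F))
    (lower (≤*-suc (raise-head j∈)))
  where
  lower : ∀ {n} {x : Fin (suc n)} {xs ys} → x ∷ xs ≤* ys → zero ∷ xs ≤* ys
  lower (_ ∷ p) = ℕ.z≤n ∷ p

move-≤ᴾ : ∀ {n} {F : Subset n} i j → i Fin.< j → i ∉ F → j ∈ F → move i j F ≤ᴾ F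
move-≤ᴾ {F = inside  ∷ F} zero    (suc j) i<j i∉ j∈ = ⊥-elim (i∉ here)
move-≤ᴾ {F = outside ∷ F} zero    (suc j) i<j i∉ (there j∈) =
  subst₂ _≤*_ (sym (increasing-inside (F [ j ]≔ outside))) (sym (increasing-outside F)) (raise-head j∈)
move-≤ᴾ {F = inside  ∷ F} (suc i) (suc j) (ℕ.s≤s i<j) i∉ (there j∈) =
  subst₂ _≤*_ (sym (increasing-inside (move i j F))) (sym (increasing-inside F))
    (ℕ.z≤n ∷ ≤*-suc (move-≤ᴾ i j i<j (i∉ ∘ there) j∈))
move-≤ᴾ {F = outside ∷ F} (suc i) (suc j) (ℕ.s≤s i<j) i∉ (there j∈) =
  subst₂ _≤*_ (sym (increasing-outside (move i j F))) (sym (increasing-outside F))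
    (≤*-suc (move-≤ᴾ i j i<j (i∉ ∘ there) j∈))

∣added∣ : ∀ {n} {F : Subset n} {i} → i ∉ F → ∣ F [ i ]≔ inside ∣ ≡ suc ∣ F ∣
∣added∣ {F = inside  ∷ F} {zero}  i∉ = ⊥-elim (i∉ here)
∣added∣ {F = outside ∷ F} {zero}  i∉ = refl
∣added∣ {F = inside  ∷ F} {suc i} i∉ = cong suc (∣added∣ (i∉ ∘ there))
∣added∣ {F = outside ∷ F} {suc i} i∉ = ∣added∣ (i∉ ∘ there)

∣move∣ : ∀ {n} {F : Subset n} i j → i ∉ F → j ∈ F → ∣ move i j F ∣ ≡ ∣ F ∣
∣move∣ i j i∉ j∈ = trans (∣added∣ (i∉ ∘ proj₁ ∘ ∈-deleted⁻)) (∣deleted∣ j∈)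

shifted⇒swapClosed : ∀ {n} (K : SimplicialComplex n) → Shifted K → ∀ m → SwapClosed (FaceOfSize K m)
shifted⇒swapClosed K shifted m {F} i j i<j i∉ j∈ (s , f) =
  trans (∣move∣ i j i∉ j∈) s , shifted (move i j F) F f (∣move∣ i j i∉ j∈) (move-≤ᴾ i j i<j i∉ j∈)

-- Degrees and their conjugate partition

degrees-∑ : ∀ {n} {S : Subset n → Set} (S? : Decidable S) w →
  + Vec.lookup (degrees S?) w ≡ ∑ˢ (λ F → ⟦ S? F ⟧ * ⟦ w Subset.∈? F ⟧)
degrees-∑ {suc n} S? zero = trans (card-∑ (S? ∘ (inside ∷_))) (sym (trans (∑ˢ-suc n _) (trans (cong₂ _+_
  (∑ˢ-cong (λ F → ℤ.*-identityʳ ⟦ S? (inside ∷ F) ⟧))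
  (∑ˢ-zero (λ F → ℤ.*-zeroʳ ⟦ S? (outside ∷ F) ⟧))) (ℤ.+-identityʳ _))))
degrees-∑ {suc n} S? (suc w) = begin
  + Vec.lookup (zipWith ℕ._+_ (degrees (S? ∘ (inside ∷_))) (degrees (S? ∘ (outside ∷_)))) w
    ≡⟨ cong +_ (Vec.lookup-zipWith ℕ._+_ w (degrees (S? ∘ (inside ∷_))) (degrees (S? ∘ (outside ∷_)))) ⟩
  + Vec.lookup (degrees (S? ∘ (inside ∷_))) w + + Vec.lookup (degrees (S? ∘ (outside ∷_))) w
    ≡⟨ cong₂ _+_ (trans (degrees-∑ (S? ∘ (inside ∷_)) w) (∑ˢ-cong (shift inside)))
                 (trans (degrees-∑ (S? ∘ (outside ∷_)) w) (∑ˢ-cong (shift outside))) ⟩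
  _ ≡⟨ ∑ˢ-suc n _ ⟨
  ∑ˢ (λ F → ⟦ S? F ⟧ * ⟦ suc w Subset.∈? F ⟧) ∎
  where
  shift : ∀ b F → ⟦ S? (b ∷ F) ⟧ * ⟦ w Subset.∈? F ⟧ ≡ ⟦ S? (b ∷ F) ⟧ * ⟦ suc w Subset.∈? (b ∷ F) ⟧
  shift b F = cong (⟦ S? (b ∷ F) ⟧ *_) (⟦⟧-iff (w Subset.∈? F) (suc w Subset.∈? (b ∷ F)) there (λ { (there w∈) → w∈ }))

deg-∑ : ∀ {n} k (K : SimplicialComplex n) v → + deg k K v ≡ ∑ (facesOfSize K (suc k)) (λ F → ⟦ v Subset.∈? F ⟧)
deg-∑ k K v = length-filter (v Subset.∈?_) (facesOfSize K (suc k))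

deg-degrees : ∀ {n} k (K : SimplicialComplex n) w → deg k K w ≡ Vec.lookup (degrees (faceOfSize? K (suc k))) w
deg-degrees k K w = ℤ.+-injective (trans (deg-∑ k K w)
  (trans (∑-faces K (suc k) _) (sym (degrees-∑ (faceOfSize? K (suc k)) w))))

deg-relabel : ∀ {n} k (π : Permutation′ n) (K : SimplicialComplex n) v → deg k (relabel π K) (π ⟨$⟩ʳ v) ≡ deg k K v
deg-relabel k π K v = ℤ.+-injective (begin
  + deg k (relabel π K) (π ⟨$⟩ʳ v)
    ≡⟨ deg-∑ k (relabel π K) (π ⟨$⟩ʳ v) ⟩
  ∑ (facesOfSize (relabel π K) (suc k)) (λ F → ⟦ (π ⟨$⟩ʳ v) Subset.∈? F ⟧)
    ≡⟨ ∑-cong (facesOfSize (relabel π K) (suc k)) (λ F → ⟦⟧-iff ((π ⟨$⟩ʳ v) Subset.∈? F) (v Subset.∈? preimage π F) (∈-preimage⁺ π) (∈-preimage⁻ π)) ⟩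
  ∑ (facesOfSize (relabel π K) (suc k)) (λ F → ⟦ v Subset.∈? preimage π F ⟧)
    ≡⟨ ∑-map (preimage π) (facesOfSize (relabel π K) (suc k)) _ ⟨
  ∑ (map (preimage π) (facesOfSize (relabel π K) (suc k))) (λ F → ⟦ v Subset.∈? F ⟧)
    ≡⟨ ∑-↭ (faces-relabel π K (suc k)) _ ⟨
  ∑ (facesOfSize K (suc k)) (λ F → ⟦ v Subset.∈? F ⟧)
    ≡⟨ deg-∑ k K v ⟨
  + deg k K v ∎)

conjugate : ∀ {n} → Vec ℕ n → ℕ → ℕ
conjugate d r = length (filter (λ v → r ℕ.≤? Vec.lookup d v) (allFin _))

conjugate-sum : ∀ {n} (d : Vec ℕ n) r → + conjugate d r ≡ sum (λ v → ⟦ r ℕ.≤? Vec.lookup d v ⟧)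
conjugate-sum {n} d r = trans (length-filter (λ v → r ℕ.≤? Vec.lookup d v) (allFin n)) (∑-allFin (λ v → ⟦ r ℕ.≤? Vec.lookup d v ⟧))

conjugateDegree-degrees : ∀ {n} k (π : Permutation′ n) (K : SimplicialComplex n) r →
  conjugateDegree k K r ≡ conjugate (degrees (faceOfSize? (relabel π K) (suc k))) r
conjugateDegree-degrees {n} k π K r = ℤ.+-injective (begin
  + conjugateDegree k K r
    ≡⟨ trans (length-filter _ (allFin n)) (∑-allFin (λ v → ⟦ r ℕ.≤? deg k K v ⟧)) ⟩
  sum (λ v → ⟦ r ℕ.≤? deg k K v ⟧)
    ≡⟨ sum-cong-≗ (λ v → cong (λ d → ⟦ r ℕ.≤? d ⟧) (trans (sym (deg-relabel k π K v)) (deg-degrees k (relabel π K) (π ⟨$⟩ʳ v)))) ⟩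
  sum (λ v → ⟦ r ℕ.≤? Vec.lookup d (π ⟨$⟩ʳ v) ⟧)
    ≡⟨ sum-permute (λ w → ⟦ r ℕ.≤? Vec.lookup d w ⟧) π ⟨
  sum (λ w → ⟦ r ℕ.≤? Vec.lookup d w ⟧)
    ≡⟨ conjugate-sum d r ⟨
  + conjugate d r ∎)
  where
  d = degrees (faceOfSize? (relabel π K) (suc k))

conjugate-∷ : ∀ {n} d (e : Vec ℕ n) r → + conjugate (d ∷ e) r ≡ ⟦ r ℕ.≤? d ⟧ + + conjugate e r
conjugate-∷ d e r = trans (conjugate-sum (d ∷ e) r) (cong (λ z → ⟦ r ℕ.≤? d ⟧ + z) (sym (conjugate-sum e r)))

conjugate-beyond : ∀ {n} (d : Vec ℕ n) → Nonincreasing d → ∀ r → first d ≤ r → conjugate d (suc r) ≡ 0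
conjugate-beyond []      _       r d≤r = refl
conjugate-beyond (d ∷ e) (p , q) r d≤r = ℤ.+-injective (trans (conjugate-∷ d e (suc r))
  (cong₂ _+_ (⟦⟧-no (suc r ℕ.≤? d) (ℕ.<⇒≱ (ℕ.s≤s d≤r))) (cong +_ (conjugate-beyond e q r (ℕ.≤-trans p d≤r)))))

conjugate-positive : ∀ {n} (d : Vec ℕ n) r → r ℕ.< first d → + conjugate d (suc r) ≢ 0ℤ
conjugate-positive (d ∷ e) r r<d z with trans (sym (conjugate-∷ d e (suc r))) z
... | w rewrite dec-true (suc r ℕ.≤? d) r<d with () ← ℤ.+-injective w

∏-applyUpTo-∷ʳ : (f : ℕ → ℤ) (R : ℕ) → ∏ (applyUpTo f (suc R)) id ≡ ∏ (applyUpTo f R) id * f R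
∏-applyUpTo-∷ʳ f zero    = ℤ.*-comm (f 0) 1ℤ
∏-applyUpTo-∷ʳ f (suc R) = trans (cong (f 0 *_) (∏-applyUpTo-∷ʳ (f ∘ suc) R)) (sym (ℤ.*-assoc (f 0) _ _))

∏-applyUpTo-tail : (f : ℕ → ℤ) (y : ℤ) (R s : ℕ) → (∀ r → R ≤ r → f r ≡ y) →
  ∏ (applyUpTo f (s ℕ.+ R)) id ≡ y ^ s * ∏ (applyUpTo f R) id
∏-applyUpTo-tail f y R zero    h = sym (ℤ.*-identityˡ _)
∏-applyUpTo-tail f y R (suc s) h = begin
  ∏ (applyUpTo f (suc (s ℕ.+ R))) id ≡⟨ ∏-applyUpTo-∷ʳ f (s ℕ.+ R) ⟩
  ∏ (applyUpTo f (s ℕ.+ R)) id * f (s ℕ.+ R) ≡⟨ cong₂ _*_ (∏-applyUpTo-tail f y R s h) (h (s ℕ.+ R) (ℕ.m≤n+m R s)) ⟩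
  y ^ s * ∏ (applyUpTo f R) id * y ≡⟨ alg (y ^ s) (∏ (applyUpTo f R) id) y ⟩
  y * y ^ s * ∏ (applyUpTo f R) id ∎
  where
  alg : ∀ a b c → a * b * c ≡ c * a * b
  alg = solve-∀

∏-applyUpTo-cong : (f g : ℕ → ℤ) (R : ℕ) → (∀ r → r ℕ.< R → f r ≡ g r) → ∏ (applyUpTo f R) id ≡ ∏ (applyUpTo g R) id
∏-applyUpTo-cong f g zero    h = refl
∏-applyUpTo-cong f g (suc R) h = cong₂ _*_ (h 0 (ℕ.s≤s ℕ.z≤n)) (∏-applyUpTo-cong (f ∘ suc) (g ∘ suc) R (λ r r<R → h (suc r) (ℕ.s≤s r<R)))

-- The leading entry `d` adds 1 to each of the first `d` conjugate entries, which replaces `x` by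
-- `x - 1` for the rest. Beyond `first e` the conjugate of `e` is 0, and there the factors are plain
-- `x - 1`.
Ψ-conjugate : ∀ {n} (d : Vec ℕ n) → Nonincreasing d → ∀ x → ∏ (applyUpTo (λ r → x - + conjugate d (suc r)) (first d)) id ≡ Ψ d x
Ψ-conjugate []      _       x = refl
Ψ-conjugate (d ∷ e) (p , q) x = begin
  ∏ (applyUpTo (λ r → x - + conjugate (d ∷ e) (suc r)) d) id
    ≡⟨ ∏-applyUpTo-cong _ f d (λ r r<d → trans (cong (λ z → x - z) (trans (conjugate-∷ d e (suc r))
         (cong (λ z → z + + conjugate e (suc r)) (⟦⟧-yes (suc r ℕ.≤? d) r<d)))) (alg x (+ conjugate e (suc r)))) ⟩
  ∏ (applyUpTo f d) id
    ≡⟨ cong (λ R → ∏ (applyUpTo f R) id) (ℕ.m∸n+n≡m p) ⟨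
  ∏ (applyUpTo f (d ℕ.∸ first e ℕ.+ first e)) id
    ≡⟨ ∏-applyUpTo-tail f (x - 1ℤ) (first e) (d ℕ.∸ first e)
         (λ r e≤r → trans (cong (λ c → x - 1ℤ - + c) (conjugate-beyond e q r e≤r)) (ℤ.+-identityʳ (x - 1ℤ))) ⟩
  (x - 1ℤ) ^ (d ℕ.∸ first e) * ∏ (applyUpTo f (first e)) id
    ≡⟨ cong ((x - 1ℤ) ^ (d ℕ.∸ first e) *_) (Ψ-conjugate e q (x - 1ℤ)) ⟩
  (x - 1ℤ) ^ (d ℕ.∸ first e) * Ψ e (x - 1ℤ) ∎
  where
  f : ℕ → ℤ
  f r = x - 1ℤ - + conjugate e (suc r)
  alg : ∀ x c → x - (1ℤ + c) ≡ x - 1ℤ - c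
  alg = solve-∀

entry-applyUpTo-< : (f : ℕ → ℤ) {R r : ℕ} → r ℕ.< R → entry (applyUpTo f R) r ≡ f r
entry-applyUpTo-< f {suc R} {zero}  _           = refl
entry-applyUpTo-< f {suc R} {suc r} (ℕ.s≤s r<R) = entry-applyUpTo-< (f ∘ suc) r<R

entry-beyond : (μs : List ℤ) {r : ℕ} → length μs ≤ r → entry μs r ≡ 0ℤ
entry-beyond []       _                 = refl
entry-beyond (μ ∷ μs) {suc r} (ℕ.s≤s p) = entry-beyond μs p

-- Deleting the first vertex maps the facets through it injectively to faces of size `k`. This makes
-- the multiplicity `N ∸ first d` of the eigenvalue 0 a true difference.
first-degree≤faces : ∀ {n} (K : SimplicialComplex n) k → first (degrees (faceOfSize? K (suc k))) ≤ length (facesOfSize K k)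
first-degree≤faces {zero}  K k = ℕ.z≤n
first-degree≤faces {suc n} K k = ℕ.≤-trans
  (length-filter-mono (faceOfSize? K (suc k) ∘ (inside ∷_)) (faceOfSize? K k ∘ (outside ∷_))
    (λ F (s , f) → ℕ.suc-injective s , closed K (λ { (there v∈) → there v∈ }) f) (subsets n))
  (subst (card (faceOfSize? K k ∘ (outside ∷_)) ≤_) (sym (card-suc (faceOfSize? K k))) (ℕ.m≤n+m _ _))

shifted⇒spectrum : ∀ {n} k (π : Permutation′ n) (K : SimplicialComplex n) (o : Orientation n) →
  Shifted (relabel π K) → SpectrumIsConjugateDegrees k K o
shifted⇒spectrum {n} k π K o shifted = μs , record
  { nonincreasing = Linked.applyUpTo⁺₂ _ (first d) (λ r → ℤ.+≤+ (length-filter-mono _ _ (λ v → ℕ.≤-trans (ℕ.n≤1+n (suc r))) (allFin n)))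
  ; nonzero       = All.applyUpTo⁺₁ _ (first d) (λ {r} → conjugate-positive d r)
  ; z             = z
  ; total         = trans (cong (z ℕ.+_) (List.length-applyUpTo _ (first d))) (ℕ.m∸n+n≡m d₁≤N)
  ; splits        = λ x → trans (sym (charHom-charPoly (upLaplacian K o k) x))
                       (trans (charPoly-unique (upLaplacian K o k) z μs (trans (cong (z ℕ.+_) (List.length-applyUpTo _ (first d))) (ℕ.m∸n+n≡m d₁≤N)) agree x 1ℤ)
                         (cong (x ^ z *_) (trans (∏-cong∈ μs (λ {μ} _ → cong (λ m → x - m) (ℤ.*-identityˡ μ))) (sym (product-∏ x μs)))))
  } , λ r → entries r
  where
  K′ = relabel π K
  S? = faceOfSize? K′ (suc k)
  d = degrees S?
  sc : SwapClosed (FaceOfSize K′ (suc k))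
  sc = shifted⇒swapClosed K′ shifted (suc k)
  d↓ : Nonincreasing d
  d↓ = degrees-nonincreasing S? sc
  -- For nonincreasing `d` exactly the first `first d` conjugate entries are nonzero, so cutting off
  -- there keeps precisely those.
  μs = applyUpTo (λ r → + conjugate d (suc r)) (first d)
  N = length (facesOfSize K k)
  N≡ : N ≡ length (facesOfSize K′ k)
  N≡ = trans (Perm.↭-length (faces-relabel π K k)) (List.length-map (preimage π) (facesOfSize K′ k))
  d₁≤N : first d ≤ N
  d₁≤N = subst (first d ≤_) (sym N≡) (first-degree≤faces K′ k)
  z = N ℕ.∸ first d
  entries : ∀ r → entry μs r ≡ + conjugateDegree k K (suc r)
  entries r with r ℕ.<? first d
  ... | yes r<d = trans (entry-applyUpTo-< _ r<d) (cong +_ (sym (conjugateDegree-degrees k π K (suc r))))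
  ... | no r≮d  = trans (entry-beyond μs (subst (_≤ r) (sym (List.length-applyUpTo _ (first d))) (ℕ.≮⇒≥ r≮d)))
                    (cong +_ (sym (trans (conjugateDegree-degrees k π K (suc r)) (conjugate-beyond d d↓ r (ℕ.≮⇒≥ r≮d)))))
  T = length (filter (¬? ∘ faceOfSize? K′ k) (subsets n))
  -- Both sides are multiplied by `x ^ T`, the share of the subsets that are not faces of size `k`,
  -- and by the power of `x` from `χ-swapClosed`; they cancel since `x` is nonzero.
  large : ∀ t → n ℕ.< t → charPoly (upLaplacian K o k) (+ t) ≡ (+ t) ^ z * ∏ μs (λ μ → + t - μ)
  large t n<t = *-cancelʳ {k = x ^ T * x ^ first d} nonzero (begin
    C * (x ^ T * x ^ first d) ≡⟨ ℤ.*-assoc C _ _ ⟨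
    C * x ^ T * x ^ first d ≡⟨ cong (λ c → c * x ^ T * x ^ first d) (charPoly-relabel π K o k x) ⟩
    D * x ^ T * x ^ first d ≡⟨ cong (_* x ^ first d) (χ-faces K′ k x) ⟨
    χ S? x * x ^ first d ≡⟨ χ-swapClosed S? sc t n<t ⟩
    x ^ length (subsets n) * Ψ d x ≡⟨ cong₂ _*_ power (sym (trans products (Ψ-conjugate d d↓ x))) ⟩
    x ^ z * x ^ first d * x ^ T * P ≡⟨ alg (x ^ z) (x ^ first d) (x ^ T) P ⟩
    x ^ z * P * (x ^ T * x ^ first d) ∎)
    where
    x = + t
    C = charPoly (upLaplacian K o k) x
    D = detL (facesOfSize K′ k) (λ σ τ → x * δ σ τ - upLap S? σ τ)
    P = ∏ μs (λ μ → x - μ)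
    x≢0 : x ≢ 0ℤ
    x≢0 e = ℕ.<⇒≢ (ℕ.≤-<-trans ℕ.z≤n n<t) (sym (ℤ.+-injective e))
    nonzero : x ^ T * x ^ first d ≢ 0ℤ
    nonzero e = ^-nonzero (T ℕ.+ first d) x≢0 (trans (ℤ.^-distribˡ-+-* x T (first d)) e)
    power : x ^ length (subsets n) ≡ x ^ z * x ^ first d * x ^ T
    power = begin
      x ^ length (subsets n) ≡⟨ cong (x ^_) (length-filter-¬ (faceOfSize? K′ k) (subsets n)) ⟨
      x ^ (length (facesOfSize K′ k) ℕ.+ T) ≡⟨ cong (λ m → x ^ (m ℕ.+ T)) (trans (sym N≡) (sym (ℕ.m∸n+n≡m d₁≤N))) ⟩
      x ^ (z ℕ.+ first d ℕ.+ T) ≡⟨ ℤ.^-distribˡ-+-* x (z ℕ.+ first d) T ⟩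
      x ^ (z ℕ.+ first d) * x ^ T ≡⟨ cong (_* x ^ T) (ℤ.^-distribˡ-+-* x z (first d)) ⟩
      x ^ z * x ^ first d * x ^ T ∎
    products : P ≡ ∏ (applyUpTo (λ r → x - + conjugate d (suc r)) (first d)) id
    products = trans (sym (∏-map (λ μ → x - μ) μs id)) (cong (λ xs → ∏ xs id) (List.map-applyUpTo _ (λ μ → x - μ) (first d)))
    alg : ∀ a b c p → a * b * c * p ≡ a * p * (c * b)
    alg = solve-∀
  agree : Unboundedly (λ t → charPoly (upLaplacian K o k) (+ t) ≡ (+ t) ^ z * ∏ μs (λ μ → + t - μ))
  agree B = suc (B ℕ.+ n) , ℕ.s≤s (ℕ.m≤m+n B n) , large (suc (B ℕ.+ n)) (ℕ.s≤s (ℕ.m≤n+m n B))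

-- Inequalities between sums

module _ {A : Set} where

  ∑-mono : (xs : List A) {f g : A → ℤ} → (∀ {x} → x List.∈ xs → f x ℤ.≤ g x) → ∑ xs f ℤ.≤ ∑ xs g
  ∑-mono []       h = ℤ.≤-refl
  ∑-mono (x ∷ xs) h = ℤ.+-mono-≤ (h (here refl)) (∑-mono xs (h ∘ there))

  ∑-nonneg : (xs : List A) {f : A → ℤ} → (∀ {x} → x List.∈ xs → 0ℤ ℤ.≤ f x) → 0ℤ ℤ.≤ ∑ xs f
  ∑-nonneg xs h = subst (ℤ._≤ ∑ xs _) (∑-zero xs (λ _ → refl)) (∑-mono xs h)

  term≤∑ : {xs : List A} {f : A → ℤ} {x : A} → (∀ {x} → x List.∈ xs → 0ℤ ℤ.≤ f x) → x List.∈ xs → f x ℤ.≤ ∑ xs f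
  term≤∑ {y ∷ xs} {f} h (here refl) = subst (ℤ._≤ f y + ∑ xs f) (ℤ.+-identityʳ (f y)) (ℤ.+-monoʳ-≤ (f y) (∑-nonneg xs (h ∘ there)))
  term≤∑ {y ∷ xs} {f} {x} h (there x∈) = ℤ.≤-trans (term≤∑ {f = f} (h ∘ there) x∈)
    (subst (ℤ._≤ f y + ∑ xs f) (ℤ.+-identityˡ (∑ xs f)) (ℤ.+-monoˡ-≤ (∑ xs f) (h (here refl))))

  -- The differences are nonnegative and their sum is at most 0, which bounds each of them by 0.
  ∑-equal : (xs : List A) {f g : A → ℤ} → (∀ {x} → x List.∈ xs → f x ℤ.≤ g x) → ∑ xs g ℤ.≤ ∑ xs f →
    ∀ {x} → x List.∈ xs → f x ≡ g x
  ∑-equal xs {f} {g} h total {x} x∈ = sym (ℤ.i-j≡0⇒i≡j (g x) (f x) (ℤ.≤-antisym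
    (ℤ.≤-trans (term≤∑ {f = λ x → g x - f x} (λ x∈ → ℤ.i≤j⇒0≤j-i (h x∈)) x∈)
      (subst (ℤ._≤ 0ℤ) (sym difference) (ℤ.i≤j⇒i-j≤0 total)))
    (ℤ.i≤j⇒0≤j-i (h x∈))))
    where
    difference : ∑ xs (λ x → g x - f x) ≡ ∑ xs g - ∑ xs f
    difference = trans (∑-+ xs g (λ x → - f x)) (cong (λ z → ∑ xs g + z)
      (trans (∑-cong xs (λ x → sym (ℤ.-1*i≡-i (f x)))) (trans (∑-*ˡ xs -1ℤ f) (ℤ.-1*i≡-i (∑ xs f)))))

∑-product : {A B : Set} (xs : List A) (ys : List B) (f : A → ℤ) (g : B → ℤ) →
  ∑ xs f * ∑ ys g ≡ ∑ xs (λ x → ∑ ys (λ y → f x * g y))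
∑-product xs ys f g = trans (sym (∑-*ʳ xs (∑ ys g) f)) (∑-cong xs (λ x → sym (∑-*ˡ ys (f x) g)))

∑-comm₃ : {A B C : Set} (xs : List A) (ys : List B) (zs : List C) (h : A → B → C → ℤ) →
  ∑ xs (λ x → ∑ ys (λ y → ∑ zs (h x y))) ≡ ∑ zs (λ z → ∑ xs (λ x → ∑ ys (λ y → h x y z)))
∑-comm₃ xs ys zs h = trans (∑-cong xs (λ x → ∑-comm ys zs (h x))) (∑-comm xs zs (λ x z → ∑ ys (λ y → h x y z)))

⟦⟧-nonneg : {P : Set} (d : Dec P) → 0ℤ ℤ.≤ ⟦ d ⟧
⟦⟧-nonneg (yes _) = ℤ.+≤+ ℕ.z≤n
⟦⟧-nonneg (no _)  = ℤ.+≤+ ℕ.z≤n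

⟦⟧*≤ : {P : Set} (d : Dec P) {x : ℤ} → 0ℤ ℤ.≤ x → ⟦ d ⟧ * x ℤ.≤ x
⟦⟧*≤ (yes _) {x} 0≤x = ℤ.≤-reflexive (ℤ.*-identityˡ x)
⟦⟧*≤ (no _)  {x} 0≤x = subst (ℤ._≤ x) (sym (ℤ.*-zeroˡ x)) 0≤x

⟦⟧*⟦⟧-nonneg : {P Q : Set} (d : Dec P) (e : Dec Q) → 0ℤ ℤ.≤ ⟦ d ⟧ * ⟦ e ⟧
⟦⟧*⟦⟧-nonneg (yes _) (yes _) = ℤ.+≤+ ℕ.z≤n
⟦⟧*⟦⟧-nonneg (yes _) (no _)  = ℤ.+≤+ ℕ.z≤n
⟦⟧*⟦⟧-nonneg (no _)  (yes _) = ℤ.+≤+ ℕ.z≤n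
⟦⟧*⟦⟧-nonneg (no _)  (no _)  = ℤ.+≤+ ℕ.z≤n

⟦⟧-× : {P Q S : Set} (d : Dec P) (e : Dec Q) (c : Dec S) → (P → Q → S) → (S → P) → (S → Q) → ⟦ d ⟧ * ⟦ e ⟧ ≡ ⟦ c ⟧
⟦⟧-× (yes p) (yes q) c f g h = sym (⟦⟧-yes c (f p q))
⟦⟧-× (yes p) (no ¬q) c f g h = sym (⟦⟧-no c (¬q ∘ h))
⟦⟧-× (no ¬p) e       c f g h = trans (ℤ.*-zeroˡ ⟦ e ⟧) (sym (⟦⟧-no c (¬p ∘ g)))

sq-mono : ∀ {a b} → 0ℤ ℤ.≤ a → a ℤ.≤ b → a * a ℤ.≤ b * b
sq-mono {+ m} {+ n} _ (ℤ.+≤+ m≤n) = subst₂ ℤ._≤_ (ℤ.pos-* m m) (ℤ.pos-* n n) (ℤ.+≤+ (ℕ.*-mono-≤ m≤n m≤n))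

-- Exchanging two vertices

module _ {n : ℕ} where

  transpose-left : ∀ (i j : Fin n) → transpose i j ⟨$⟩ʳ i ≡ j
  transpose-left i j rewrite dec-true (i Fin.≟ i) refl = refl

  transpose-right : ∀ (i j : Fin n) → transpose i j ⟨$⟩ʳ j ≡ i
  transpose-right i j with j Fin.≟ i
  ... | yes j≡i = j≡i
  ... | no _ rewrite dec-true (j Fin.≟ j) refl = refl

  transpose-other : ∀ {i j v : Fin n} → v ≢ i → v ≢ j → transpose i j ⟨$⟩ʳ v ≡ v
  transpose-other {i} {j} {v} v≢i v≢j rewrite dec-false (v Fin.≟ i) v≢i | dec-false (v Fin.≟ j) v≢j = refl

  -- Unlike `move` this is an involution on all subsets, which makes it suitable for counting.
  exchange : Fin n → Fin n → Subset n → Subset n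
  exchange i j = preimage (transpose i j)

  exchange-≡ : ∀ i j (F G : Subset n) → Vec.lookup F j ≡ Vec.lookup G i → Vec.lookup F i ≡ Vec.lookup G j →
    (∀ {v} → v ≢ i → v ≢ j → Vec.lookup F v ≡ Vec.lookup G v) → exchange i j F ≡ G
  exchange-≡ i j F G at-i at-j at-v = subset-ext λ v → trans (lookup-preimage (transpose i j) F v) (go v (v Fin.≟ i) (v Fin.≟ j))
    where
    go : ∀ v → Dec (v ≡ i) → Dec (v ≡ j) → Vec.lookup F (transpose i j ⟨$⟩ʳ v) ≡ Vec.lookup G v
    go v (yes refl) _          = trans (cong (Vec.lookup F) (transpose-left v j)) at-i
    go v (no _)     (yes refl) = trans (cong (Vec.lookup F) (transpose-right i v)) at-j
    go v (no v≢i)   (no v≢j)   = trans (cong (Vec.lookup F) (transpose-other v≢i v≢j)) (at-v v≢i v≢j)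

  exchange-involutive : ∀ i j (F : Subset n) → exchange i j (exchange i j F) ≡ F
  exchange-involutive i j F = exchange-≡ i j (exchange i j F) F
    (trans (lookup-preimage (transpose i j) F j) (cong (Vec.lookup F) (transpose-right i j)))
    (trans (lookup-preimage (transpose i j) F i) (cong (Vec.lookup F) (transpose-left i j)))
    (λ {v} v≢i v≢j → trans (lookup-preimage (transpose i j) F v) (cong (Vec.lookup F) (transpose-other v≢i v≢j)))

  exchange-fixed : ∀ i j {F : Subset n} → i ∈ F → j ∈ F → exchange i j F ≡ F
  exchange-fixed i j {F} i∈ j∈ = exchange-≡ i j F F (trans (∈-lookup j∈) (sym (∈-lookup i∈))) (trans (∈-lookup i∈) (sym (∈-lookup j∈))) (λ _ _ → refl)

  ∉-lookup : ∀ {F : Subset n} {v} → v ∉ F → Vec.lookup F v ≡ outside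
  ∉-lookup {F} {v} v∉ with Vec.lookup F v in e
  ... | true  = ⊥-elim (v∉ (lookup-∈ e))
  ... | false = refl

  -- Distinct F and G with a common subset of codimension one.
  ridge-∉ : ∀ {F G : Subset n} {i j} → F ≢ G → i ∈ F → j ∈ G → F [ i ]≔ outside ≡ G [ j ]≔ outside → i ∉ G
  ridge-∉ {F} {G} {i} {j} F≢G i∈F j∈G e i∈G with i Fin.≟ j
  ... | no i≢j   = ∉-deleted F i (subst (i ∈_) (sym e) (∈-deleted⁺ i∈G i≢j))
  ... | yes refl = F≢G (subset-ext same)
    where
    same : ∀ v → Vec.lookup F v ≡ Vec.lookup G v
    same v with v Fin.≟ i
    ... | yes refl = trans (∈-lookup i∈F) (sym (∈-lookup i∈G))
    ... | no v≢i   = trans (sym (Vec.lookup∘update′ v≢i F outside)) (trans (cong (λ H → Vec.lookup H v) e) (Vec.lookup∘update′ v≢i G outside))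

  ridge-exchange : ∀ {F G : Subset n} {i j} → F ≢ G → i ∈ F → j ∈ G → F [ i ]≔ outside ≡ G [ j ]≔ outside → exchange i j F ≡ G
  ridge-exchange {F} {G} {i} {j} F≢G i∈ j∈ e = exchange-≡ i j F G
    (trans (∉-lookup (ridge-∉ (F≢G ∘ sym) j∈ i∈ (sym e))) (sym (∉-lookup (ridge-∉ F≢G i∈ j∈ e))))
    (trans (∈-lookup i∈) (sym (∈-lookup j∈)))
    (λ {v} v≢i v≢j → trans (sym (Vec.lookup∘update′ v≢i F outside)) (trans (cong (λ H → Vec.lookup H v) e) (Vec.lookup∘update′ v≢j G outside)))

  -- If a vertex other than `i` were removed from `F`, then `i` would survive in the common subset
  -- and so lie in `G`.
  ridge-unique : ∀ {F G : Subset n} {i j i′ j′} → F ≢ G → i ∈ F → j ∈ G → F [ i ]≔ outside ≡ G [ j ]≔ outside →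
    F [ i′ ]≔ outside ≡ G [ j′ ]≔ outside → F [ i′ ]≔ outside ≡ F [ i ]≔ outside
  ridge-unique {F} {G} {i} {j} {i′} {j′} F≢G i∈ j∈ e e′ with i Fin.≟ i′
  ... | yes refl = refl
  ... | no i≢i′  = ⊥-elim (ridge-∉ F≢G i∈ j∈ e (proj₁ (∈-deleted⁻ (subst (i ∈_) e′ (∈-deleted⁺ i∈ i≢i′)))))

signs-sq : ∀ m → (-1ℤ ^ m) * (-1ℤ ^ m) ≡ 1ℤ
signs-sq zero    = refl
signs-sq (suc m) = trans (*-interchange -1ℤ (-1ℤ ^ m) -1ℤ (-1ℤ ^ m)) (trans (ℤ.*-identityˡ _) (signs-sq m))

incidence-cases : ∀ {n} (o : Orientation n) σ F →
  incidence o σ F ≡ 0ℤ ⊎ incidence o σ F * incidence o σ F ≡ 1ℤ × ∃[ i ] i ∈ F × σ ≡ F [ i ]≔ outside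
incidence-cases o σ F with Fin.any? (λ i → σ ≟ˢ (F Subset.- lookup (vertices (o F)) i))
... | no _        = inj₁ refl
... | yes (i , e) = inj₂ (trans (*-interchange (-1ℤ ^ toℕ i) s (-1ℤ ^ toℕ i) s) (cong₂ _*_ (signs-sq (toℕ i)) (signs-sq (inversions xs ys))) ,
                          x , Equivalence.to (complete (o F) x) (List.∈-lookup i) , trans e (minus-update F x))
  where
  xs = removeAt (vertices (o F)) i
  ys = vertices (o σ)
  x = lookup (vertices (o F)) i
  s = sgn xs ys

-- The trace of the squared up-Laplacian counts exchanges between facets

module _ {n : ℕ} (K : SimplicialComplex n) (k : ℕ) (o : Orientation n) where

  private
    C = facesOfSize K (suc k)
    R = facesOfSize K k
    V = allFin n
    S? = faceOfSize? K (suc k)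
    L = upLaplacian K o k

    B : Subset n → Subset n → ℤ
    B = incidence o

  gram : Subset n → Subset n → ℤ
  gram F G = ∑ R (λ σ → B σ F * B σ G)

  -- The trace of `(B Bᵀ)²` regroups as that of `(Bᵀ B)²`: for fixed columns `F` and `G`, the sums
  -- over the two rows separate into two equal inner products.
  trace-gram : sum (λ a → square L a a) ≡ ∑ C (λ F → ∑ C (λ G → gram F G * gram F G))
  trace-gram = begin
    sum (λ a → square L a a)
      ≡⟨ sum-cong-≗ (λ a → trans (∑-allFin (λ b → L a b * L b a)) (trans
           (sum-cong-≗ (λ b → cong₂ _*_ (laplacian a b) (laplacian b a)))
           (sum-lookup R (λ τ → U (lookup R a) τ * U τ (lookup R a))))) ⟩
    sum (λ a → ∑ R (λ τ → U (lookup R a) τ * U τ (lookup R a)))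
      ≡⟨ sum-lookup R (λ σ → ∑ R (λ τ → U σ τ * U τ σ)) ⟩
    ∑ R (λ σ → ∑ R (λ τ → U σ τ * U τ σ))
      ≡⟨ ∑-cong R (λ σ → ∑-cong R (λ τ → ∑-product C C (λ F → B σ F * B τ F) (λ G → B τ G * B σ G))) ⟩
    ∑ R (λ σ → ∑ R (λ τ → ∑ C (λ F → ∑ C (λ G → B σ F * B τ F * (B τ G * B σ G)))))
      ≡⟨ ∑-comm₃ R R C (λ σ τ F → ∑ C (λ G → B σ F * B τ F * (B τ G * B σ G))) ⟩
    ∑ C (λ F → ∑ R (λ σ → ∑ R (λ τ → ∑ C (λ G → B σ F * B τ F * (B τ G * B σ G)))))
      ≡⟨ ∑-cong C (λ F → ∑-comm₃ R R C (λ σ τ G → B σ F * B τ F * (B τ G * B σ G))) ⟩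
    ∑ C (λ F → ∑ C (λ G → ∑ R (λ σ → ∑ R (λ τ → B σ F * B τ F * (B τ G * B σ G)))))
      ≡⟨ ∑-cong C (λ F → ∑-cong C (λ G → trans
           (∑-cong R (λ σ → ∑-cong R (λ τ → alg (B σ F) (B τ F) (B τ G) (B σ G))))
           (sym (∑-product R R (λ σ → B σ F * B σ G) (λ τ → B τ F * B τ G))))) ⟩
    ∑ C (λ F → ∑ C (λ G → gram F G * gram F G)) ∎
    where
    U = upLapᵒ K o k
    laplacian : ∀ a b → L a b ≡ U (lookup R a) (lookup R b)
    laplacian a b = sum-lookup C (λ F → B (lookup R a) F * B (lookup R b) F)
    alg : ∀ a b c d → a * b * (c * d) ≡ a * d * (b * c)
    alg = solve-∀

  exchanges : Subset n → Subset n → ℤ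
  exchanges F G = ∑ V (λ i → ∑ V (λ j → ⟦ i Subset.∈? F ⟧ * δ (exchange i j F) G))

  exchanges-nonneg : ∀ (F G : Subset n) i {j} → 0ℤ ℤ.≤ ⟦ i Subset.∈? F ⟧ * δ (exchange i j F) G
  exchanges-nonneg F G i {j} = ⟦⟧*⟦⟧-nonneg (i Subset.∈? F) (exchange i j F ≟ˢ G)

  -- A nonzero incidence with `F` has square 1 and comes from removing a member, so `gram F F` is at
  -- most the size of `F`. Its square is then at most the number of pairs of members, and exchanging
  -- two members fixes `F`.
  gram-diagonal : ∀ F → gram F F * gram F F ℤ.≤ exchanges F F
  gram-diagonal F = ℤ.≤-trans (sq-mono (∑-nonneg R (λ {σ} _ → nonneg σ)) gram≤size)
    (subst (ℤ._≤ exchanges F F) (sym (∑-product V V _ _))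
      (∑-mono V (λ {i} _ → ∑-mono V (λ {j} _ → fixed i j))))
    where
    nonneg : ∀ σ → 0ℤ ℤ.≤ B σ F * B σ F
    nonneg σ with incidence-cases o σ F
    ... | inj₁ z       = ℤ.≤-reflexive (sym (trans (cong (_* B σ F) z) (ℤ.*-zeroˡ (B σ F))))
    ... | inj₂ (s , _) = subst (0ℤ ℤ.≤_) (sym s) (ℤ.+≤+ ℕ.z≤n)
    pairs : ∀ σ → B σ F * B σ F ℤ.≤ ∑ V (λ i → ⟦ i Subset.∈? F ⟧ * δ σ (F [ i ]≔ outside))
    pairs σ with incidence-cases o σ F
    ... | inj₁ z = ℤ.≤-trans (ℤ.≤-reflexive (trans (cong (_* B σ F) z) (ℤ.*-zeroˡ (B σ F))))
                     (∑-nonneg V (λ {i} _ → ⟦⟧*⟦⟧-nonneg (i Subset.∈? F) (σ ≟ˢ (F [ i ]≔ outside))))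
    ... | inj₂ (s , i , i∈ , e) = ℤ.≤-trans
      (ℤ.≤-reflexive (trans s (sym (cong₂ _*_ (⟦⟧-yes (i Subset.∈? F) i∈) (⟦⟧-yes (σ ≟ˢ (F [ i ]≔ outside)) e)))))
      (term≤∑ {f = λ i → ⟦ i Subset.∈? F ⟧ * δ σ (F [ i ]≔ outside)} (λ {i} _ → ⟦⟧*⟦⟧-nonneg (i Subset.∈? F) (σ ≟ˢ (F [ i ]≔ outside))) (List.∈-allFin i))
    gram≤size : gram F F ℤ.≤ ∑ V (λ i → ⟦ i Subset.∈? F ⟧)
    gram≤size = ℤ.≤-trans (∑-mono R (λ {σ} _ → pairs σ))
      (subst (ℤ._≤ ∑ V (λ i → ⟦ i Subset.∈? F ⟧))
        (trans (∑-cong V (λ i → trans (ℤ.*-comm ⟦ S′? i ⟧ ⟦ i Subset.∈? F ⟧) (trans (cong (⟦ i Subset.∈? F ⟧ *_) (sym (count i))) (sym (∑-*ˡ R ⟦ i Subset.∈? F ⟧ _)))))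
               (∑-comm V R (λ i σ → ⟦ i Subset.∈? F ⟧ * δ σ (F [ i ]≔ outside))))
        (∑-mono V (λ {i} _ → ⟦⟧*≤ (S′? i) (⟦⟧-nonneg (i Subset.∈? F)))))
      where
      S′? : ∀ i → Dec (FaceOfSize K k (F [ i ]≔ outside))
      S′? i = faceOfSize? K k (F [ i ]≔ outside)
      count : ∀ i → ∑ R (λ σ → δ σ (F [ i ]≔ outside)) ≡ ⟦ S′? i ⟧
      count i = trans (∑-faces K k _) (∑ˢ-δ (λ σ → ⟦ faceOfSize? K k σ ⟧) (F [ i ]≔ outside))
    fixed : ∀ i j → ⟦ i Subset.∈? F ⟧ * ⟦ j Subset.∈? F ⟧ ℤ.≤ ⟦ i Subset.∈? F ⟧ * δ (exchange i j F) F
    fixed i j with i Subset.∈? F | j Subset.∈? F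
    ... | yes i∈ | yes j∈ = ℤ.≤-reflexive (sym (cong (1ℤ *_) (⟦⟧-yes (exchange i j F ≟ˢ F) (exchange-fixed i j i∈ j∈))))
    ... | yes i∈ | no _   = ⟦⟧*⟦⟧-nonneg (yes i∈) (exchange i j F ≟ˢ F)
    ... | no i∉  | yes _  = ⟦⟧*⟦⟧-nonneg (no i∉) (exchange i j F ≟ˢ F)
    ... | no i∉  | no _   = ⟦⟧*⟦⟧-nonneg (no i∉) (exchange i j F ≟ˢ F)

  Ridge : Subset n → Subset n → Subset n → Set
  Ridge F G σ = (B σ F * B σ F ≡ 1ℤ × ∃[ i ] i ∈ F × σ ≡ F [ i ]≔ outside) × (B σ G * B σ G ≡ 1ℤ × ∃[ j ] j ∈ G × σ ≡ G [ j ]≔ outside)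

  gram-term : ∀ F G σ → B σ F * B σ G ≡ 0ℤ ⊎ Ridge F G σ
  gram-term F G σ with incidence-cases o σ F | incidence-cases o σ G
  ... | inj₁ z | _      = inj₁ (trans (cong (_* B σ G) z) (ℤ.*-zeroˡ (B σ G)))
  ... | inj₂ _ | inj₁ z = inj₁ (trans (cong (B σ F *_) z) (ℤ.*-zeroʳ (B σ F)))
  ... | inj₂ p | inj₂ q = inj₂ (p , q)

  -- Distinct facets have at most one codimension one subset in common, so at most one term of the
  -- inner product is nonzero. Its square is 1, and the vertices in which the facets differ form a
  -- pair counted on the right.
  gram-off-diagonal : ∀ {F G} → F ≢ G → gram F G * gram F G ℤ.≤ exchanges F G
  gram-off-diagonal {F} {G} F≢G with search R
    where
    search : ∀ ρs → (∀ {σ} → σ List.∈ ρs → B σ F * B σ G ≡ 0ℤ) ⊎ ∃[ σ ] σ List.∈ ρs × Ridge F G σ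
    search []       = inj₁ (λ ())
    search (σ ∷ ρs) with gram-term F G σ | search ρs
    ... | inj₂ r | _                   = inj₂ (σ , here refl , r)
    ... | inj₁ z | inj₂ (τ , τ∈ , r)   = inj₂ (τ , there τ∈ , r)
    ... | inj₁ z | inj₁ zs             = inj₁ λ { (here refl) → z ; (there τ∈) → zs τ∈ }
  ... | inj₁ zs = subst (ℤ._≤ exchanges F G) (sym (cong₂ _*_ (∑-zero R zs) (∑-zero R zs)))
                    (∑-nonneg V (λ {i} _ → ∑-nonneg V (λ {j} _ → exchanges-nonneg F G i {j})))
  ... | inj₂ (σ , σ∈ , (s , i , i∈ , e) , (t , j , j∈ , e′)) = ℤ.≤-trans (ℤ.≤-reflexive value)
      (ℤ.≤-trans (term≤∑ {f = λ j → ⟦ i Subset.∈? F ⟧ * δ (exchange i j F) G} (λ {j} _ → exchanges-nonneg F G i {j}) (List.∈-allFin j))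
        (term≤∑ {f = λ i → ∑ V (λ j → ⟦ i Subset.∈? F ⟧ * δ (exchange i j F) G)} (λ {i} _ → ∑-nonneg V (λ {j} _ → exchanges-nonneg F G i {j})) (List.∈-allFin i)))
    where
    others : ∀ {ρ} → ρ List.∈ R → ρ ≢ σ → B ρ F * B ρ G ≡ 0ℤ
    others {ρ} _ ρ≢σ with gram-term F G ρ
    ... | inj₁ z = z
    ... | inj₂ ((_ , i′ , _ , d) , (_ , j′ , _ , d′)) =
      ⊥-elim (ρ≢σ (trans d (trans (ridge-unique F≢G i∈ j∈ (trans (sym e) e′) (trans (sym d) d′)) (sym e))))
    single : gram F G ≡ B σ F * B σ G
    single = ∑-only (faces-unique K k) σ∈ others
    value : gram F G * gram F G ≡ ⟦ i Subset.∈? F ⟧ * δ (exchange i j F) G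
    value = begin
      gram F G * gram F G ≡⟨ cong₂ _*_ single single ⟩
      B σ F * B σ G * (B σ F * B σ G) ≡⟨ *-interchange (B σ F) (B σ G) (B σ F) (B σ G) ⟩
      B σ F * B σ F * (B σ G * B σ G) ≡⟨ cong₂ _*_ s t ⟩
      1ℤ
        ≡⟨ cong₂ _*_ (⟦⟧-yes (i Subset.∈? F) i∈) (⟦⟧-yes (exchange i j F ≟ˢ G) (ridge-exchange F≢G i∈ j∈ (trans (sym e) e′))) ⟨
      ⟦ i Subset.∈? F ⟧ * δ (exchange i j F) G ∎

  gram-bound : ∀ F G → gram F G * gram F G ℤ.≤ exchanges F G
  gram-bound F G with F ≟ˢ G
  ... | yes refl = gram-diagonal F
  ... | no F≢G   = gram-off-diagonal F≢G

  exchangeable : Fin n → Fin n → ℤ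
  exchangeable i j = ∑ C (λ F → ⟦ i Subset.∈? F ⟧ * ⟦ S? (exchange i j F) ⟧)

  ∑-exchanges : ∑ C (λ F → ∑ C (λ G → exchanges F G)) ≡ ∑ V (λ i → ∑ V (λ j → exchangeable i j))
  ∑-exchanges = begin
    ∑ C (λ F → ∑ C (λ G → exchanges F G))
      ≡⟨ ∑-cong C (λ F → ∑-comm₃ V V C (λ i j G → ⟦ i Subset.∈? F ⟧ * δ (exchange i j F) G)) ⟨
    ∑ C (λ F → ∑ V (λ i → ∑ V (λ j → ∑ C (λ G → ⟦ i Subset.∈? F ⟧ * δ (exchange i j F) G))))
      ≡⟨ ∑-comm₃ V V C (λ i j F → ∑ C (λ G → ⟦ i Subset.∈? F ⟧ * δ (exchange i j F) G)) ⟨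
    ∑ V (λ i → ∑ V (λ j → ∑ C (λ F → ∑ C (λ G → ⟦ i Subset.∈? F ⟧ * δ (exchange i j F) G))))
      ≡⟨ ∑-cong V (λ i → ∑-cong V (λ j → ∑-cong C (λ F → trans (∑-*ˡ C ⟦ i Subset.∈? F ⟧ _) (cong (⟦ i Subset.∈? F ⟧ *_) (count (exchange i j F)))))) ⟩
    ∑ V (λ i → ∑ V (λ j → exchangeable i j)) ∎
    where
    count : ∀ H → ∑ C (λ G → δ H G) ≡ ⟦ S? H ⟧
    count H = trans (∑-faces K (suc k) _) (trans (∑ˢ-cong (λ G → cong (⟦ S? G ⟧ *_) (δ-sym H G))) (∑ˢ-δ (λ G → ⟦ S? G ⟧) H))

  exchangeable≤left : ∀ i j → exchangeable i j ℤ.≤ + deg k K i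
  exchangeable≤left i j = subst (exchangeable i j ℤ.≤_) (sym (deg-∑ k K i))
    (∑-mono C (λ {F} _ → subst (ℤ._≤ ⟦ i Subset.∈? F ⟧) (ℤ.*-comm ⟦ S? (exchange i j F) ⟧ ⟦ i Subset.∈? F ⟧)
      (⟦⟧*≤ (S? (exchange i j F)) (⟦⟧-nonneg (i Subset.∈? F)))))

  -- Reindexing by the involution `exchange i j` interchanges the roles of `F` and its image, and
  -- turns membership of `i` into membership of `j`.
  exchangeable≤right : ∀ i j → exchangeable i j ℤ.≤ + deg k K j
  exchangeable≤right i j = subst₂ ℤ._≤_ (sym reindexed) (sym (trans (deg-∑ k K j) (∑-faces K (suc k) _)))
    (∑-mono (subsets n) (λ {G} _ → ⟦⟧*≤ (S? (exchange i j G)) (⟦⟧*⟦⟧-nonneg (S? G) (j Subset.∈? G))))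
    where
    term : ∀ G → ⟦ S? (exchange i j G) ⟧ * (⟦ i Subset.∈? exchange i j G ⟧ * ⟦ S? (exchange i j (exchange i j G)) ⟧) ≡
      ⟦ S? (exchange i j G) ⟧ * (⟦ S? G ⟧ * ⟦ j Subset.∈? G ⟧)
    term G = cong (⟦ S? (exchange i j G) ⟧ *_) (trans (ℤ.*-comm ⟦ i Subset.∈? exchange i j G ⟧ _) (cong₂ _*_
      (cong (λ H → ⟦ S? H ⟧) (exchange-involutive i j G))
      (⟦⟧-iff (i Subset.∈? exchange i j G) (j Subset.∈? G)
        (λ i∈ → subst (_∈ G) (transpose-left i j) (∈-preimage⁻ (transpose i j) i∈))
        (λ j∈ → ∈-preimage⁺ (transpose i j) (subst (_∈ G) (sym (transpose-left i j)) j∈)))))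
    reindexed : exchangeable i j ≡ ∑ˢ (λ G → ⟦ S? (exchange i j G) ⟧ * (⟦ S? G ⟧ * ⟦ j Subset.∈? G ⟧))
    reindexed = trans (∑-faces K (suc k) _) (trans (∑-↭ (subsets-preimage (transpose i j)) _)
      (trans (∑-map (exchange i j) (subsets n) _) (∑ˢ-cong term)))

  exchangeable≤⊓ : ∀ i j → exchangeable i j ℤ.≤ + (deg k K i ℕ.⊓ deg k K j)
  exchangeable≤⊓ i j with ℕ.⊓-sel (deg k K i) (deg k K j)
  ... | inj₁ e rewrite e = exchangeable≤left i j
  ... | inj₂ e rewrite e = exchangeable≤right i j

  ∑-below : ∀ R m → m ≤ R → ∑ (upTo R) (λ r → ⟦ suc r ℕ.≤? m ⟧) ≡ + m
  ∑-below R       zero    _           = ∑-zero (upTo R) (λ _ → refl)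
  ∑-below (suc R) (suc m) (ℕ.s≤s m≤R) = cong (λ z → 1ℤ + z)
    (trans (cong (λ rs → ∑ rs (λ r → ⟦ suc r ℕ.≤? suc m ⟧)) (sym (List.map-upTo suc R)))
      (trans (∑-map suc (upTo R) (λ r → ⟦ suc r ℕ.≤? suc m ⟧)) (∑-below R m m≤R)))

  applyUpTo-entry : (μs : List ℤ) → applyUpTo (entry μs) (length μs) ≡ μs
  applyUpTo-entry []       = refl
  applyUpTo-entry (μ ∷ μs) = cong (μ ∷_) (applyUpTo-entry μs)

  module _ (μs : List ℤ) (entries : ∀ r → entry μs r ≡ + conjugateDegree k K (suc r)) where

    -- Otherwise the entry just beyond the end of `μs`, which is 0, would count `v`. Summing over
    -- the entries of `μs` therefore reaches every degree.
    deg≤length : ∀ v → deg k K v ≤ length μs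
    deg≤length v = ℕ.≮⇒≥ λ len<d → ℤ.<⇒≱ (ℤ.+<+ (ℕ.s≤s ℕ.z≤n)) (subst (1ℤ ℤ.≤_) zero-sum (one len<d))
      where
      zero-sum : ∑ V (λ w → ⟦ suc (length μs) ℕ.≤? deg k K w ⟧) ≡ 0ℤ
      zero-sum = trans (sym (length-filter _ V)) (trans (sym (entries (length μs))) (entry-beyond μs ℕ.≤-refl))
      one : length μs ℕ.< deg k K v → 1ℤ ℤ.≤ ∑ V (λ w → ⟦ suc (length μs) ℕ.≤? deg k K w ⟧)
      one len<d = subst (ℤ._≤ ∑ V (λ w → ⟦ suc (length μs) ℕ.≤? deg k K w ⟧)) (⟦⟧-yes (suc (length μs) ℕ.≤? deg k K v) len<d)
        (term≤∑ {f = λ w → ⟦ suc (length μs) ℕ.≤? deg k K w ⟧} (λ {w} _ → ⟦⟧-nonneg (suc (length μs) ℕ.≤? deg k K w)) (List.∈-allFin v))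

    -- The square of an entry counts pairs of vertices whose degrees both reach its index. A fixed
    -- pair is counted as often as its smaller degree says.
    ∑-squares : ∑ μs (λ μ → μ * μ) ≡ ∑ V (λ i → ∑ V (λ j → + (deg k K i ℕ.⊓ deg k K j)))
    ∑-squares = begin
      ∑ μs (λ μ → μ * μ)
        ≡⟨ cong (λ νs → ∑ νs (λ μ → μ * μ)) (trans (List.map-upTo (entry μs) N) (applyUpTo-entry μs)) ⟨
      ∑ (map (entry μs) (upTo N)) (λ μ → μ * μ)
        ≡⟨ ∑-map (entry μs) (upTo N) _ ⟩
      ∑ (upTo N) (λ r → entry μs r * entry μs r)
        ≡⟨ ∑-cong (upTo N) (λ r → trans (cong₂ _*_ (column r) (column r)) (∑-product V V _ _)) ⟩
      ∑ (upTo N) (λ r → ∑ V (λ i → ∑ V (λ j → bit i r * bit j r)))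
        ≡⟨ ∑-comm₃ V V (upTo N) (λ i j r → bit i r * bit j r) ⟨
      ∑ V (λ i → ∑ V (λ j → ∑ (upTo N) (λ r → bit i r * bit j r)))
        ≡⟨ ∑-cong V (λ i → ∑-cong V (λ j → trans (∑-cong (upTo N) (meet i j))
             (∑-below N _ (ℕ.≤-trans (ℕ.m⊓n≤m (deg k K i) (deg k K j)) (deg≤length i))))) ⟩
      ∑ V (λ i → ∑ V (λ j → + (deg k K i ℕ.⊓ deg k K j))) ∎
      where
      N = length μs
      bit : Fin n → ℕ → ℤ
      bit v r = ⟦ suc r ℕ.≤? deg k K v ⟧
      column : ∀ r → entry μs r ≡ ∑ V (λ v → bit v r)
      column r = trans (entries r) (length-filter _ V)
      meet : ∀ i j r → bit i r * bit j r ≡ ⟦ suc r ℕ.≤? (deg k K i ℕ.⊓ deg k K j) ⟧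
      meet i j r = ⟦⟧-× (suc r ℕ.≤? deg k K i) (suc r ℕ.≤? deg k K j) (suc r ℕ.≤? (deg k K i ℕ.⊓ deg k K j))
        ℕ.⊓-glb (λ q → ℕ.≤-trans q (ℕ.m⊓n≤m (deg k K i) (deg k K j))) (λ q → ℕ.≤-trans q (ℕ.m⊓n≤n (deg k K i) (deg k K j)))

    module _ (spectrum : NonzeroEigenvalues L μs) where

      -- The termwise bounds and the computation of `tr L²` close up to a circle of inequalities.
      -- `∑-equal` brings the equality from the double sum down to a row, and then from the row to
      -- an entry.
      exchangeable-⊓ : ∀ i j → exchangeable i j ≡ + (deg k K i ℕ.⊓ deg k K j)
      exchangeable-⊓ i j = ∑-equal V (λ {j} _ → exchangeable≤⊓ i j) (ℤ.≤-reflexive (sym rows)) (List.∈-allFin j)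
        where
        total : ∑ V (λ i → ∑ V (λ j → + (deg k K i ℕ.⊓ deg k K j))) ℤ.≤ ∑ V (λ i → ∑ V (λ j → exchangeable i j))
        total = subst₂ ℤ._≤_ (trans (sym trace-gram) (trans (trace-square L μs spectrum) ∑-squares)) ∑-exchanges
          (∑-mono C (λ {F} _ → ∑-mono C (λ {G} _ → gram-bound F G)))
        rows : ∑ V (λ j → exchangeable i j) ≡ ∑ V (λ j → + (deg k K i ℕ.⊓ deg k K j))
        rows = ∑-equal V {f = λ i → ∑ V (λ j → exchangeable i j)} (λ {i} _ → ∑-mono V (λ {j} _ → exchangeable≤⊓ i j)) total (List.∈-allFin i)

      -- Here the minimum is the degree of `j`, so the facets through `j` that admit the exchange
      -- are as many as all facets through `j`.
      facet-exchange : ∀ {i j F} → deg k K j ≤ deg k K i → FaceOfSize K (suc k) F → j ∈ F → FaceOfSize K (suc k) (exchange j i F)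
      facet-exchange {i} {j} {F} d≤ f j∈ = conclude (S? (exchange j i F)) (trans (sym (ℤ.*-identityˡ ⟦ S? (exchange j i F) ⟧))
        (trans (cong (_* ⟦ S? (exchange j i F) ⟧) (sym (⟦⟧-yes (j Subset.∈? F) j∈))) (trans equal (⟦⟧-yes (j Subset.∈? F) j∈))))
        where
        total : ∑ C (λ F → ⟦ j Subset.∈? F ⟧) ≡ exchangeable j i
        total = trans (sym (deg-∑ k K j)) (trans (cong +_ (sym (ℕ.m≤n⇒m⊓n≡m d≤))) (sym (exchangeable-⊓ j i)))
        equal : ⟦ j Subset.∈? F ⟧ * ⟦ S? (exchange j i F) ⟧ ≡ ⟦ j Subset.∈? F ⟧
        equal = ∑-equal C {f = λ F → ⟦ j Subset.∈? F ⟧ * ⟦ S? (exchange j i F) ⟧} {g = λ F → ⟦ j Subset.∈? F ⟧}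
          (λ {F} _ → subst (ℤ._≤ ⟦ j Subset.∈? F ⟧) (ℤ.*-comm ⟦ S? (exchange j i F) ⟧ ⟦ j Subset.∈? F ⟧) (⟦⟧*≤ (S? (exchange j i F)) (⟦⟧-nonneg (j Subset.∈? F))))
          (ℤ.≤-reflexive total) (∈-faces⁺ K (suc k) f)
        conclude : {P : Set} (d : Dec P) → ⟦ d ⟧ ≡ 1ℤ → P
        conclude (yes p) _ = p

-- From facets to all faces, and from swaps to the componentwise order

∈-move⁺ : ∀ {n} {F : Subset n} {i j v} → v ≡ i ⊎ v ∈ F × v ≢ j → v ∈ move i j F
∈-move⁺ {F = F} {i} {j} {v} h with v Fin.≟ i | h
... | yes refl | _                  = lookup-∈ (Vec.lookup∘update v (F [ j ]≔ outside) inside)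
... | no v≢i   | inj₁ v≡i           = ⊥-elim (v≢i v≡i)
... | no v≢i   | inj₂ (v∈ , v≢j)    = lookup-∈ (trans (Vec.lookup∘update′ v≢i (F [ j ]≔ outside) inside) (∈-lookup (∈-deleted⁺ v∈ v≢j)))

∈-move⁻ : ∀ {n} {F : Subset n} {i j v} → v ∈ move i j F → v ≡ i ⊎ v ∈ F × v ≢ j
∈-move⁻ {F = F} {i} {j} {v} v∈ with v Fin.≟ i
... | yes v≡i = inj₁ v≡i
... | no v≢i  = inj₂ (∈-deleted⁻ (lookup-∈ (trans (sym (Vec.lookup∘update′ v≢i (F [ j ]≔ outside) inside)) (∈-lookup v∈))))

-- Purity extends `F` to a facet `G`. If `i` already lies in `G`, then the swapped set stays inside
-- `G`; otherwise it lies inside the swapped facet.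
facets⇒faces : ∀ {n} (K : SimplicialComplex n) m → (∀ F → Face K F → ∃[ G ] Face K G × ∣ G ∣ ≡ m × F ⊆ G) →
  SwapClosed (FaceOfSize K m) → SwapClosed (Face K)
facets⇒faces K m pure sc {F} i j i<j i∉ j∈ f with pure F f
... | G , g , s , F⊆G with i Subset.∈? G
...   | yes i∈G = closed K within g
  where
  within : move i j F ⊆ G
  within v∈ with ∈-move⁻ v∈
  ... | inj₁ refl       = i∈G
  ... | inj₂ (v∈F , _) = F⊆G v∈F
...   | no i∉G  = closed K within (proj₂ (sc i j i<j i∉G (F⊆G j∈) (s , g)))
  where
  within : move i j F ⊆ move i j G
  within v∈ with ∈-move⁻ v∈
  ... | inj₁ v≡i         = ∈-move⁺ (inj₁ v≡i)
  ... | inj₂ (v∈F , v≢j) = ∈-move⁺ (inj₂ (F⊆G v∈F , v≢j))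

≤*-pred : ∀ {n} {xs ys : List (Fin n)} → map suc xs ≤* map suc ys → xs ≤* ys
≤*-pred = Pointwise.map ℕ.s≤s⁻¹ ∘ Pointwise.map⁻ suc suc

suc≰*zero : ∀ {n} (xs : List (Fin n)) {ys} → ¬ map suc xs ≤* zero ∷ ys
suc≰*zero (x ∷ xs) (() ∷ _)

increasing-view : ∀ {n} (G : Subset n) → increasing G ≡ [] ⊎ ∃[ g ] g ∈ G × increasing G ≡ g ∷ increasing (G [ g ]≔ outside)
increasing-view []            = inj₁ refl
increasing-view (inside  ∷ G) = inj₂ (zero , here , trans (increasing-inside G) (cong (zero ∷_) (sym (increasing-outside G))))
increasing-view (outside ∷ G) with increasing-view G
... | inj₁ e            = inj₁ (trans (increasing-outside G) (cong (map suc) e))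
... | inj₂ (g , g∈ , e) = inj₂ (suc g , there g∈ , trans (increasing-outside G)
                            (trans (cong (map suc) e) (cong (suc g ∷_) (sym (increasing-outside (G [ g ]≔ outside))))))

-- Vertices are settled from the first one on. If `F` contains the first vertex and `G` does not,
-- then the least member `g` of `G` is swapped for it; both increasing lists lose their heads, and
-- the comparison of the tails persists.
swapClosed-≤ᴾ : ∀ {n} {P : Subset n → Set} → SwapClosed P → ∀ F G → P G → F ≤ᴾ G → P F
swapClosed-≤ᴾ sc []            []            pG _ = pG
swapClosed-≤ᴾ sc (inside  ∷ F) (inside  ∷ G) pG F≤G
  with _ ∷ F≤G′ ← subst₂ _≤*_ (increasing-inside F) (increasing-inside G) F≤G =
  swapClosed-≤ᴾ (swapClosed-∷ inside sc) F G pG (≤*-pred F≤G′)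
swapClosed-≤ᴾ sc (outside ∷ F) (outside ∷ G) pG F≤G =
  swapClosed-≤ᴾ (swapClosed-∷ outside sc) F G pG (≤*-pred (subst₂ _≤*_ (increasing-outside F) (increasing-outside G) F≤G))
swapClosed-≤ᴾ sc (inside  ∷ F) (outside ∷ G) pG F≤G
  with subst₂ _≤*_ (increasing-inside F) (increasing-outside G) F≤G | increasing-view G
... | F≤G′ | inj₁ e with () ← subst (λ ys → zero ∷ map suc (increasing F) ≤* map suc ys) e F≤G′
... | F≤G′ | inj₂ (g , g∈ , e) with _ ∷ F≤G″ ← subst (λ ys → zero ∷ map suc (increasing F) ≤* map suc ys) e F≤G′ =
  swapClosed-≤ᴾ (swapClosed-∷ inside sc) F (G [ g ]≔ outside) (sc zero (suc g) (ℕ.s≤s ℕ.z≤n) (λ ()) (there g∈) pG) (≤*-pred F≤G″)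
swapClosed-≤ᴾ sc (outside ∷ F) (inside  ∷ G) pG F≤G =
  ⊥-elim (suc≰*zero (increasing F) (subst₂ _≤*_ (increasing-outside F) (increasing-inside G) F≤G))

-- Exchange and swap agree when the set contains exactly one of the two vertices. This lets a
-- symmetric exchange in the original labelling be read as a directed swap in the new one.
move-preimage : ∀ {n} (π : Permutation′ n) {G : Subset n} {i j} → π ⟨$⟩ʳ i ∉ G → π ⟨$⟩ʳ j ∈ G →
  exchange j i (preimage π G) ≡ preimage π (move (π ⟨$⟩ʳ i) (π ⟨$⟩ʳ j) G)
move-preimage π {G} {i} {j} i∉ j∈ = exchange-≡ j i (preimage π G) (preimage π M)
  (trans (lookup-preimage π G i) (trans (∉-lookup i∉) (sym (trans (lookup-preimage π M j) (∉-lookup j∉M)))))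
  (trans (lookup-preimage π G j) (trans (∈-lookup j∈) (sym (trans (lookup-preimage π M i) (∈-lookup (∈-move⁺ {F = G} {j = π ⟨$⟩ʳ j} (inj₁ refl)))))))
  (λ {v} v≢j v≢i → trans (lookup-preimage π G v) (sym (trans (lookup-preimage π M v)
    (trans (Vec.lookup∘update′ (v≢i ∘ perm-injective π) (G [ π ⟨$⟩ʳ j ]≔ outside) inside)
           (Vec.lookup∘update′ (v≢j ∘ perm-injective π) G outside)))))
  where
  M = move (π ⟨$⟩ʳ i) (π ⟨$⟩ʳ j) G
  j∉M : π ⟨$⟩ʳ j ∉ M
  j∉M j∈M with ∈-move⁻ j∈M
  ... | inj₁ e           = i∉ (subst (_∈ G) e j∈)
  ... | inj₂ (_ , j≢j)   = j≢j refl

spectrum⇒shifted : ∀ {n} k (K : SimplicialComplex n) → PureOfDimension k K → (o : Orientation n) →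
  SpectrumIsConjugateDegrees k K o →
  ∀ (π : Permutation′ n) → NonincreasingDegrees k (relabel π K) → Shifted (relabel π K)
spectrum⇒shifted k K pureK o (μs , spectrum , entries) π degrees↓ F G g _ F≤G =
  swapClosed-≤ᴾ (facets⇒faces K′ (suc k) pure facets) F G g F≤G
  where
  K′ = relabel π K
  pure : ∀ F → Face K′ F → ∃[ G ] Face K′ G × ∣ G ∣ ≡ suc k × F ⊆ G
  pure F f with PureOfDimension.pure pureK (preimage π F) f
  ... | H , h , s , F⊆H with preimage-surjective π H
  ...   | G , refl = G , h , trans (sym (∣preimage∣ π G)) s ,
          λ {w} w∈ → subst (_∈ G) (inverseʳ π) (∈-preimage⁻ π (F⊆H (∈-preimage⁺ π (subst (_∈ F) (sym (inverseʳ π)) w∈))))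
  -- The spectral hypothesis concerns `K`, so the exchange is made there, between the vertices
  -- labelled `j` and `i`, and carried over along `π`.
  facets : SwapClosed (FaceOfSize K′ (suc k))
  facets {F} i j i<j i∉ j∈ (s , f) = subst₂ (λ i j → FaceOfSize K′ (suc k) (move i j F)) (inverseʳ π) (inverseʳ π)
    (trans (sym (∣preimage∣ π M)) (subst (λ H → ∣ H ∣ ≡ suc k) moved (proj₁ swapped)) , subst (Face K) moved (proj₂ swapped))
    where
    i′ = π ⟨$⟩ˡ i
    j′ = π ⟨$⟩ˡ j
    M = move (π ⟨$⟩ʳ i′) (π ⟨$⟩ʳ j′) F
    j′∈ : π ⟨$⟩ʳ j′ ∈ F
    j′∈ = subst (_∈ F) (sym (inverseʳ π)) j∈
    deg-back : ∀ v → deg k K (π ⟨$⟩ˡ v) ≡ deg k K′ v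
    deg-back v = trans (sym (deg-relabel k π K (π ⟨$⟩ˡ v))) (cong (deg k K′) (inverseʳ π))
    swapped : FaceOfSize K (suc k) (exchange j′ i′ (preimage π F))
    swapped = facet-exchange K k o μs entries spectrum
      (subst₂ _≤_ (sym (deg-back j)) (sym (deg-back i)) (degrees↓ i j (ℕ.<⇒≤ i<j)))
      (trans (∣preimage∣ π F) s , f) (∈-preimage⁺ π j′∈)
    moved : exchange j′ i′ (preimage π F) ≡ preimage π M
    moved = move-preimage π (i∉ ∘ subst (_∈ F) (inverseʳ π)) j′∈

-- Sorting by degree

maximum : ∀ {n} (f : Fin (suc n) → ℕ) → ∃[ i ] ∀ j → f j ≤ f i
maximum {zero}  f = zero , λ { zero → ℕ.≤-refl }
maximum {suc n} f with maximum (f ∘ suc)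
... | i , h with ℕ.≤-total (f zero) (f (suc i))
...   | inj₁ p = suc i , λ { zero → p ; (suc j) → h j }
...   | inj₂ p = zero , λ { zero → ℕ.≤-refl ; (suc j) → ℕ.≤-trans (h j) p }

-- Selection sort: a place of maximal value is transposed to the front, and the rest is sorted
-- recursively.
sorting : ∀ {n} (f : Fin n → ℕ) → ∃[ ρ ] ∀ i j → i Fin.≤ j → f (ρ ⟨$⟩ʳ j) ≤ f (_⟨$⟩ʳ_ {n} {n} ρ i)
sorting {zero}  f = Permutation.id , λ ()
sorting {suc n} f with maximum f
... | m , h with sorting (λ v → f (transpose zero m ⟨$⟩ʳ suc v))
...   | ρ , sorted = lift₀ ρ ∘ₚ transpose zero m , λ
  { zero    j       _           → subst (f (transpose zero m ⟨$⟩ʳ (lift₀ ρ ⟨$⟩ʳ j)) ≤_) (cong f (sym (transpose-left zero m))) (h _)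
  ; (suc i) (suc j) (ℕ.s≤s i≤j) → sorted i j i≤j }

theorem3p12 : ∀ (n k : ℕ) → 1 ≤ k →
    (K : SimplicialComplex n) → PureOfDimension k K →
    (o : Orientation n) →
    (SpectrumIsConjugateDegrees k K o ⇔ (∃[ K′ ] Shifted K′ × K ≅ K′)) ×
    (SpectrumIsConjugateDegrees k K o →
    ∀ (π : Permutation′ n) → NonincreasingDegrees k (relabel π K) → Shifted (relabel π K))
theorem3p12 n k _ K pureK o = mk⇔ to from , spectrum⇒shifted k K pureK o
  where
  to : SpectrumIsConjugateDegrees k K o → ∃[ K′ ] Shifted K′ × K ≅ K′
  to spec with sorting (deg k K)
  ... | ρ , sorted = relabel π K , spectrum⇒shifted k K pureK o spec π degrees↓ , π , λ F → mk⇔ id id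
    where
    -- `sorting` sends places to vertices, whereas a relabelling sends vertices to labels.
    π = Permutation.flip ρ
    deg-back : ∀ v → deg k (relabel π K) v ≡ deg k K (ρ ⟨$⟩ʳ v)
    deg-back v = trans (cong (deg k (relabel π K)) (sym (inverseˡ ρ))) (deg-relabel k π K (ρ ⟨$⟩ʳ v))
    degrees↓ : NonincreasingDegrees k (relabel π K)
    degrees↓ i j i≤j = subst₂ _≤_ (sym (deg-back j)) (sym (deg-back i)) (sorted i j i≤j)
  from : (∃[ K′ ] Shifted K′ × K ≅ K′) → SpectrumIsConjugateDegrees k K o
  from (K′ , shifted , π , iso) = shifted⇒spectrum k π K o
    (λ F G g s F≤G → Equivalence.from (iso F) (shifted F G (Equivalence.to (iso G) g) s F≤G))
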